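{- Let $V$ be a group-like set. Then $V$ is $\mathbb{Q}$-like if and only if $\mathbb{Q}\cap[0,1]\subseteq V$ and $\mathrm{Homeo}(2^{\mathbb{N}},\mu_V)$ has the Rokhlin property.
   Context: All measures are Borel probability measures; $2^{\mathbb{N}}$ is the Cantor space. A measure is full if it is positive on every nonempty open set; the clopen values set of $\mu$ is $\{\mu(U): U\text{ clopen}\}$. A full measure $\mu$ on $2^{\mathbb{N}}$ is good if whenever $U,W$ are clopen with $\mu(U)<\mu(W)$, there is a clopen $W'\subseteq W$ with $\mu(W')=\mu(U)$. A set $V$ is group-like if it is countably infinite, $\{0,1\}\subseteq V\subseteq[0,1]$, and $V+\mathbb{Z}$ is an additive subgroup of $\mathbb{R}$. A group-like set $V$ is $\mathbb{Q}$-like if $V+\mathbb{Z}$ is a $\mathbb{Q}$-vector subspace of $\mathbb{R}$. For group-like $V$, $\mu_V$ denotes the good measure on $2^{\mathbb{N}}$ with clopen values set $V$ (it exists and is unique up to homeomorphism). $\mathrm{Homeo}(2^{\mathbb{N}},\mu_V)$ is the Polish group (compact-open topology) of homeomorphisms of $2^{\mathbb{N}}$ preserving $\mu_V$. A Polish group has the Rokhlin property if it admits a dense conjugacy class. -}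

module Defs where

open import Algebra.Bundles using (Group)
open import Data.Bool.Base using (Bool)
open import Data.Integer.Base using (ℤ)
open import Data.List.Base using (List; []; _∷_)
open import Data.List.Relation.Unary.All as All using (All; []; _∷_)
open import Data.List.Relation.Unary.Any using (Any)
open import Data.Nat.Base as ℕ using (ℕ; zero; suc; _⊔_)
import Data.Nat.Properties as ℕ
open import Data.Product.Base using (Σ; ∃; ∃-syntax; Σ-syntax; _×_; _,_; proj₁; proj₂)
open import Data.Rational.Base as ℚ using (ℚ; 0ℚ; 1ℚ; ½)
import Data.Rational.Properties as ℚ
open import Data.Rational.Solver using (module +-*-Solver)
open import Data.Unit.Base using (tt)
open import Function.Base using (_∘_)
open import Function.Bundles using (Bijection; Inverse; _⇔_)
import Function.Construct.Composition as Composition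
import Function.Construct.Identity as Identity
import Function.Construct.Symmetry as Symmetry
open import Level using (Level; 0ℓ) renaming (suc to lsuc; _⊔_ to _⊔ˡ_)
open import Relation.Binary.Bundles using (Setoid)
import Relation.Binary.Construct.On as On
open import Relation.Binary.Structures using (IsEquivalence)
open import Relation.Binary.Definitions using (_Respects_)
open import Relation.Binary.PropositionalEquality
  using (_≡_; _≢_; _≗_; _→-setoid_; refl; sym; trans; cong; cong₂; subst; setoid)
open import Relation.Unary
  using (Pred; U; ∁; _∩_; _⊆_; _≐_; _⊥_; _⊢_; ⋃; Satisfiable)

-- Real numbers are Cauchy sequences of rationals, equal when their
-- difference tends to 0.

IsCauchy : (ℕ → ℚ) → Set
IsCauchy x = ∀ ε → 0ℚ ℚ.< ε →
  ∃[ N ] (∀ m n → N ℕ.≤ m → N ℕ.≤ n → ℚ.∣ x m ℚ.- x n ∣ ℚ.< ε)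

record ℝ : Set where
  constructor mkℝ
  field
    seq    : ℕ → ℚ
    cauchy : IsCauchy seq

open ℝ public

infix 4 _≃_ _≤_ _<_

-- Records rather than functions, so that the two reals can be inferred.
record _≃_ (x y : ℝ) : Set where
  constructor mk≃
  field
    close : ∀ ε → 0ℚ ℚ.< ε →
      ∃[ N ] (∀ n → N ℕ.≤ n → ℚ.∣ seq x n ℚ.- seq y n ∣ ℚ.< ε)

record _≤_ (x y : ℝ) : Set where
  constructor mk≤
  field
    below : ∀ ε → 0ℚ ℚ.< ε →
      ∃[ N ] (∀ n → N ℕ.≤ n → seq x n ℚ.≤ seq y n ℚ.+ ε)

record _<_ (x y : ℝ) : Set where
  constructor mk<
  field
    gap   : ℚ
    0<gap : 0ℚ ℚ.< gap
    apart : ∃[ N ] (∀ n → N ℕ.≤ n → seq x n ℚ.+ gap ℚ.≤ seq y n)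

private
  0<½*ε : ∀ {ε} → 0ℚ ℚ.< ε → 0ℚ ℚ.< ½ ℚ.* ε
  0<½*ε {ε} p = subst (ℚ._< ½ ℚ.* ε) (ℚ.*-zeroʳ ½) (ℚ.*-monoʳ-<-pos ½ p)

  half+half : ∀ ε → ½ ℚ.* ε ℚ.+ ½ ℚ.* ε ≡ ε
  half+half ε = trans (sym (ℚ.*-distribʳ-+ ε ½ ½)) (ℚ.*-identityˡ ε)

  split : ∀ {ε a b} c → c ≡ a ℚ.+ b →
          ℚ.∣ a ∣ ℚ.< ½ ℚ.* ε → ℚ.∣ b ∣ ℚ.< ½ ℚ.* ε → ℚ.∣ c ∣ ℚ.< ε
  split {ε} {a} {b} _ refl p q =
    ℚ.≤-<-trans (ℚ.∣p+q∣≤∣p∣+∣q∣ a b)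
      (subst (ℚ.∣ a ∣ ℚ.+ ℚ.∣ b ∣ ℚ.<_) (half+half ε) (ℚ.+-mono-< p q))

  swap-∣-∣ : ∀ a b → ℚ.∣ a ℚ.- b ∣ ≡ ℚ.∣ b ℚ.- a ∣
  swap-∣-∣ a b = trans (sym (ℚ.∣-p∣≡∣p∣ (a ℚ.- b))) (cong ℚ.∣_∣ (lem a b))
    where
    open +-*-Solver
    lem : ∀ a b → ℚ.- (a ℚ.- b) ≡ b ℚ.- a
    lem = solve 2 (λ a b → :- (a :- b) := b :- a) refl

  telescope : ∀ a b c → a ℚ.- c ≡ (a ℚ.- b) ℚ.+ (b ℚ.- c)
  telescope = solve 3 (λ a b c → a :- c := (a :- b) :+ (b :- c)) refl
    where open +-*-Solver

  interchange : ∀ a b c d → (a ℚ.+ b) ℚ.- (c ℚ.+ d) ≡ (a ℚ.- c) ℚ.+ (b ℚ.- d)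
  interchange = solve 4 (λ a b c d → (a :+ b) :- (c :+ d) := (a :- c) :+ (b :- d)) refl
    where open +-*-Solver

  factor : ∀ q a b → q ℚ.* a ℚ.- q ℚ.* b ≡ q ℚ.* (a ℚ.- b)
  factor = solve 3 (λ q a b → q :* a :- q :* b := q :* (a :- b)) refl
    where open +-*-Solver

  bounded-scale : ∀ q b .{{_ : ℚ.Positive b}} → ℚ.∣ q ∣ ℚ.≤ b → ∀ ε → 0ℚ ℚ.< ε →
    ∃[ δ ] (0ℚ ℚ.< δ × (∀ d → ℚ.∣ d ∣ ℚ.< δ → ℚ.∣ q ℚ.* d ∣ ℚ.< ε))
  bounded-scale q b q≤b ε p = c ℚ.* ε , c*ε>0 , λ d d<δ →
    subst (ℚ._< ε) (sym (ℚ.∣p*q∣≡∣p∣*∣q∣ q d))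
      (ℚ.≤-<-trans
        (ℚ.*-monoʳ-≤-nonNeg ℚ.∣ d ∣ {{ℚ.∣-∣-nonNeg d}} q≤b)
        (subst (b ℚ.* ℚ.∣ d ∣ ℚ.<_) b*c*ε≡ε (ℚ.*-monoʳ-<-pos b d<δ)))
    where
    c : ℚ
    c = (ℚ.1/ b) {{ℚ.pos⇒nonZero b}}

    c*ε>0 : 0ℚ ℚ.< c ℚ.* ε
    c*ε>0 = subst (ℚ._< c ℚ.* ε) (ℚ.*-zeroʳ c)
              (ℚ.*-monoʳ-<-pos c {{ℚ.1/pos⇒pos b}} p)

    b*c*ε≡ε : b ℚ.* (c ℚ.* ε) ≡ ε
    b*c*ε≡ε = trans (sym (ℚ.*-assoc b c ε))
                (trans (cong (ℚ._* ε) (ℚ.*-inverseʳ b {{ℚ.pos⇒nonZero b}}))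
                  (ℚ.*-identityˡ ε))

  scale : ∀ q ε → 0ℚ ℚ.< ε →
    ∃[ δ ] (0ℚ ℚ.< δ × (∀ d → ℚ.∣ d ∣ ℚ.< δ → ℚ.∣ q ℚ.* d ∣ ℚ.< ε))
  scale q = bounded-scale q (ℚ.∣ q ∣ ℚ.+ 1ℚ)
    {{ℚ.positive (ℚ.+-mono-≤-< (ℚ.0≤∣p∣ q) (ℚ.positive⁻¹ 1ℚ))}}
    (subst (ℚ._≤ ℚ.∣ q ∣ ℚ.+ 1ℚ) (ℚ.+-identityʳ ℚ.∣ q ∣)
      (ℚ.+-monoʳ-≤ ℚ.∣ q ∣ (ℚ.nonNegative⁻¹ 1ℚ)))

-- Opaque, as normalising these proofs is expensive and never needed.
abstract
  ≃-isEquivalence : IsEquivalence _≃_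
  ≃-isEquivalence = record
    { refl  = λ {x} → mk≃ λ ε p → 0 , λ n _ →
        subst (ℚ._< ε) (cong ℚ.∣_∣ (sym (ℚ.+-inverseʳ (seq x n)))) p
    ; sym   = λ {x} {y} (mk≃ e) → mk≃ λ ε p → let (N , h) = e ε p in
        N , λ n l → subst (ℚ._< ε) (swap-∣-∣ (seq x n) (seq y n)) (h n l)
    ; trans = λ {x} {y} {z} (mk≃ e) (mk≃ f) → mk≃ λ ε p →
        let (M , h) = e (½ ℚ.* ε) (0<½*ε p)
            (N , k) = f (½ ℚ.* ε) (0<½*ε p)
        in M ⊔ N , λ n l →
             split _ (telescope (seq x n) (seq y n) (seq z n))
               (h n (ℕ.m⊔n≤o⇒m≤o M N l)) (k n (ℕ.m⊔n≤o⇒n≤o M N l))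
    }

  const-cauchy : ∀ q → IsCauchy (λ _ → q)
  const-cauchy q ε p = 0 , λ _ _ _ _ →
    subst (ℚ._< ε) (cong ℚ.∣_∣ (sym (ℚ.+-inverseʳ q))) p

  +-cauchy : ∀ x y → IsCauchy x → IsCauchy y → IsCauchy (λ n → x n ℚ.+ y n)
  +-cauchy x y cx cy ε p =
    let (M , h) = cx (½ ℚ.* ε) (0<½*ε p)
        (N , k) = cy (½ ℚ.* ε) (0<½*ε p)
    in M ⊔ N , λ m n l l′ →
         split _ (interchange (x m) (y m) (x n) (y n))
           (h m n (ℕ.m⊔n≤o⇒m≤o M N l) (ℕ.m⊔n≤o⇒m≤o M N l′))
           (k m n (ℕ.m⊔n≤o⇒n≤o M N l) (ℕ.m⊔n≤o⇒n≤o M N l′))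

  ·-cauchy : ∀ q x → IsCauchy x → IsCauchy (λ n → q ℚ.* x n)
  ·-cauchy q x cx ε p =
    let (δ , δ>0 , small) = scale q ε p
        (N , h)           = cx δ δ>0
    in N , λ m n l l′ →
         subst (λ d → ℚ.∣ d ∣ ℚ.< ε) (sym (factor q (x m) (x n)))
           (small (x m ℚ.- x n) (h m n l l′))

ℝ-setoid : Setoid 0ℓ 0ℓ
ℝ-setoid = record { isEquivalence = ≃-isEquivalence }

fromℚ : ℚ → ℝ
fromℚ q = mkℝ (λ _ → q) (const-cauchy q)

fromℤ : ℤ → ℝ
fromℤ k = fromℚ (k ℚ./ 1)

0ℝ 1ℝ : ℝ
0ℝ = fromℚ 0ℚ
1ℝ = fromℚ 1ℚ

infixl 6 _+_
infixl 7 _·_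
infix  8 -_

_+_ : ℝ → ℝ → ℝ
x + y = mkℝ (λ n → seq x n ℚ.+ seq y n) (+-cauchy (seq x) (seq y) (cauchy x) (cauchy y))

_·_ : ℚ → ℝ → ℝ
q · x = mkℝ (λ n → q ℚ.* seq x n) (·-cauchy q (seq x) (cauchy x))

-_ : ℝ → ℝ
- x = (ℚ.- 1ℚ) · x

sumℝ : ℕ → (ℕ → ℝ) → ℝ
sumℝ zero    a = 0ℝ
sumℝ (suc n) a = sumℝ n a + a n

infix 4 _⟶_

_⟶_ : (ℕ → ℝ) → ℝ → Set
s ⟶ r = ∀ ε → 0ℚ ℚ.< ε →
  ∃[ N ] (∀ n → N ℕ.≤ n → s n ≤ r + fromℚ ε × r ≤ s n + fromℚ ε)

record IsAdditiveSubgroup (W : Pred ℝ 0ℓ) : Set where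
  field
    0∈         : W 0ℝ
    +-closed   : ∀ {x y} → W x → W y → W (x + y)
    neg-closed : ∀ {x} → W x → W (- x)

record IsℚSubspace (W : Pred ℝ 0ℓ) : Set where
  field
    isAdditiveSubgroup : IsAdditiveSubgroup W
    ·-closed           : ∀ q {x} → W x → W (q · x)

_+ℤ : Pred ℝ 0ℓ → Pred ℝ 0ℓ
(V +ℤ) x = ∃[ v ] (V v × ∃[ k ] x ≃ v + fromℤ k)

record IsGroupLike (V : Pred ℝ 0ℓ) : Set where
  field
    -- V is a set of real numbers, not merely of representing sequences.
    resp              : V Respects _≃_
    countablyInfinite : Bijection (setoid ℕ) (On.setoid {B = ∃ V} ℝ-setoid proj₁)
    0∈                : V 0ℝ
    1∈                : V 1ℝ
    ⊆[0,1]            : ∀ {x} → V x → 0ℝ ≤ x × x ≤ 1ℝ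
    subgroup          : IsAdditiveSubgroup (V +ℤ)

record IsℚLike (V : Pred ℝ 0ℓ) : Set where
  field
    isGroupLike : IsGroupLike V
    subspace    : IsℚSubspace (V +ℤ)

-- The open sets of the topology generated by a subbase: every point of
-- O lies in a finite intersection of subbasic sets contained in O.
Generated : ∀ {a i ℓ} {X : Set a} {I : Set i} →
            (I → Pred X ℓ) → Pred (Pred X ℓ) (a ⊔ˡ i ⊔ˡ ℓ)
Generated {I = I} B O = ∀ {x} → O x →
  Σ[ is ∈ List I ] (All (λ i → B i x) is × (∀ {y} → All (λ i → B i y) is → O y))

Dense : ∀ {a ℓ o d} {X : Set a} → Pred (Pred X ℓ) o → Pred X d →
        Set (a ⊔ˡ lsuc ℓ ⊔ˡ o ⊔ˡ d)
Dense IsOpen D = ∀ {O} → IsOpen O → Satisfiable O → Satisfiable (O ∩ D)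

Cantor : Set
Cantor = ℕ → Bool

Open : Pred Cantor 0ℓ → Set
Open = Generated {I = ℕ × Bool} λ (n , b) x → x n ≡ b

Clopen : Pred Cantor 0ℓ → Set
Clopen A = Open A × Open (∁ A)

Compact : Pred Cantor 0ℓ → Set₁
Compact K = ∀ {I : Set} (O : I → Pred Cantor 0ℓ) → (∀ i → Open (O i)) →
  K ⊆ ⋃ I O → ∃[ is ] K ⊆ (λ x → Any (λ i → O i x) is)

Continuous : (Cantor → Cantor) → Set₁
Continuous f = ∀ {O} → Open O → Open (f ⊢ O)

data Borel : Pred Cantor 0ℓ → Set₁ where
  opens : ∀ {A} → Open A → Borel A
  compl : ∀ {A} → Borel A → Borel (∁ A)
  union : ∀ {As : ℕ → Pred Cantor 0ℓ} → (∀ n → Borel (As n)) → Borel (⋃ ℕ As)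
  resp  : ∀ {A B} → A ≐ B → Borel A → Borel B

Open-U : Open U
Open-U _ = [] , [] , λ _ → tt

record ProbabilityMeasure : Set₁ where
  field
    μ          : ∀ {A} → Borel A → ℝ
    -- μ depends only on the set, not on how it is seen to be Borel.
    μ-cong     : ∀ {A B} (a : Borel A) (b : Borel B) → A ≐ B → μ a ≃ μ b
    nonneg     : ∀ {A} (a : Borel A) → 0ℝ ≤ μ a
    total      : μ (opens Open-U) ≃ 1ℝ
    σ-additive : ∀ {As : ℕ → Pred Cantor 0ℓ} (as : ∀ n → Borel (As n)) →
                 (∀ {m n} → m ≢ n → As m ⊥ As n) →
                 (λ n → sumℝ n (λ k → μ (as k))) ⟶ μ (union as)

  μᶜ : ∀ {A} → Clopen A → ℝ
  μᶜ c = μ (opens (proj₁ c))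

module _ (M : ProbabilityMeasure) where
  open ProbabilityMeasure M

  IsFull : Set₁
  IsFull = ∀ {O} (o : Open O) → Satisfiable O → 0ℝ < μ (opens o)

  record IsGood : Set₁ where
    field
      full : IsFull
      good : ∀ {A B} (a : Clopen A) (b : Clopen B) → μᶜ a < μᶜ b →
             ∃[ C ] Σ[ c ∈ Clopen C ] (C ⊆ B × μᶜ c ≃ μᶜ a)

  ClopenValues : Pred ℝ (lsuc 0ℓ)
  ClopenValues r = ∃[ A ] Σ[ a ∈ Clopen A ] r ≃ μᶜ a

preimage-Borel : ∀ {f A} → Continuous f → Borel A → Borel (f ⊢ A)
preimage-Borel c (opens o)            = opens (c o)
preimage-Borel c (compl a)            = compl (preimage-Borel c a)
preimage-Borel c (union as)           = union λ n → preimage-Borel c (as n)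
preimage-Borel c (resp (A⊆B , B⊆A) a) = resp (A⊆B , B⊆A) (preimage-Borel c a)

module _ (M : ProbabilityMeasure) where
  open ProbabilityMeasure M

  record Homeo : Set₁ where
    field
      bijection       : Inverse (ℕ →-setoid Bool) (ℕ →-setoid Bool)
    open Inverse bijection public
    field
      to-continuous   : Continuous to
      from-continuous : Continuous from
      preserves       : ∀ {A} (a : Borel A) →
                        μ (preimage-Borel to-continuous a) ≃ μ a

open-resp-≗ : ∀ {O} → Open O → O Respects _≗_
open-resp-≗ o x≗y Ox with o Ox
... | _ , all , sub = sub (All.map (λ {i} → trans (sym (x≗y (proj₁ i)))) all)

borel-resp-≗ : ∀ {A} → Borel A → A Respects _≗_
borel-resp-≗ (opens o)            x≗y = open-resp-≗ o x≗y
borel-resp-≗ (compl a)            x≗y ¬Ax Ay = ¬Ax (borel-resp-≗ a (sym ∘ x≗y) Ay)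
borel-resp-≗ (union as)           x≗y (n , Ax) = n , borel-resp-≗ (as n) x≗y Ax
borel-resp-≗ (resp (A⊆B , B⊆A) a) x≗y Bx = A⊆B (borel-resp-≗ a x≗y (B⊆A Bx))

HomeoGroup : ProbabilityMeasure → Group (lsuc 0ℓ) 0ℓ
HomeoGroup M = record
  { Carrier = Homeo M
  ; _≈_     = λ f g → ∀ x → to f x ≗ to g x
  ; _∙_     = λ f g → record
    { bijection       = Composition.inverse (bijection g) (bijection f)
    ; to-continuous   = λ o → to-continuous g (to-continuous f o)
    ; from-continuous = λ o → from-continuous f (from-continuous g o)
    ; preserves       = λ a →
        ≃-trans (μ-cong _ _ ((λ z → z) , (λ z → z)))
          (≃-trans (preserves g (preimage-Borel (to-continuous f) a)) (preserves f a))
    }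
  ; ε       = record
    { bijection       = Identity.inverse _
    ; to-continuous   = λ o → o
    ; from-continuous = λ o → o
    ; preserves       = λ a → μ-cong _ _ ((λ z → z) , (λ z → z))
    }
  ; _⁻¹     = λ f → record
    { bijection       = Symmetry.inverse (bijection f)
    ; to-continuous   = from-continuous f
    ; from-continuous = to-continuous f
    ; preserves       = λ a →
        ≃-trans (≃-sym (preserves f (preimage-Borel (from-continuous f) a)))
          (μ-cong _ _ ( (λ {x} → borel-resp-≗ a (strictlyInverseʳ f x))
                      , (λ {x} → borel-resp-≗ a (sym ∘ strictlyInverseʳ f x)) ))
    }
  ; isGroup = record
    { isMonoid = record
      { isSemigroup = record
        { isMagma = record
          { isEquivalence = record
            { refl  = λ _ _ → refl
            ; sym   = λ e x n → sym (e x n)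
            ; trans = λ e e′ x n → trans (e x n) (e′ x n)
            }
          ; ∙-cong = λ {f} {f′} {g} {g′} e e′ x n →
              trans (to-cong f (e′ x) n) (e (to g′ x) n)
          }
        ; assoc = λ _ _ _ _ _ → refl
        }
      ; identity = (λ _ _ _ → refl) , (λ _ _ _ → refl)
      }
    ; inverse = (λ f x → strictlyInverseʳ f x) , (λ f x → strictlyInverseˡ f x)
    ; ⁻¹-cong = λ {f} {g} e x n →
        trans (sym (strictlyInverseʳ g (from f x) n))
          (from-cong g (λ k → trans (sym (e (from f x) k)) (strictlyInverseˡ f x k)) n)
    }
  }
  where
  open ProbabilityMeasure M
  open Homeo
  open Setoid ℝ-setoid using () renaming (sym to ≃-sym; trans to ≃-trans)

CompactOpen : (M : ProbabilityMeasure) → Pred (Pred (Homeo M) 0ℓ) (lsuc 0ℓ)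
CompactOpen M = Generated {I = ∃ Compact × ∃ Open} λ ((K , _) , (O , _)) h →
  K ⊆ (Homeo.to h ⊢ O)

module _ {c ℓ} (G : Group c ℓ) where
  open Group G

  ConjugacyClass : Carrier → Pred Carrier (c ⊔ˡ ℓ)
  ConjugacyClass g f = ∃[ h ] f ≈ h ∙ g ∙ h ⁻¹

  HasRokhlin : ∀ {ℓ′ o} → Pred (Pred Carrier ℓ′) o → Set (c ⊔ˡ ℓ ⊔ˡ lsuc ℓ′ ⊔ˡ o)
  HasRokhlin IsOpen = ∃[ g ] Dense IsOpen (ConjugacyClass g)

HomeoHasRokhlin : ProbabilityMeasure → Set₁
HomeoHasRokhlin M = HasRokhlin (HomeoGroup M) (CompactOpen M)

-- M is (a representative of the homeomorphism class of) μ_V.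
record IsGoodMeasureFor (V : Pred ℝ 0ℓ) (M : ProbabilityMeasure) : Set₁ where
  field
    isGood       : IsGood M
    clopenValues : ∀ r → V r ⇔ ClopenValues M r

module Submission where

-- If V is ℚ-like, every clopen set splits into n clopen pieces of equal measure.
-- A homeomorphism g is then built from partitions of the Cantor space into towers
-- of clopen sets, whose levels g permutes cyclically.  From one stage to the next
-- the levels shrink, the height of the towers is multiplied, and the towers are
-- cut so that the n-th item in an enumeration of finite lists of clopen values is
-- realised.  To approximate a given h up to finitely many clopen sets, regard each
-- point as an edge between the atoms that contain it and its image.  As h preserves
-- the measure this finite weighted graph is balanced, so its edges can be joined
-- into closed walks, that is, into towers of a periodic map.  These have the same
-- level sizes as towers of g, and matching the levels extends by back and forth to
-- a homeomorphism that conjugates g close to h.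
--
-- Conversely, if g has a dense conjugacy class, a conjugate of g permutes n clopen
-- sets of measure 1/n cyclically, and another one fixes a clopen set of measure v.
-- Pulled back to g itself, the fixed set meets each of the n sets in measure v/n.

open import Defs
open import Axiom.ExcludedMiddle using (ExcludedMiddle)
open import Data.Product.Base using (Σ; ∃; ∃₂; ∃-syntax; Σ-syntax; _×_; _,_; proj₁; proj₂; swap)
open import Data.Rational.Base as ℚ using (ℚ; 0ℚ; 1ℚ; ½)
open import Function.Bundles using (Bijection; Equivalence; _⇔_; mk⇔)
open import Level using (0ℓ; Lift; lift) renaming (suc to lsuc)
open import Relation.Unary using (Pred; ∁; _⊆_; _≐_; ⋃; _⊢_; _∪_; ∅)

import Algebra.Definitions.RawMonoid
import Algebra.Properties.CommutativeMonoid.Mult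
import Algebra.Properties.Monoid.Mult
open import Algebra.Bundles using (CommutativeMonoid; Group)
open import Data.Bool.Base using (Bool; true; false; _∧_; _∨_; not; if_then_else_)
import Data.Bool.Properties as Bool
open import Data.Empty using (⊥)
open import Data.Fin.Base as Fin using (Fin; zero; suc)
import Data.Fin.Properties as Fin
open import Data.Integer.Base as ℤ using (ℤ; +_; -[1+_])
import Data.Integer.Solver as ℤS
open import Data.List.Base as List using (List; []; _∷_; _++_; foldr; length)
open import Data.List.Membership.Propositional using (_∈_; find; lose)
open import Data.List.Membership.Propositional.Properties
  using (∈-map⁺; ∈-map⁻; ∈-concatMap⁺; ∈-concatMap⁻; ∈-allFin)
open import Data.List.Relation.Binary.Permutation.Propositional
  using (_↭_; ↭-sym; ↭-trans)
  renaming (refl to ↭-refl; prep to ↭-prep; swap to ↭-swap; trans to ↭-trans′)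
import Data.List.Relation.Binary.Permutation.Propositional.Properties as ↭
open import Data.List.Relation.Binary.Pointwise as Pointwise using (Pointwise; []; _∷_)
open import Data.List.Relation.Unary.All as All using (All; []; _∷_)
import Data.List.Relation.Unary.All.Properties as All
open import Data.List.Relation.Unary.Any as Any using (Any; here; there)
import Data.List.Relation.Unary.Any.Properties as Any
open import Data.Nat.Base as ℕ using (ℕ; zero; suc; _⊔_)
open import Data.Nat.Binary.Base as ℕᵇ using (ℕᵇ; 2[1+_]; 1+[2_])
import Data.Nat.Binary.Properties as ℕᵇ
import Data.Nat.Properties as ℕ
import Data.Rational.Properties as ℚ
open import Data.Rational.Solver using (module +-*-Solver)
open import Data.Rational.Unnormalised.Base as ℚᵘ using (mkℚᵘ; *≡*)
import Data.Rational.Unnormalised.Properties as ℚᵘ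
open import Data.Sum.Base as Sum using (_⊎_; inj₁; inj₂)
open import Data.Vec.Base as Vec using (Vec; []; _∷_; lookup; tabulate)
import Data.Vec.Properties as Vec
open import Data.Vec.Relation.Unary.All as AllV using ([]; _∷_) renaming (All to AllV)
import Data.Vec.Relation.Unary.All.Properties as AllV
open import Function.Base using (_∘_; id)
open import Relation.Binary.Bundles using (Setoid; Poset)
open import Relation.Binary.Definitions using (_Respects_; tri<; tri≈; tri>)
open import Relation.Binary.PropositionalEquality
  using (_≡_; _≢_; _≗_; refl; sym; trans; cong; cong₂; subst)
import Relation.Binary.Reasoning.PartialOrder
import Relation.Binary.Reasoning.Setoid as ≈-Reasoning
open import Relation.Nullary using (¬_; Dec; yes; no; contradiction)
open import Relation.Nullary.Decidable.Core using (isYes)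

-- Real numbers

open Setoid ℝ-setoid
  using () renaming (refl to ≃-refl; sym to ≃-sym; trans to ≃-trans)

-- For most of the proof a tower is only a tuple of clopen sets of equal measure, with no map
-- between its levels. Goodness can therefore cut every level on its own, and the map appears only
-- in the limit, when the levels have shrunk to points. A conjugacy between towers needs equal
-- heights as well as equal level measures. Divisibility handles the heights: a tower of height a,
-- cut into b thinner ones of equal measure that are stacked, gets height ab, and since its top
-- level leads back to its bottom level, the old transitions are respected. If the towers of g have
-- height a and those of a periodic approximation height b, both are brought to height ab. The level
-- measures then sum to 1/(ab) on either side, so the two families have a common refinement. As V is
-- countable, there are only countably many pairs of a height and a list of level measures, and one
-- g can serve them all. In the converse, a conjugate is only known to map each level into the next.
-- This gives inequalities, which become equalities because the levels form a cycle. Such a cycle of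
-- n sets exists because 1/n belongs to V.

pw : ∀ {x y} → (∀ n → seq x n ≡ seq y n) → x ≃ y
pw {x} {y} e = mk≃ λ ε p → 0 , λ n l →
  subst (λ z → ℚ.∣ seq x n ℚ.- z ∣ ℚ.< ε) (e n)
    (subst (ℚ._< ε) (cong ℚ.∣_∣ (sym (ℚ.+-inverseʳ (seq x n)))) p)

p≤∣p∣ : ∀ p → p ℚ.≤ ℚ.∣ p ∣
p≤∣p∣ p with ℚ.≤-total 0ℚ p
... | inj₁ 0≤p = ℚ.≤-reflexive (sym (ℚ.0≤p⇒∣p∣≡p 0≤p))
... | inj₂ p≤0 = ℚ.≤-trans p≤0 (ℚ.0≤∣p∣ p)

∣p∣< : ∀ {p q} → p ℚ.< q → ℚ.- p ℚ.< q → ℚ.∣ p ∣ ℚ.< q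
∣p∣< {p} {q} p<q -p<q with ℚ.∣p∣≡p∨∣p∣≡-p p
... | inj₁ e = subst (ℚ._< q) (sym e) p<q
... | inj₂ e = subst (ℚ._< q) (sym e) -p<q

0<½* : ∀ {ε} → 0ℚ ℚ.< ε → 0ℚ ℚ.< ½ ℚ.* ε
0<½* {ε} p = subst (ℚ._< ½ ℚ.* ε) (ℚ.*-zeroʳ ½) (ℚ.*-monoʳ-<-pos ½ p)

½*+½* : ∀ ε → ½ ℚ.* ε ℚ.+ ½ ℚ.* ε ≡ ε
½*+½* ε = trans (sym (ℚ.*-distribʳ-+ ε ½ ½)) (ℚ.*-identityˡ ε)

½*< : ∀ {ε} → 0ℚ ℚ.< ε → ½ ℚ.* ε ℚ.< ε
½*< {ε} p = subst (½ ℚ.* ε ℚ.<_) (½*+½* ε)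
  (subst (ℚ._< ½ ℚ.* ε ℚ.+ ½ ℚ.* ε) (ℚ.+-identityʳ _) (ℚ.+-monoʳ-< (½ ℚ.* ε) (0<½* p)))

-≤⇒≤+ : ∀ {a b ε} → a ℚ.- b ℚ.≤ ε → a ℚ.≤ b ℚ.+ ε
-≤⇒≤+ {a} {b} {ε} h = subst (ℚ._≤ b ℚ.+ ε) (lem a b) (ℚ.+-monoʳ-≤ b h)
  where
  open +-*-Solver
  lem : ∀ a b → b ℚ.+ (a ℚ.- b) ≡ a
  lem = solve 2 (λ a b → b :+ (a :- b) := a) refl

≤+⇒-≤ : ∀ {a b ε} → a ℚ.≤ b ℚ.+ ε → a ℚ.- b ℚ.≤ ε
≤+⇒-≤ {a} {b} {ε} h = subst (a ℚ.- b ℚ.≤_) (lem b ε) (ℚ.+-monoˡ-≤ (ℚ.- b) h)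
  where
  open +-*-Solver
  lem : ∀ b ε → b ℚ.+ ε ℚ.- b ≡ ε
  lem = solve 2 (λ b ε → b :+ ε :- b := ε) refl

≃⇒≤ : ∀ {x y} → x ≃ y → x ≤ y
≃⇒≤ {x} {y} (mk≃ e) = mk≤ λ ε p → let (N , h) = e ε p in N , λ n l →
  -≤⇒≤+ (ℚ.≤-trans (p≤∣p∣ _) (ℚ.<⇒≤ (h n l)))

≤-trans : ∀ {x y z} → x ≤ y → y ≤ z → x ≤ z
≤-trans {x} {y} {z} (mk≤ f) (mk≤ g) = mk≤ λ ε p →
  let (M , h) = f _ (0<½* p)
      (N , k) = g _ (0<½* p)
  in M ⊔ N , λ n l →
    ℚ.≤-trans (h n (ℕ.m⊔n≤o⇒m≤o M N l))
      (subst (seq y n ℚ.+ ½ ℚ.* ε ℚ.≤_)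
        (trans (ℚ.+-assoc (seq z n) _ _) (cong (seq z n ℚ.+_) (½*+½* ε)))
        (ℚ.+-monoˡ-≤ (½ ℚ.* ε) (k n (ℕ.m⊔n≤o⇒n≤o M N l))))

neg-minus : ∀ a b → ℚ.- (a ℚ.- b) ≡ b ℚ.- a
neg-minus = solve 2 (λ a b → :- (a :- b) := b :- a) refl
  where open +-*-Solver

≤-antisym : ∀ {x y} → x ≤ y → y ≤ x → x ≃ y
≤-antisym {x} {y} (mk≤ f) (mk≤ g) = mk≃ λ ε p →
  let (M , h) = f _ (0<½* p)
      (N , k) = g _ (0<½* p)
  in M ⊔ N , λ n l → ∣p∣<
    (ℚ.≤-<-trans (≤+⇒-≤ (h n (ℕ.m⊔n≤o⇒m≤o M N l))) (½*< p))
    (subst (ℚ._< ε) (sym (neg-minus (seq x n) (seq y n)))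
      (ℚ.≤-<-trans (≤+⇒-≤ (k n (ℕ.m⊔n≤o⇒n≤o M N l))) (½*< p)))

≤-refl : ∀ {x} → x ≤ x
≤-refl = ≃⇒≤ ≃-refl

ℝ-poset : Poset 0ℓ 0ℓ 0ℓ
ℝ-poset = record
  { _≈_ = _≃_ ; _≤_ = _≤_
  ; isPartialOrder = record
    { isPreorder = record
      { isEquivalence = ≃-isEquivalence ; reflexive = ≃⇒≤ ; trans = ≤-trans }
    ; antisym = ≤-antisym } }

+-mono-≤ : ∀ {x y u v} → x ≤ y → u ≤ v → x + u ≤ y + v
+-mono-≤ {x} {y} {u} {v} (mk≤ f) (mk≤ g) = mk≤ λ ε p →
  let (M , h) = f _ (0<½* p)
      (N , k) = g _ (0<½* p)
  in M ⊔ N , λ n l → subst (seq x n ℚ.+ seq u n ℚ.≤_)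
    (trans (lem (seq y n) (seq v n) (½ ℚ.* ε))
      (cong (seq y n ℚ.+ seq v n ℚ.+_) (½*+½* ε)))
    (ℚ.+-mono-≤ (h n (ℕ.m⊔n≤o⇒m≤o M N l)) (k n (ℕ.m⊔n≤o⇒n≤o M N l)))
  where
  open +-*-Solver
  lem : ∀ a b e → (a ℚ.+ e) ℚ.+ (b ℚ.+ e) ≡ a ℚ.+ b ℚ.+ (e ℚ.+ e)
  lem = solve 3 (λ a b e → (a :+ e) :+ (b :+ e) := a :+ b :+ (e :+ e)) refl

+-cong : ∀ {x y u v} → x ≃ y → u ≃ v → x + u ≃ y + v
+-cong e f = ≤-antisym (+-mono-≤ (≃⇒≤ e) (≃⇒≤ f)) (+-mono-≤ (≃⇒≤ (≃-sym e)) (≃⇒≤ (≃-sym f)))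

+-comm : ∀ x y → x + y ≃ y + x
+-comm x y = pw λ n → ℚ.+-comm (seq x n) (seq y n)

+-assoc : ∀ x y z → x + y + z ≃ x + (y + z)
+-assoc x y z = pw λ n → ℚ.+-assoc (seq x n) (seq y n) (seq z n)

+-identityˡ : ∀ x → 0ℝ + x ≃ x
+-identityˡ x = pw λ n → ℚ.+-identityˡ (seq x n)

+-identityʳ : ∀ x → x + 0ℝ ≃ x
+-identityʳ x = pw λ n → ℚ.+-identityʳ (seq x n)

+-cancelʳ-≤ : ∀ {x y} z → x + z ≤ y + z → x ≤ y
+-cancelʳ-≤ {x} {y} z h = ≤-trans (≃⇒≤ (pw λ n → lem (seq x n) (seq z n)))
  (≤-trans (+-mono-≤ h (≤-refl {ℚ.- 1ℚ · z})) (≃⇒≤ (pw λ n → sym (lem (seq y n) (seq z n)))))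
  where
  open +-*-Solver
  lem : ∀ a b → a ≡ a ℚ.+ b ℚ.+ ℚ.- 1ℚ ℚ.* b
  lem = solve 2 (λ a b → a := a :+ b :+ (con (ℚ.- 1ℚ)) :* b) refl

-- Addition with its definition hidden: unification against _+_ would unfold
-- to rational arithmetic.
infixl 6 _⊕_

abstract
  _⊕_ : ℝ → ℝ → ℝ
  x ⊕ y = x + y

  ⊕-≃ : ∀ x y → x ⊕ y ≃ x + y
  ⊕-≃ x y = ≃-refl

  ⊕-cong : ∀ {x y u v} → x ≃ y → u ≃ v → x ⊕ u ≃ y ⊕ v
  ⊕-cong = +-cong

  ⊕-comm : ∀ x y → x ⊕ y ≃ y ⊕ x
  ⊕-comm = +-comm

  ⊕-assoc : ∀ x y z → x ⊕ y ⊕ z ≃ x ⊕ (y ⊕ z)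
  ⊕-assoc = +-assoc

  ⊕-identityˡ : ∀ x → 0ℝ ⊕ x ≃ x
  ⊕-identityˡ = +-identityˡ

  ⊕-identityʳ : ∀ x → x ⊕ 0ℝ ≃ x
  ⊕-identityʳ = +-identityʳ

  ⊕-mono-≤ : ∀ {x y u v} → x ≤ y → u ≤ v → x ⊕ u ≤ y ⊕ v
  ⊕-mono-≤ = +-mono-≤

  ⊕-cancelʳ-≤ : ∀ {x y} z → x ⊕ z ≤ y ⊕ z → x ≤ y
  ⊕-cancelʳ-≤ = +-cancelʳ-≤

  ⊕-cancelʳ : ∀ {x y} z → x ⊕ z ≃ y ⊕ z → x ≃ y
  ⊕-cancelʳ z e = ≤-antisym (⊕-cancelʳ-≤ z (≃⇒≤ e)) (⊕-cancelʳ-≤ z (≃⇒≤ (≃-sym e)))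

ℝ-⊕ : CommutativeMonoid 0ℓ 0ℓ
ℝ-⊕ = record
  { _≈_ = _≃_ ; _∙_ = _⊕_ ; ε = 0ℝ
  ; isCommutativeMonoid = record
    { isMonoid = record
      { isSemigroup = record
        { isMagma = record { isEquivalence = ≃-isEquivalence ; ∙-cong = ⊕-cong }
        ; assoc = ⊕-assoc }
      ; identity = ⊕-identityˡ , ⊕-identityʳ }
    ; comm = ⊕-comm } }

·-cong : ∀ q {x y} → x ≃ y → q · x ≃ q · y
·-cong q {x} {y} (mk≃ e) = mk≃ λ ε p →
  let δ = ℚ.1/ b ℚ.* ε
      (N , h) = e δ (subst (ℚ._< δ) (ℚ.*-zeroʳ (ℚ.1/ b)) (ℚ.*-monoʳ-<-pos (ℚ.1/ b) p))
  in N , λ n l → ℚ.≤-<-trans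
       (ℚ.≤-reflexive (trans (cong ℚ.∣_∣ (factor (seq x n) (seq y n))) (ℚ.∣p*q∣≡∣p∣*∣q∣ q _)))
       (ℚ.≤-<-trans
         (ℚ.*-monoʳ-≤-nonNeg ℚ.∣ seq x n ℚ.- seq y n ∣ {{ℚ.∣-∣-nonNeg (seq x n ℚ.- seq y n)}} ∣q∣≤b)
         (subst (b ℚ.* ℚ.∣ seq x n ℚ.- seq y n ∣ ℚ.<_) (b*δ ε) (ℚ.*-monoʳ-<-pos b (h n l))))
  where
  open +-*-Solver
  b : ℚ
  -- The summand 1 keeps `b` invertible when `q` is 0.
  b = ℚ.∣ q ∣ ℚ.+ 1ℚ
  instance
    b-pos : ℚ.Positive b
    b-pos = ℚ.positive (ℚ.+-mono-≤-< (ℚ.0≤∣p∣ q) (ℚ.positive⁻¹ 1ℚ))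
    b-nonZero : ℚ.NonZero b
    b-nonZero = ℚ.pos⇒nonZero b
    1/b-pos : ℚ.Positive (ℚ.1/ b)
    1/b-pos = ℚ.1/pos⇒pos b
  ∣q∣≤b : ℚ.∣ q ∣ ℚ.≤ b
  ∣q∣≤b = subst (ℚ._≤ b) (ℚ.+-identityʳ ℚ.∣ q ∣) (ℚ.+-monoʳ-≤ ℚ.∣ q ∣ (ℚ.nonNegative⁻¹ 1ℚ))
  factor : ∀ a c → q ℚ.* a ℚ.- q ℚ.* c ≡ q ℚ.* (a ℚ.- c)
  factor = solve 3 (λ q a c → q :* a :- q :* c := q :* (a :- c)) refl q
  b*δ : ∀ ε → b ℚ.* (ℚ.1/ b ℚ.* ε) ≡ ε
  b*δ ε = trans (sym (ℚ.*-assoc b (ℚ.1/ b) ε))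
    (trans (cong (ℚ._* ε) (ℚ.*-inverseʳ b)) (ℚ.*-identityˡ ε))

fromℚ-½+½ : ∀ ε → fromℚ (½ ℚ.* ε) + fromℚ (½ ℚ.* ε) ≃ fromℚ ε
fromℚ-½+½ ε = pw λ _ → ½*+½* ε

≤-approx : ∀ {x y} → (∀ ε → 0ℚ ℚ.< ε → x ≤ y + fromℚ ε) → x ≤ y
≤-approx {x} {y} f = mk≤ λ ε p →
  let mk≤ g = f _ (0<½* p)
      (N , h) = g _ (0<½* p)
  in N , λ n l → subst (seq x n ℚ.≤_)
    (trans (ℚ.+-assoc (seq y n) _ _) (cong (seq y n ℚ.+_) (½*+½* ε))) (h n l)

<⇒≱ : ∀ {x y} → x < y → ¬ y ≤ x
<⇒≱ {x} {y} (mk< g 0<g (N , h)) (mk≤ f) =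
  let (M , k) = f _ (0<½* 0<g)
      n = M ⊔ N
  in ℚ.<-irrefl refl
    (ℚ.<-≤-trans
      (ℚ.+-monoʳ-< (seq x n) (½*< 0<g))
      (ℚ.≤-trans (h n (ℕ.m≤n⊔m M N)) (k n (ℕ.m≤m⊔n M N))))

<⇒≤ : ∀ {x y} → x < y → x ≤ y
<⇒≤ {x} {y} (mk< g 0<g (N , h)) = mk≤ λ ε p → N , λ n l →
  ℚ.≤-trans (a≤a+ (ℚ.<⇒≤ 0<g)) (ℚ.≤-trans (h n l) (a≤a+ (ℚ.<⇒≤ p)))
  where
  a≤a+ : ∀ {a b} → 0ℚ ℚ.≤ b → a ℚ.≤ a ℚ.+ b
  a≤a+ {a} {b} 0≤b = subst (ℚ._≤ a ℚ.+ b) (ℚ.+-identityʳ a) (ℚ.+-monoʳ-≤ a 0≤b)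

module ≤-Reasoning = Relation.Binary.Reasoning.PartialOrder ℝ-poset
open Algebra.Definitions.RawMonoid (CommutativeMonoid.rawMonoid ℝ-⊕) public
  using () renaming (_×_ to _⋆_)
open Algebra.Properties.CommutativeMonoid.Mult ℝ-⊕ public using () renaming (×-distrib-+ to ⋆-distrib-+)
open Algebra.Properties.Monoid.Mult (CommutativeMonoid.monoid ℝ-⊕) public
  using () renaming (×-congʳ to ⋆-congʳ; ×-assocˡ to ⋆-assocˡ; ×-homo-+ to ⋆-homo-+)

⋆-mono-≤ : ∀ n {x y} → x ≤ y → n ⋆ x ≤ n ⋆ y
⋆-mono-≤ zero    h = ≤-refl
⋆-mono-≤ (suc n) h = ⊕-mono-≤ h (⋆-mono-≤ n h)

⋆-zero : ∀ n → n ⋆ 0ℝ ≃ 0ℝ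
⋆-zero zero    = ≃-refl
⋆-zero (suc n) = ≃-trans (⊕-identityˡ _) (⋆-zero n)

-- Integer multiples and quotients of real numbers

fromℕ : ℕ → ℚ
fromℕ n = + n ℚ./ 1

/1-homo-+ : ∀ i j → (i ℤ.+ j) ℚ./ 1 ≡ i ℚ./ 1 ℚ.+ j ℚ./ 1
/1-homo-+ i j = ℚ.toℚᵘ-injective (begin
  ℚ.toℚᵘ ((i ℤ.+ j) ℚ./ 1)                  ≈⟨ ℚ.toℚᵘ-fromℚᵘ (mkℚᵘ (i ℤ.+ j) 0) ⟩
  mkℚᵘ (i ℤ.+ j) 0                          ≈⟨ *≡* (lem i j) ⟩
  mkℚᵘ i 0 ℚᵘ.+ mkℚᵘ j 0                    ≈⟨ ℚᵘ.+-cong (ℚ.toℚᵘ-fromℚᵘ (mkℚᵘ i 0)) (ℚ.toℚᵘ-fromℚᵘ (mkℚᵘ j 0)) ⟨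
  ℚ.toℚᵘ (i ℚ./ 1) ℚᵘ.+ ℚ.toℚᵘ (j ℚ./ 1)    ≈⟨ ℚ.toℚᵘ-homo-+ (i ℚ./ 1) (j ℚ./ 1) ⟨
  ℚ.toℚᵘ (i ℚ./ 1 ℚ.+ j ℚ./ 1)              ∎)
  where
  open ≈-Reasoning ℚᵘ.≃-setoid
  open ℤS.+-*-Solver
  lem : ∀ i j → (i ℤ.+ j) ℤ.* ℤ.+ 1 ≡ (i ℤ.* ℤ.+ 1 ℤ.+ j ℤ.* ℤ.+ 1) ℤ.* ℤ.+ 1
  lem = solve 2 (λ i j → (i :+ j) :* con (ℤ.+ 1) := (i :* con (ℤ.+ 1) :+ j :* con (ℤ.+ 1)) :* con (ℤ.+ 1)) refl

*-denominator : ∀ i n → (i ℚ./ suc n) ℚ.* ((+ suc n) ℚ./ 1) ≡ i ℚ./ 1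
*-denominator i n = ℚ.toℚᵘ-injective (begin
  ℚ.toℚᵘ ((i ℚ./ suc n) ℚ.* ((+ suc n) ℚ./ 1))              ≈⟨ ℚ.toℚᵘ-homo-* (i ℚ./ suc n) ((+ suc n) ℚ./ 1) ⟩
  ℚ.toℚᵘ (i ℚ./ suc n) ℚᵘ.* ℚ.toℚᵘ ((+ suc n) ℚ./ 1)        ≈⟨ ℚᵘ.*-cong (ℚ.toℚᵘ-fromℚᵘ (mkℚᵘ i n)) (ℚ.toℚᵘ-fromℚᵘ (mkℚᵘ (+ suc n) 0)) ⟩
  mkℚᵘ i n ℚᵘ.* mkℚᵘ (+ suc n) 0                            ≈⟨ *≡* (trans (lem i (+ suc n)) (cong (λ d → i ℤ.* + d) (sym (ℕ.*-identityʳ (suc n))))) ⟩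
  mkℚᵘ i 0                                                  ≈⟨ ℚ.toℚᵘ-fromℚᵘ (mkℚᵘ i 0) ⟨
  ℚ.toℚᵘ (i ℚ./ 1)                                          ∎)
  where
  open ≈-Reasoning ℚᵘ.≃-setoid
  open ℤS.+-*-Solver
  lem : ∀ i n → i ℤ.* n ℤ.* ℤ.+ 1 ≡ i ℤ.* n
  lem = solve 2 (λ i n → i :* n :* con (ℤ.+ 1) := i :* n) refl

fromℕ-⋆ : ∀ n x → fromℕ n · x ≃ n ⋆ x
fromℕ-⋆ zero    x = pw λ n → ℚ.*-zeroˡ (seq x n)
fromℕ-⋆ (suc n) x = ≃-trans
  (pw {y = x + fromℕ n · x} λ k → trans (cong (ℚ._* seq x k) (/1-homo-+ (+ 1) (+ n)))
    (trans (ℚ.*-distribʳ-+ (seq x k) 1ℚ (fromℕ n)) (cong (ℚ._+ fromℕ n ℚ.* seq x k) (ℚ.*-identityˡ (seq x k)))))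
  (≃-trans (≃-sym (⊕-≃ x (fromℕ n · x))) (⊕-cong ≃-refl (fromℕ-⋆ n x)))

infixl 7 _/ℕ_

_/ℕ_ : ℝ → (n : ℕ) → .{{ℕ.NonZero n}} → ℝ
x /ℕ n = (+ 1 ℚ./ n) · x

⋆-/ℕ : ∀ n x → suc n ⋆ (x /ℕ suc n) ≃ x
⋆-/ℕ n x = ≃-trans (≃-sym (fromℕ-⋆ (suc n) (x /ℕ suc n))) (pw λ k →
  trans (sym (ℚ.*-assoc (fromℕ (suc n)) (+ 1 ℚ./ suc n) (seq x k)))
    (trans (cong (ℚ._* seq x k) (trans (ℚ.*-comm (fromℕ (suc n)) (+ 1 ℚ./ suc n)) (*-denominator (+ 1) n)))
      (ℚ.*-identityˡ _)))

-- Once `x` has been divided by the denominator of `q`, scaling by `q` is an integer multiple.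
-- Closure of `V +ℤ` under rational scalars thus comes down to division by positive integers.
·-as-multiple : ∀ q {w x} → ℚ.↧ₙ q ⋆ w ≃ x → q · x ≃ (ℚ.↥ q ℚ./ 1) · w
·-as-multiple q@(ℚ.mkℚ i n c) {w} {x} e = ≃-trans (·-cong q (≃-sym e))
  (≃-trans (·-cong q (≃-sym (fromℕ-⋆ (suc n) w))) (pw λ k →
    trans (sym (ℚ.*-assoc q (fromℕ (suc n)) (seq w k)))
      (cong (ℚ._* seq w k)
        (trans (cong (ℚ._* fromℕ (suc n)) (sym (ℚ.↥p/↧p≡p q))) (*-denominator i n)))))

module _ {W : Pred ℝ 0ℓ} (W-resp : W Respects _≃_) (G : IsAdditiveSubgroup W) where
  open IsAdditiveSubgroup G

  ⋆-closed : ∀ n {x} → W x → W (n ⋆ x)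
  ⋆-closed zero    w = 0∈
  ⋆-closed (suc n) {x} w = W-resp (≃-sym (⊕-≃ x (n ⋆ x))) (+-closed w (⋆-closed n w))

  ℤ·-closed : ∀ k {x} → W x → W ((k ℚ./ 1) · x)
  ℤ·-closed (+ n)     {x} w = W-resp (≃-sym (fromℕ-⋆ n x)) (⋆-closed n w)
  ℤ·-closed -[1+ n ]  {x} w = W-resp
    (≃-trans (·-cong (ℚ.- 1ℚ) (≃-sym (fromℕ-⋆ (suc n) x))) (pw λ k → lem (fromℕ (suc n)) (seq x k)))
    (neg-closed (⋆-closed (suc n) w))
    where
    open +-*-Solver
    lem : ∀ a b → ℚ.- 1ℚ ℚ.* (a ℚ.* b) ≡ (ℚ.- a) ℚ.* b
    lem = solve 2 (λ a b → con (ℚ.- 1ℚ) :* (a :* b) := (:- a) :* b) refl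

+ℤ-resp : ∀ {V} → (V +ℤ) Respects _≃_
+ℤ-resp e (v , Vv , k , f) = v , Vv , k , ≃-trans (≃-sym e) f

fromℚ-mono-≤ : ∀ {p q} → p ℚ.≤ q → fromℚ p ≤ fromℚ q
fromℚ-mono-≤ {p} {q} h = mk≤ λ ε 0<ε → 0 , λ _ _ →
  ℚ.≤-trans h (subst (ℚ._≤ q ℚ.+ ε) (ℚ.+-identityʳ q) (ℚ.+-monoʳ-≤ q (ℚ.<⇒≤ 0<ε)))

1≤suc/1 : ∀ n → 1ℚ ℚ.≤ fromℕ (suc n)
1≤suc/1 n = subst (1ℚ ℚ.≤_) (sym (/1-homo-+ (+ 1) (+ n)))
  (subst (ℚ._≤ 1ℚ ℚ.+ fromℕ n) (ℚ.+-identityʳ 1ℚ) (ℚ.+-monoʳ-≤ 1ℚ (ℚ.nonNegative⁻¹ (fromℕ n) {{ℚ.normalize-nonNeg n 1}})))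

-- With `v` and `x` both in the unit interval, a shift by a positive integer forces `x` to be 1 and
-- a shift by a negative one forces it to be 0, and both values belong to `V`.
unit-interval-part : ∀ {V} → IsGroupLike V → ∀ {x} → (V +ℤ) x → 0ℝ ≤ x → x ≤ 1ℝ → V x
unit-interval-part {V} G {x} (v , Vv , k , e) 0≤x x≤1 = go k e
  where
  open IsGroupLike G renaming (resp to V-resp)
  open ≤-Reasoning
  go : ∀ k → x ≃ v + fromℤ k → V x
  go (+ zero)  e = V-resp (≃-sym (≃-trans e (+-identityʳ v))) Vv
  go (+ suc n) e = V-resp (≤-antisym (begin
      1ℝ                        ≤⟨ fromℚ-mono-≤ (1≤suc/1 n) ⟩
      fromℤ (+ suc n)           ≈⟨ +-identityˡ _ ⟨
      0ℝ + fromℤ (+ suc n)      ≤⟨ +-mono-≤ (proj₁ (⊆[0,1] Vv)) ≤-refl ⟩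
      v + fromℤ (+ suc n)       ≈⟨ e ⟨
      x                         ∎) x≤1) 1∈
  go -[1+ n ] e = V-resp (≤-antisym 0≤x (begin
      x                         ≈⟨ e ⟩
      v + fromℤ -[1+ n ]        ≤⟨ +-mono-≤ (proj₂ (⊆[0,1] Vv)) (fromℚ-mono-≤ (ℚ.neg-antimono-≤ (1≤suc/1 n))) ⟩
      1ℝ + fromℚ (ℚ.- 1ℚ)       ≈⟨ pw (λ _ → refl) ⟩
      0ℝ                        ∎)) 0∈

-- The order of the reals under excluded middle

module RealOrder (em : ∀ {P : Set} → Dec P) where

  dne : ∀ {P : Set} → ¬ ¬ P → P
  dne {P} ¬¬p with em {P}
  ... | yes p = p
  ... | no ¬p = contradiction ¬p ¬¬p

  -- If `x ≤ y` fails, then for some ε the sequence of `x` exceeds that of `y` by more than ε at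
  -- arbitrarily large indices. Beyond the point where both sequences vary by less than ε/4, one
  -- such index leaves a gap of ε/2 at all indices.
  ≰⇒> : ∀ {x y} → ¬ x ≤ y → y < x
  ≰⇒> {x} {y} ¬x≤y = dne λ ¬y<x → ¬x≤y (mk≤ λ ε p → dne λ ¬N → ¬y<x
    (let e   = ½ ℚ.* ε
         e′  = ½ ℚ.* e
         0<e = 0<½* p
         (A , a) = cauchy x _ (0<½* 0<e)
         (B , b) = cauchy y _ (0<½* 0<e)
         N = A ⊔ B
         (m , N≤m , far) = frequently N ¬N
     in mk< e 0<e (N , λ n N≤n → ℚ.≤-trans
          (bound (seq x n) (seq x m) (seq y n) (seq y m) e′ ε e (½*+½* e) (½*+½* ε) (ℚ.<⇒≤ (ℚ.≰⇒> far))
            (ℚ.≤-trans (p≤∣p∣ _) (ℚ.<⇒≤ (a m n (ℕ.m⊔n≤o⇒m≤o A B N≤m) (ℕ.m⊔n≤o⇒m≤o A B N≤n))))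
            (ℚ.≤-trans (p≤∣p∣ _) (ℚ.<⇒≤ (b n m (ℕ.m⊔n≤o⇒n≤o A B N≤n) (ℕ.m⊔n≤o⇒n≤o A B N≤m)))))
          ℚ.≤-refl)))
    where
    frequently : ∀ {P : ℕ → Set} N → ¬ (∃[ N ] (∀ n → N ℕ.≤ n → P n)) → ∃[ m ] (N ℕ.≤ m × ¬ P m)
    frequently N ¬N = dne λ h → ¬N (N , λ n N≤n → dne λ ¬p → h (n , N≤n , ¬p))
    bound : ∀ xn xm yn ym e′ ε e → e′ ℚ.+ e′ ≡ e → e ℚ.+ e ≡ ε → ym ℚ.+ ε ℚ.≤ xm →
            xm ℚ.- xn ℚ.≤ e′ → yn ℚ.- ym ℚ.≤ e′ → yn ℚ.+ e ℚ.≤ xn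
    bound xn xm yn ym e′ ε e refl refl f g h = begin
      yn ℚ.+ (e′ ℚ.+ e′)                                             ≡⟨ solve 3 (λ yn ym e → yn :+ (e :+ e) := (yn :- ym) :+ ((ym :+ ((e :+ e) :+ (e :+ e))) :- (e :+ e))) refl yn ym e′ ⟩
      (yn ℚ.- ym) ℚ.+ ((ym ℚ.+ ε) ℚ.- e)                             ≤⟨ ℚ.+-mono-≤ h (ℚ.+-monoˡ-≤ (ℚ.- e) f) ⟩
      e′ ℚ.+ (xm ℚ.- e)                                              ≡⟨ solve 3 (λ xm xn e → e :+ (xm :- (e :+ e)) := (xm :- xn) :+ (xn :- e)) refl xm xn e′ ⟩
      (xm ℚ.- xn) ℚ.+ (xn ℚ.- e′)                                    ≤⟨ ℚ.+-monoˡ-≤ _ g ⟩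
      e′ ℚ.+ (xn ℚ.- e′)                                             ≡⟨ solve 2 (λ xn e → e :+ (xn :- e) := xn) refl xn e′ ⟩
      xn                                                             ∎
      where
      open ℚ.≤-Reasoning
      open +-*-Solver

  data Compare (x y : ℝ) : Set where
    lt : x < y → Compare x y
    eq : x ≃ y → Compare x y
    gt : y < x → Compare x y

  compare : ∀ x y → Compare x y
  compare x y with em {x ≤ y} | em {y ≤ x}
  ... | no ¬p | _     = gt (≰⇒> ¬p)
  ... | yes p | no ¬q = lt (≰⇒> ¬q)
  ... | yes p | yes q = eq (≤-antisym p q)

  <-≤-trans : ∀ {x y z} → x < y → y ≤ z → x < z
  <-≤-trans x<y y≤z = ≰⇒> λ z≤x → <⇒≱ x<y (≤-trans y≤z z≤x)

  ≤-<-trans : ∀ {x y z} → x ≤ y → y < z → x < z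
  ≤-<-trans x≤y y<z = ≰⇒> λ z≤x → <⇒≱ y<z (≤-trans z≤x x≤y)

  ⊕-monoˡ-< : ∀ z {x y} → x < y → x ⊕ z < y ⊕ z
  ⊕-monoˡ-< z x<y = ≰⇒> λ h → <⇒≱ x<y (⊕-cancelʳ-≤ z h)

  ⋆-cancel-≤ : ∀ n {x y} → suc n ⋆ x ≤ suc n ⋆ y → x ≤ y
  ⋆-cancel-≤ n {x} {y} h = dne λ ¬x≤y →
    <⇒≱ (≤-<-trans (⊕-mono-≤ (≤-refl {y}) (⋆-mono-≤ n (<⇒≤ (≰⇒> ¬x≤y)))) (⊕-monoˡ-< (n ⋆ x) (≰⇒> ¬x≤y))) h

  ⋆-cancel : ∀ n {x y} → suc n ⋆ x ≃ suc n ⋆ y → x ≃ y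
  ⋆-cancel n e = ≤-antisym (⋆-cancel-≤ n (≃⇒≤ e)) (⋆-cancel-≤ n (≃⇒≤ (≃-sym e)))

-- Clopen sets and compactness

Agree : ℕ → Cantor → Cantor → Set
Agree n x y = ∀ i → i ℕ.< n → x i ≡ y i

agree-≤ : ∀ {m n x y} → m ℕ.≤ n → Agree n x y → Agree m x y
agree-≤ m≤n h i i<m = h i (ℕ.<-≤-trans i<m m≤n)

agree-sym : ∀ {n x y} → Agree n x y → Agree n y x
agree-sym h i i<n = sym (h i i<n)

agree-trans : ∀ {n x y z} → Agree n x y → Agree n y z → Agree n x z
agree-trans h k i i<n = trans (h i i<n) (k i i<n)

open⇒local : ∀ {O} → Open O → ∀ {x} → O x → ∃[ n ] (∀ {y} → Agree n x y → O y)
open⇒local {O} o {x} Ox = let (is , on , sub) = o Ox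
                              (n , h) = bound is on
                          in n , λ a → sub (h a)
  where
  bound : ∀ is → All (λ i → x (proj₁ i) ≡ proj₂ i) is →
          ∃[ n ] (∀ {y} → Agree n x y → All (λ i → y (proj₁ i) ≡ proj₂ i) is)
  bound []             []       = 0 , λ _ → []
  bound ((i , b) ∷ is) (e ∷ es) =
    let (n , h) = bound is es in
    suc i ⊔ n , λ a → trans (sym (a i (ℕ.m≤m⊔n (suc i) n))) e ∷ h (agree-≤ (ℕ.m≤n⊔m (suc i) n) a)

local⇒open : ∀ {O} → (∀ {x} → O x → ∃[ n ] (∀ {y} → Agree n x y → O y)) → Open O
local⇒open l {x} Ox =
  let (n , h) = l Ox in constraints n , satisfied n , λ on → h (agree n on)
  where
  constraints : ℕ → List (ℕ × Bool)
  constraints zero    = []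
  constraints (suc n) = (n , x n) ∷ constraints n
  satisfied : ∀ n → All (λ i → x (proj₁ i) ≡ proj₂ i) (constraints n)
  satisfied zero    = []
  satisfied (suc n) = refl ∷ satisfied n
  agree : ∀ n {y} → All (λ i → y (proj₁ i) ≡ proj₂ i) (constraints n) → Agree n x y
  agree (suc n) (e ∷ es) i i<sn with ℕ.m<1+n⇒m<n∨m≡n i<sn
  ... | inj₁ i<n  = agree n es i i<n
  ... | inj₂ refl = sym e

-- A clopen set as data: its characteristic function together with a number of coordinates that
-- determine it. Membership is decidable, Boolean operations are computed pointwise, and lists of
-- such sets stay in `Set`, where `em` applies.
record Clo : Set where
  constructor mkClo
  field
    χ     : Cantor → Bool
    depth : ℕ
    local : ∀ {x y} → Agree depth x y → χ x ≡ χ y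

open Clo public

infix 5 _∈ᶜ_

_∈ᶜ_ : Cantor → Clo → Set
x ∈ᶜ A = χ A x ≡ true

⟦_⟧ : Clo → Pred Cantor 0ℓ
⟦ A ⟧ x = x ∈ᶜ A

∈ᶜ-agree : ∀ A {x y} → Agree (depth A) x y → x ∈ᶜ A → y ∈ᶜ A
∈ᶜ-agree A a x∈A = trans (sym (local A a)) x∈A

χ-≗ : ∀ A {x y} → x ≗ y → χ A x ≡ χ A y
χ-≗ A e = local A λ i _ → e i

clopen : ∀ A → Clopen ⟦ A ⟧
clopen A = local⇒open (λ x∈A → depth A , λ a → ∈ᶜ-agree A a x∈A)
         , local⇒open (λ x∉A → depth A , λ a y∈A → x∉A (∈ᶜ-agree A (agree-sym a) y∈A))

full : Clo
full = mkClo (λ _ → true) 0 (λ _ → refl)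

infixl 7 _∩ᶜ_ _∖_

_∩ᶜ_ _∖_ : Clo → Clo → Clo
A ∩ᶜ B = mkClo (λ x → χ A x ∧ χ B x) (depth A ⊔ depth B) λ a →
  cong₂ _∧_ (local A (agree-≤ (ℕ.m≤m⊔n _ _) a)) (local B (agree-≤ (ℕ.m≤n⊔m _ _) a))
A ∖ B = mkClo (λ x → χ A x ∧ not (χ B x)) (depth A ⊔ depth B) λ a →
  cong₂ _∧_ (local A (agree-≤ (ℕ.m≤m⊔n _ _) a)) (cong not (local B (agree-≤ (ℕ.m≤n⊔m _ _) a)))

bit : ℕ → Clo
bit n = mkClo (λ x → x n) (suc n) (λ a → a n ℕ.≤-refl)

infix 4 _⊑_

_⊑_ : Clo → Clo → Set
A ⊑ B = ∀ x → x ∈ᶜ A → x ∈ᶜ B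

∩-⊑ˡ : ∀ A B → A ∩ᶜ B ⊑ A
∩-⊑ˡ A B x h with χ A x
... | true = refl

∩-⊑ʳ : ∀ A B → A ∩ᶜ B ⊑ B
∩-⊑ʳ A B x h with χ A x
... | true = h

∈-∩ : ∀ A B {x} → x ∈ᶜ A → x ∈ᶜ B → x ∈ᶜ A ∩ᶜ B
∈-∩ A B p q rewrite p = q

extend : Cantor → ℕ → Bool → Cantor
extend x n b i with i ℕ.≟ n
... | yes _ = b
... | no  _ = x i

extend-agree : ∀ x n b → Agree n x (extend x n b)
extend-agree x n b i i<n with i ℕ.≟ n
... | yes refl = contradiction i<n (ℕ.<-irrefl refl)
... | no  _    = refl

extend-at : ∀ x n b → extend x n b n ≡ b
extend-at x n b with n ℕ.≟ n
... | yes _ = refl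
... | no ¬p = contradiction refl ¬p

agree-extend : ∀ {x y} n → Agree n x y → Agree (suc n) (extend x n (y n)) y
agree-extend {x} {y} n a i i<sn with ℕ.m<1+n⇒m<n∨m≡n i<sn
... | inj₁ i<n  = trans (sym (extend-agree x n (y n) i i<n)) (a i i<n)
... | inj₂ refl = extend-at x n (y n)

module Compactness (em : ∀ {P : Set} → Dec P) where
  open RealOrder em using (dne)

  -- König's lemma: a bad cylinder of depth 0 has an infinite branch of bad
  -- subcylinders, whose limit point contradicts locality.
  fan : (R : Cantor → ℕ → Set) →
        (∀ {x y n} → Agree n x y → R x n → R y n) →
        (∀ x n → (∀ b → R (extend x n b) (suc n)) → R x n) →
        (∀ x → ∃[ n ] R x n) → ∀ x → R x 0
  fan R R-resp merge loc x₀ = dne λ ¬R₀ →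
    let open Branch ¬R₀
        (n , Rzn) = loc limit
    in proj₂ (branch n) (R-resp (limit-agree n) Rzn)
    where
    step : ∀ n → ((x , _) : ∃[ x ] ¬ R x n) → Σ[ (y , _) ∈ (∃[ y ] ¬ R y (suc n)) ] Agree n x y
    step n (x , ¬R) with em {R (extend x n true) (suc n)}
    ... | no ¬R₁ = (_ , ¬R₁) , extend-agree x n true
    ... | yes R₁ = (_ , λ R₂ → ¬R (merge x n λ { true → R₁ ; false → R₂ })) , extend-agree x n false
    module Branch (¬R₀ : ¬ R x₀ 0) where
      branch : ∀ n → ∃[ x ] ¬ R x n
      branch zero    = x₀ , ¬R₀
      branch (suc n) = proj₁ (step n (branch n))
      limit : Cantor
      limit n = proj₁ (branch (suc n)) n
      limit-agree : ∀ n → Agree n limit (proj₁ (branch n))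
      limit-agree (suc n) i i<sn with ℕ.m<1+n⇒m<n∨m≡n i<sn
      ... | inj₁ i<n  = trans (limit-agree n i i<n) (proj₂ (step n (branch n)) i i<n)
      ... | inj₂ refl = refl

  origin : Cantor
  origin _ = false

  agree-zero : ∀ {x y} → Agree 0 x y
  agree-zero _ ()

  clopen⇒uniform : ∀ {A} → Clopen A → ∃[ n ] (∀ {y z} → Agree n y z → A y → A z)
  clopen⇒uniform {A} (o , o′) =
    let (n , h) = fan R R-resp merge loc origin in n , λ a → h agree-zero agree-zero a
    where
    R : Cantor → ℕ → Set
    R x n = ∃[ m ] (∀ {y z} → Agree n x y → Agree n x z → Agree m y z → A y → A z)
    R-resp : ∀ {x y n} → Agree n x y → R x n → R y n
    R-resp a (m , h) = m , λ p q → h (agree-trans a p) (agree-trans a q)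
    merge : ∀ x n → (∀ b → R (extend x n b) (suc n)) → R x n
    -- The modulus exceeds `n`, so `y` and `z` lie in the same half of the cylinder, and the modulus
    -- of that half applies.
    merge x n r = suc n ⊔ (M true ⊔ M false) , λ {y} {z} p q a →
      proj₂ (r (y n))
        (agree-extend n p)
        (subst (λ b → Agree (suc n) (extend x n b) z) (sym (a n (ℕ.m≤m⊔n (suc n) (M true ⊔ M false)))) (agree-extend n q))
        (agree-≤ (ℕ.≤-trans (M≤ (y n)) (ℕ.m≤n⊔m (suc n) _)) a)
      where
      M : Bool → ℕ
      M b = proj₁ (r b)
      M≤ : ∀ b → M b ℕ.≤ M true ⊔ M false
      M≤ true  = ℕ.m≤m⊔n _ _
      M≤ false = ℕ.m≤n⊔m _ _
    loc : ∀ x → ∃[ n ] R x n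
    loc x with em {A x}
    ... | yes Ax = let (n , h) = open⇒local o Ax in n , 0 , λ _ q _ _ → h q
    ... | no ¬Ax = let (n , h) = open⇒local o′ ¬Ax in n , 0 , λ p _ _ Ay → contradiction Ay (h p)

  fromPred : (A : Pred Cantor 0ℓ) (n : ℕ) → (∀ {y z} → Agree n y z → A y → A z) → Clo
  fromPred A n h = mkClo (λ x → isYes (em {A x})) n lem
    where
    lem : ∀ {x y} → Agree n x y → isYes (em {A x}) ≡ isYes (em {A y})
    lem {x} {y} a with em {A x} | em {A y}
    ... | yes _ | yes _ = refl
    ... | no _  | no _  = refl
    ... | yes p | no ¬q = contradiction (h a p) ¬q
    ... | no ¬p | yes q = contradiction (h (agree-sym a) q) ¬p

  module _ {A : Pred Cantor 0ℓ} {n : ℕ} {h : ∀ {y z} → Agree n y z → A y → A z} where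
    fromPred⁻ : ∀ {x} → x ∈ᶜ fromPred A n h → A x
    fromPred⁻ {x} e with em {A x}
    ... | yes p = p

    fromPred⁺ : ∀ {x} → A x → x ∈ᶜ fromPred A n h
    fromPred⁺ {x} Ax with em {A x}
    ... | yes _ = refl
    ... | no ¬p = contradiction Ax ¬p

  abstract
    clopen⇒Clo : ∀ {A} → Clopen A → Σ[ C ∈ Clo ] ((∀ {x} → x ∈ᶜ C → A x) × (∀ {x} → A x → x ∈ᶜ C))
    clopen⇒Clo {A} c = let (n , h) = clopen⇒uniform c in fromPred A n h , fromPred⁻ {h = h} , fromPred⁺ {h = h}

  abstract
    preimageᶜ : ∀ {f} → Continuous f → Clo → Clo
    preimageᶜ {f} c A = proj₁ (clopen⇒Clo {f ⊢ ⟦ A ⟧} (c (proj₁ (clopen A)) , c (proj₂ (clopen A))))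

    χ-preimageᶜ : ∀ {f} (c : Continuous f) A x → χ (preimageᶜ c A) x ≡ χ A (f x)
    χ-preimageᶜ {f} c A x =
      let (_ , ⊆A , A⊆) = clopen⇒Clo {f ⊢ ⟦ A ⟧} (c (proj₁ (clopen A)) , c (proj₂ (clopen A)))
      in iff ⊆A A⊆
      where
      iff : ∀ {b c} → (b ≡ true → c ≡ true) → (c ≡ true → b ≡ true) → b ≡ c
      iff {true}  {_}     f _ = sym (f refl)
      iff {false} {true}  _ g = g refl
      iff {false} {false} _ _ = refl

  ∈-preimage⁺ : ∀ {f} (c : Continuous f) A {x} → f x ∈ᶜ A → x ∈ᶜ preimageᶜ c A
  ∈-preimage⁺ c A h = trans (χ-preimageᶜ c A _) h

  ∈-preimage⁻ : ∀ {f} (c : Continuous f) A {x} → x ∈ᶜ preimageᶜ c A → f x ∈ᶜ A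
  ∈-preimage⁻ c A h = trans (sym (χ-preimageᶜ c A _)) h

  Clo-compact : ∀ A → Compact ⟦ A ⟧
  Clo-compact A {I} O oO cover =
    let (is , h) = fan R R-resp merge loc origin in is , λ x∈A → h agree-zero x∈A
    where
    R : Cantor → ℕ → Set
    R x n = ∃[ is ] (∀ {y} → Agree n x y → y ∈ᶜ A → Any (λ i → O i y) is)
    R-resp : ∀ {x y n} → Agree n x y → R x n → R y n
    R-resp a (is , h) = is , λ p → h (agree-trans a p)
    merge : ∀ x n → (∀ b → R (extend x n b) (suc n)) → R x n
    merge x n r = proj₁ (r true) ++ proj₁ (r false) , λ {y} p y∈A → lem (y n) y∈A (agree-extend n p)
      where
      lem : ∀ b {y} → y ∈ᶜ A → Agree (suc n) (extend x n b) y →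
            Any (λ i → O i y) (proj₁ (r true) ++ proj₁ (r false))
      lem true  y∈A a = Any.++⁺ˡ (proj₂ (r true) a y∈A)
      lem false y∈A a = Any.++⁺ʳ (proj₁ (r true)) (proj₂ (r false) a y∈A)
    loc : ∀ x → ∃[ n ] R x n
    loc x with em {x ∈ᶜ A}
    ... | no x∉A = depth A , [] , λ a y∈A → contradiction (∈ᶜ-agree A (agree-sym a) y∈A) x∉A
    ... | yes x∈A = let (i , Oix) = cover x∈A
                        (n , h) = open⇒local (oO i) Oix
                    in n , i ∷ [] , λ a _ → here (h a)

  -- The cylinders contained in `O` cover `K`. Finitely many of them suffice, and a finite union of
  -- cylinders is clopen.
  clopen-between : ∀ {K O} → Compact K → Open O → K ⊆ O →
                   Σ[ C ∈ Clo ] ((∀ {x} → K x → x ∈ᶜ C) × (∀ {x} → x ∈ᶜ C → O x))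
  clopen-between {K} {O} cK o K⊆O =
    let (is , h) = cK {I} Cyl (λ i → local⇒open λ a → radius i , λ b → agree-trans a b) cover
        (n , u)  = uniform is
    in fromPred (λ x → Any (λ i → Cyl i x) is) n u
     , (λ Kx → fromPred⁺ {h = u} (h Kx))
     , (λ x∈ → inside is (fromPred⁻ {h = u} x∈))
    where
    I : Set
    I = Σ[ (x , n) ∈ Cantor × ℕ ] (∀ {y} → Agree n x y → O y)
    radius : I → ℕ
    radius ((_ , n) , _) = n
    Cyl : I → Pred Cantor 0ℓ
    Cyl ((x , n) , _) y = Agree n x y
    cover : K ⊆ ⋃ I Cyl
    cover {x} Kx = let (n , h) = open⇒local o (K⊆O Kx) in ((x , n) , h) , λ _ _ → refl
    uniform : ∀ is → ∃[ n ] (∀ {y z} → Agree n y z → Any (λ i → Cyl i y) is → Any (λ i → Cyl i z) is)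
    uniform []       = 0 , λ _ ()
    uniform (i ∷ is) = let (n , h) = uniform is in radius i ⊔ n , λ
      { a (here p)  → here (agree-trans p (agree-≤ (ℕ.m≤m⊔n (radius i) n) a))
      ; a (there p) → there (h (agree-≤ (ℕ.m≤n⊔m (radius i) n) a) p) }
    inside : ∀ is {x} → Any (λ i → Cyl i x) is → O x
    inside (((_ , _) , h) ∷ is) (here a)  = h a
    inside (_ ∷ is)             (there p) = inside is p

-- Measure theory

⟶-unique : ∀ {s r c} N → (∀ n → N ℕ.≤ n → s n ≃ c) → s ⟶ r → c ≃ r
⟶-unique {s} {r} {c} N e lim = ≤-antisym
  (≤-approx λ ε p → let (M , h) = lim ε p
                        k = N ⊔ M in
    ≤-trans (≃⇒≤ (≃-sym (e k (ℕ.m≤m⊔n N M)))) (proj₁ (h k (ℕ.m≤n⊔m N M))))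
  (≤-approx λ ε p → let (M , h) = lim ε p
                        k = N ⊔ M in
    ≤-trans (proj₂ (h k (ℕ.m≤n⊔m N M))) (+-mono-≤ (≃⇒≤ (e k (ℕ.m≤m⊔n N M))) ≤-refl))

FiniteUnion : (ℕ → Pred Cantor 0ℓ) → ℕ → Pred Cantor 0ℓ
FiniteUnion As zero    = ∅
FiniteUnion As (suc n) = FiniteUnion As n ∪ As n

finiteUnion⁺ : ∀ As {n k x} → k ℕ.< n → As k x → FiniteUnion As n x
finiteUnion⁺ As {suc n} k<sn Ax with ℕ.m<1+n⇒m<n∨m≡n k<sn
... | inj₁ k<n  = inj₁ (finiteUnion⁺ As k<n Ax)
... | inj₂ refl = inj₂ Ax

finiteUnion⁻ : ∀ As n → FiniteUnion As n ⊆ ⋃ ℕ As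
finiteUnion⁻ As (suc n) (inj₁ h) = finiteUnion⁻ As n h
finiteUnion⁻ As (suc n) (inj₂ h) = n , h

finiteUnion-mono : ∀ As {m n} → m ℕ.≤ n → FiniteUnion As m ⊆ FiniteUnion As n
finiteUnion-mono As {suc m} m<n (inj₁ h) = finiteUnion-mono As (ℕ.<⇒≤ m<n) h
finiteUnion-mono As {suc m} m<n (inj₂ h) = finiteUnion⁺ As m<n h

infixr 6 _∪ᵇ_

∅ᵇ : Borel ∅
∅ᵇ = opens (λ ())

-- Finite unions and finite additivity have to come from countable ones, so a pair of sets is
-- continued by empty sets.
padded : Pred Cantor 0ℓ → Pred Cantor 0ℓ → ℕ → Pred Cantor 0ℓ
padded A B 0             = A
padded A B 1             = B
padded A B (suc (suc _)) = ∅

paddedᵇ : ∀ {A B} → Borel A → Borel B → ∀ n → Borel (padded A B n)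
paddedᵇ a b 0             = a
paddedᵇ a b 1             = b
paddedᵇ a b (suc (suc _)) = ∅ᵇ

padded-≐ : ∀ {A B} → ⋃ ℕ (padded A B) ≐ A ∪ B
padded-≐ = (λ { (0 , p) → inj₁ p ; (1 , p) → inj₂ p }) , (λ { (inj₁ p) → 0 , p ; (inj₂ p) → 1 , p })

_∪ᵇ_ : ∀ {A B} → Borel A → Borel B → Borel (A ∪ B)
a ∪ᵇ b = resp padded-≐ (union (paddedᵇ a b))

finiteUnionᵇ : ∀ {As} → (∀ n → Borel (As n)) → ∀ n → Borel (FiniteUnion As n)
finiteUnionᵇ as zero    = ∅ᵇ
finiteUnionᵇ as (suc n) = finiteUnionᵇ as n ∪ᵇ as n

infixl 7 _∖ₛ_

_∖ₛ_ : Pred Cantor 0ℓ → Pred Cantor 0ℓ → Pred Cantor 0ℓ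
(A ∖ₛ B) x = A x × ¬ B x

cloᵇ : ∀ A → Borel ⟦ A ⟧
cloᵇ A = opens (proj₁ (clopen A))

infixl 6 _∪ᶜ_

_∪ᶜ_ : Clo → Clo → Clo
A ∪ᶜ B = mkClo (λ x → χ A x ∨ χ B x) (depth A ⊔ depth B) λ a →
  cong₂ _∨_ (local A (agree-≤ (ℕ.m≤m⊔n _ _) a)) (local B (agree-≤ (ℕ.m≤n⊔m _ _) a))

∈-∪⁻ : ∀ A B {x} → x ∈ᶜ A ∪ᶜ B → x ∈ᶜ A ⊎ x ∈ᶜ B
∈-∪⁻ A B {x} h with χ A x
... | true  = inj₁ refl
... | false = inj₂ h

∈-∪⁺ : ∀ A B {x} → x ∈ᶜ A ⊎ x ∈ᶜ B → x ∈ᶜ A ∪ᶜ B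
∈-∪⁺ A B {x} (inj₁ h) rewrite h = refl
∈-∪⁺ A B {x} (inj₂ h) with χ A x
... | true  = refl
... | false = h

∈-∖⁻ : ∀ A B {x} → x ∈ᶜ A ∖ B → x ∈ᶜ A × ¬ x ∈ᶜ B
∈-∖⁻ A B {x} h with χ A x | χ B x
... | true | false = refl , λ ()

∈-∖⁺ : ∀ A B {x} → x ∈ᶜ A → ¬ x ∈ᶜ B → x ∈ᶜ A ∖ B
∈-∖⁺ A B {x} h k with χ A x | χ B x
... | true | false = refl
... | true | true  = contradiction refl k

module MeasureTheory (em : ∀ {P : Set} → Dec P) where
  open RealOrder em
  open Compactness em

  _∖ᵇ_ : ∀ {A B} → Borel A → Borel B → Borel (A ∖ₛ B)
  a ∖ᵇ b = resp ( (λ h → dne (h ∘ inj₁) , h ∘ inj₂)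
                , (λ { (p , ¬q) → Sum.[ (λ ¬p → ¬p p) , ¬q ] })) (compl (compl a ∪ᵇ b))

  module Measure (M : ProbabilityMeasure) where
    open ProbabilityMeasure M
    open ≤-Reasoning

    sumℝ-nonneg : ∀ {s : ℕ → ℝ} n → (∀ k → 0ℝ ≤ s k) → 0ℝ ≤ sumℝ n s
    sumℝ-nonneg zero    h = ≤-refl
    sumℝ-nonneg (suc n) h = ≤-trans (≃⇒≤ (≃-sym (+-identityˡ 0ℝ))) (+-mono-≤ (sumℝ-nonneg n h) (h n))

    -- A constant sequence of empty sets is disjoint, so its partial sums n e converge.
    μ-empty : ∀ {A} (a : Borel A) → (∀ {x} → ¬ A x) → μ a ≃ 0ℝ
    μ-empty {A} a empty = ≤-antisym (≤-approx λ ε p →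
      let (N , h) = σ-additive (λ _ → a) (λ _ → λ (p , _) → empty p) ε p
      in +-cancelʳ-≤ (μ a) (begin
        μ a + μ a                                     ≤⟨ +-mono-≤ (≤-trans (≃⇒≤ (≃-sym (+-identityˡ _))) (+-mono-≤ (sumℝ-nonneg N (λ _ → nonneg a)) ≤-refl)) ≤-refl ⟩
        sumℝ (suc (suc N)) (λ _ → μ a)                ≤⟨ proj₁ (h (suc (suc N)) (ℕ.m≤n⇒m≤1+n (ℕ.n≤1+n N))) ⟩
        μ (union (λ _ → a)) + fromℚ ε                 ≈⟨ +-cong (μ-cong _ _ ((λ { (_ , p) → p }) , (λ p → 0 , p))) ≃-refl ⟩
        μ a + fromℚ ε                                 ≈⟨ +-comm _ _ ⟩
        fromℚ ε + μ a                                 ≈⟨ +-cong (+-identityˡ _) ≃-refl ⟨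
        0ℝ + fromℚ ε + μ a                            ∎)) (nonneg a)

    μ-additive : ∀ {A B C} (a : Borel A) (b : Borel B) (c : Borel C) →
                 (∀ {x} → A x → ¬ B x) → C ≐ A ∪ B → μ c ≃ μ a + μ b
    μ-additive {A} {B} a b c disj C≐ = ≃-sym (≃-trans
      (⟶-unique {s = λ n → sumℝ n (λ k → μ (paddedᵇ a b k))} 2 eventually (σ-additive (paddedᵇ a b) disjoint))
      (μ-cong _ _ ( (λ h → proj₂ C≐ (proj₁ padded-≐ h)) , (λ h → proj₂ padded-≐ (proj₁ C≐ h)))))
      where
      disjoint : ∀ {m n} → m ≢ n → ∀ {x} → ¬ (padded A B m x × padded A B n x)
      disjoint {0} {0} m≢n _ = m≢n refl
      disjoint {0} {1} _ (p , q) = disj p q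
      disjoint {1} {0} _ (p , q) = disj q p
      disjoint {1} {1} m≢n _ = m≢n refl
      disjoint {0} {suc (suc _)} _ (_ , ())
      disjoint {1} {suc (suc _)} _ (_ , ())
      disjoint {suc (suc _)} _ (() , _)
      eventually : ∀ n → 2 ℕ.≤ n → sumℝ n (λ k → μ (paddedᵇ a b k)) ≃ μ a + μ b
      eventually 1 (ℕ.s≤s ())
      eventually 2 _ = +-cong (+-identityˡ _) ≃-refl
      eventually (suc n@(suc (suc _))) _ = ≃-trans
        (+-cong (eventually n (ℕ.s≤s (ℕ.s≤s ℕ.z≤n))) (μ-empty ∅ᵇ (λ ()))) (+-identityʳ _)

    μ-split : ∀ {A B} (a : Borel A) (b : Borel B) → A ⊆ B → μ b ≃ μ a + μ (b ∖ᵇ a)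
    μ-split {A} {B} a b A⊆B = μ-additive a (b ∖ᵇ a) b (λ p (_ , ¬p) → ¬p p)
      ((λ {x} q → split {A} {B} {x} q) , λ { (inj₁ p) → A⊆B p ; (inj₂ (q , _)) → q })
      where
      split : ∀ {A B : Pred Cantor 0ℓ} {x} → B x → A x ⊎ (B x × ¬ A x)
      split {A} {_} {x} q with em {A x}
      ... | yes p = inj₁ p
      ... | no ¬p = inj₂ (q , ¬p)

    ≤-+ˡ : ∀ {x y} → 0ℝ ≤ y → x ≤ x + y
    ≤-+ˡ {x} h = ≤-trans (≃⇒≤ (≃-sym (+-identityʳ x))) (+-mono-≤ ≤-refl h)

    μ-mono : ∀ {A B} (a : Borel A) (b : Borel B) → A ⊆ B → μ a ≤ μ b
    μ-mono a b A⊆B = ≤-trans (≤-+ˡ (nonneg (b ∖ᵇ a))) (≃⇒≤ (≃-sym (μ-split a b A⊆B)))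

    μ-subadditive : ∀ {A B C} (a : Borel A) (b : Borel B) (c : Borel C) → C ⊆ A ∪ B → μ c ≤ μ a + μ b
    μ-subadditive a b c C⊆ = begin
      μ c                      ≤⟨ μ-mono c (a ∪ᵇ b) C⊆ ⟩
      μ (a ∪ᵇ b)               ≈⟨ μ-split a (a ∪ᵇ b) inj₁ ⟩
      μ a + μ ((a ∪ᵇ b) ∖ᵇ a)  ≤⟨ +-mono-≤ ≤-refl (μ-mono _ b λ { (inj₁ p , ¬p) → contradiction p ¬p ; (inj₂ q , _) → q }) ⟩
      μ a + μ b                ∎

    tail : ∀ {As} (as : ∀ n → Borel (As n)) (n : ℕ) → Borel (⋃ ℕ As ∖ₛ FiniteUnion As n)
    tail as n = union as ∖ᵇ finiteUnionᵇ as n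

    -- Removing from each set the earlier ones makes the family disjoint without changing the finite
    -- unions. The partial sums of the measures are then the measures of the finite unions, and
    -- their convergence bounds what is left.
    tail-small : ∀ {As} (as : ∀ n → Borel (As n)) ε → 0ℚ ℚ.< ε →
                 ∃[ N ] (∀ n → N ℕ.≤ n → μ (tail as n) ≤ fromℚ ε)
    tail-small {As} as ε p =
      let (N , h) = σ-additive bs disjoint ε p in N , λ n l → +-cancelʳ-≤ (μ (fu n)) (begin
        μ (tail as n) + μ (fu n)        ≈⟨ +-comm _ _ ⟩
        μ (fu n) + μ (tail as n)        ≈⟨ μ-split (fu n) (union as) (finiteUnion⁻ As n) ⟨
        μ (union as)                    ≈⟨ μ-cong _ _ (disjointify , λ { (k , (q , _)) → k , q }) ⟩
        μ (union bs)                    ≤⟨ proj₂ (h n l) ⟩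
        sumℝ n (λ k → μ (bs k)) + fromℚ ε ≈⟨ +-comm _ _ ⟩
        fromℚ ε + sumℝ n (λ k → μ (bs k)) ≈⟨ +-cong ≃-refl (partial n) ⟨
        fromℚ ε + μ (fu n)              ∎)
      where
      fu : ∀ n → Borel (FiniteUnion As n)
      fu = finiteUnionᵇ as
      bs : ∀ n → Borel (As n ∖ₛ FiniteUnion As n)
      bs n = as n ∖ᵇ fu n
      disjoint : ∀ {m n} → m ≢ n → ∀ {x} → ¬ ((As m ∖ₛ FiniteUnion As m) x × (As n ∖ₛ FiniteUnion As n) x)
      disjoint {m} {n} m≢n ((p , ¬p) , (q , ¬q)) with ℕ.<-cmp m n
      ... | tri< m<n _ _ = ¬q (finiteUnion⁺ As m<n p)
      ... | tri≈ _ m≡n _ = m≢n m≡n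
      ... | tri> _ _ n<m = ¬p (finiteUnion⁺ As n<m q)
      first : ∀ n {x} → FiniteUnion As n x → ∃[ k ] (As k ∖ₛ FiniteUnion As k) x
      first (suc n) {x} h with em {FiniteUnion As n x}
      ... | yes h′ = first n h′
      first (suc n) (inj₁ h) | no ¬h = contradiction h ¬h
      first (suc n) (inj₂ q) | no ¬h = n , q , ¬h
      disjointify : ⋃ ℕ As ⊆ ⋃ ℕ (λ n → As n ∖ₛ FiniteUnion As n)
      disjointify (n , q) = first (suc n) (inj₂ q)
      partial : ∀ n → μ (fu n) ≃ sumℝ n (λ k → μ (bs k))
      partial zero    = μ-empty ∅ᵇ (λ ())
      partial (suc n) = ≃-trans (μ-split (fu n) (fu (suc n)) inj₁) (+-cong (partial n)
        (μ-cong _ _ ((λ { (inj₁ p , ¬p) → contradiction p ¬p ; (inj₂ q , ¬p) → q , ¬p })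
                    , (λ { (q , ¬p) → inj₂ q , ¬p }))))

  -- Measures that agree on clopen sets agree on Borel sets

  module Uniqueness (M₁ M₂ : ProbabilityMeasure)
    (agree : ∀ A → ProbabilityMeasure.μ M₁ (cloᵇ A) ≃ ProbabilityMeasure.μ M₂ (cloᵇ A)) where
    open ProbabilityMeasure M₁ using () renaming (μ to μ₁)
    open ProbabilityMeasure M₂ using () renaming (μ to μ₂)
    module M₁ = Measure M₁
    module M₂ = Measure M₂

    -- This class contains the open sets and is closed under complements and countable unions.
    Approximable : Pred Cantor 0ℓ → Set₁
    Approximable A = ∀ ε → 0ℚ ℚ.< ε → Σ[ C ∈ Clo ] Σ[ E ∈ Pred Cantor 0ℓ ] Σ[ e ∈ Borel E ]
      (∀ {x} → ¬ E x → (A x → x ∈ᶜ C) × (x ∈ᶜ C → A x)) × μ₁ e ≤ fromℚ ε × μ₂ e ≤ fromℚ ε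

    clo-approximable : ∀ C → Approximable ⟦ C ⟧
    clo-approximable C ε p = C , ∅ , ∅ᵇ , (λ _ → id , id) , null M₁ , null M₂
      where
      null : ∀ M → ProbabilityMeasure.μ M ∅ᵇ ≤ fromℚ ε
      null M = ≤-trans (≃⇒≤ (Measure.μ-empty M ∅ᵇ (λ ()))) (fromℚ-mono-≤ (ℚ.<⇒≤ p))

    ≐-approximable : ∀ {A B} → A ≐ B → Approximable A → Approximable B
    ≐-approximable (A⊆B , B⊆A) h ε p =
      let (C , E , e , k , s) = h ε p in C , E , e , (λ ¬E → proj₁ (k ¬E) ∘ B⊆A , A⊆B ∘ proj₂ (k ¬E)) , s

    compl-approximable : ∀ {A} → Approximable A → Approximable (∁ A)
    compl-approximable h ε p =
      let (C , E , e , k , s) = h ε p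
      in full ∖ C , E , e , (λ ¬E → (λ ¬A → ∈-∖⁺ full C refl (¬A ∘ proj₂ (k ¬E)))
                                   , (λ ∉C → proj₂ (∈-∖⁻ full C ∉C) ∘ proj₁ (k ¬E))) , s

    μ-halves : ∀ M ε {A B} (a : Borel A) (b : Borel B) → ProbabilityMeasure.μ M a ≤ fromℚ (½ ℚ.* ε) →
               ProbabilityMeasure.μ M b ≤ fromℚ (½ ℚ.* ε) → ProbabilityMeasure.μ M (a ∪ᵇ b) ≤ fromℚ ε
    μ-halves M ε a b p q = ≤-trans (Measure.μ-subadditive M a b (a ∪ᵇ b) id)
      (≤-trans (+-mono-≤ p q) (≃⇒≤ (fromℚ-½+½ ε)))

    ∪-approximable : ∀ {A B} → Approximable A → Approximable B → Approximable (A ∪ B)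
    ∪-approximable h h′ ε p =
      let (C , E , e , k , s₁ , s₂)        = h _ (0<½* p)
          (C′ , E′ , e′ , k′ , s₁′ , s₂′)  = h′ _ (0<½* p)
      in C ∪ᶜ C′ , E ∪ E′ , e ∪ᵇ e′
       , (λ ¬E → (λ h → ∈-∪⁺ C C′ (Sum.map (proj₁ (k (¬E ∘ inj₁))) (proj₁ (k′ (¬E ∘ inj₂))) h))
               , (λ h → Sum.map (proj₂ (k (¬E ∘ inj₁))) (proj₂ (k′ (¬E ∘ inj₂))) (∈-∪⁻ C C′ h)))
       , μ-halves M₁ ε e e′ s₁ s₁′ , μ-halves M₂ ε e e′ s₂ s₂′

    finiteUnion-approximable : ∀ {As} → (∀ n → Approximable (As n)) → ∀ n → Approximable (FiniteUnion As n)
    finiteUnion-approximable h zero    = ≐-approximable ((λ {x} q → proj₂ (∈-∖⁻ full full {x} q) refl) , λ ()) (clo-approximable (full ∖ full))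
    finiteUnion-approximable h (suc n) = ∪-approximable (finiteUnion-approximable h n) (h n)

    -- The union is truncated at an index where the tail is small for both measures at once. The
    -- tail goes into the exceptional set, with one half of ε for it and one for the finite union.
    ⋃-approximable : ∀ {As} → (∀ n → Borel (As n)) → (∀ n → Approximable (As n)) → Approximable (⋃ ℕ As)
    ⋃-approximable {As} as h ε p =
      let (N₁ , t₁) = M₁.tail-small as _ (0<½* p)
          (N₂ , t₂) = M₂.tail-small as _ (0<½* p)
          N = N₁ ⊔ N₂
          (C , E , e , k , s₁ , s₂) = finiteUnion-approximable h N _ (0<½* p)
          t = M₁.tail as N
      in C , _ , e ∪ᵇ t
       , (λ ¬E → (λ u → proj₁ (k (¬E ∘ inj₁)) (dne λ ¬fu → ¬E (inj₂ (u , ¬fu))))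
               , (λ c → finiteUnion⁻ As N (proj₂ (k (¬E ∘ inj₁)) c)))
       , μ-halves M₁ ε e t s₁ (t₁ N (ℕ.m≤m⊔n N₁ N₂)) , μ-halves M₂ ε e t s₂ (t₂ N (ℕ.m≤n⊔m N₁ N₂))

    -- `O` is the union over n of the sets of points whose cylinder of depth n lies in `O`. Each of
    -- these depends on n coordinates only, hence is clopen.
    open-approximable : ∀ {O} → Open O → Approximable O
    open-approximable {O} o = ≐-approximable
      ( (λ { (n , h) → fromPred⁻ {h = resp-agree n} h (λ _ _ → refl) })
      , (λ Ox → let (n , h) = open⇒local o Ox in n , fromPred⁺ {h = resp-agree n} h))
      (⋃-approximable (λ n → cloᵇ (inner n)) (λ n → clo-approximable (inner n)))
      where
      Inner : ℕ → Pred Cantor 0ℓ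
      Inner n x = ∀ {y} → Agree n x y → O y
      resp-agree : ∀ n {y z} → Agree n y z → Inner n y → Inner n z
      resp-agree n a h b = h (agree-trans a b)
      inner : ℕ → Clo
      inner n = fromPred (Inner n) n (resp-agree n)

    borel-approximable : ∀ {A} → Borel A → Approximable A
    borel-approximable (opens o)  = open-approximable o
    borel-approximable (compl a)  = compl-approximable (borel-approximable a)
    borel-approximable (union as) = ⋃-approximable as (λ n → borel-approximable (as n))
    borel-approximable (resp e a) = ≐-approximable e (borel-approximable a)

    -- One clopen set approximates `A` for both measures simultaneously, so it can be used to pass
    -- from one measure to the other. Outside the exceptional set it equals `A`, which costs ε/2 on
    -- each side.
    agree-borel : ∀ {A} (a : Borel A) → μ₁ a ≃ μ₂ a
    agree-borel {A} a = ≤-antisym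
      (≤-approx λ ε p → let (C , E , e , k , s₁ , s₂) = borel-approximable a _ (0<½* p) in
        bound M₁ M₂ ε C e k s₁ s₂ (agree C))
      (≤-approx λ ε p → let (C , E , e , k , s₁ , s₂) = borel-approximable a _ (0<½* p) in
        bound M₂ M₁ ε C e k s₂ s₁ (≃-sym (agree C)))
      where
      covered : ∀ {B C E : Pred Cantor 0ℓ} → (∀ {x} → ¬ E x → B x → C x) → B ⊆ C ∪ E
      covered {E = E} h {x} q with em {E x}
      ... | yes p = inj₂ p
      ... | no ¬p = inj₁ (h ¬p q)
      bound : ∀ M M′ ε C {E} (e : Borel E) → (∀ {x} → ¬ E x → (A x → x ∈ᶜ C) × (x ∈ᶜ C → A x)) →
              ProbabilityMeasure.μ M e ≤ fromℚ (½ ℚ.* ε) → ProbabilityMeasure.μ M′ e ≤ fromℚ (½ ℚ.* ε) →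
              ProbabilityMeasure.μ M (cloᵇ C) ≃ ProbabilityMeasure.μ M′ (cloᵇ C) →
              ProbabilityMeasure.μ M a ≤ ProbabilityMeasure.μ M′ a + fromℚ ε
      bound M M′ ε C e k s s′ same = begin
        μ a                                                   ≤⟨ Measure.μ-subadditive M (cloᵇ C) e a (covered λ {x} ¬E → proj₁ (k {x} ¬E)) ⟩
        μ (cloᵇ C) + μ e                                      ≤⟨ +-mono-≤ (≃⇒≤ same) s ⟩
        μ′ (cloᵇ C) + fromℚ (½ ℚ.* ε)                         ≤⟨ +-mono-≤ (Measure.μ-subadditive M′ a e (cloᵇ C) (covered λ {x} ¬E → proj₂ (k {x} ¬E))) ≤-refl ⟩
        μ′ a + μ′ e + fromℚ (½ ℚ.* ε)                         ≤⟨ +-mono-≤ (+-mono-≤ ≤-refl s′) ≤-refl ⟩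
        μ′ a + fromℚ (½ ℚ.* ε) + fromℚ (½ ℚ.* ε)              ≈⟨ +-assoc _ _ _ ⟩
        μ′ a + (fromℚ (½ ℚ.* ε) + fromℚ (½ ℚ.* ε))            ≈⟨ +-cong ≃-refl (fromℚ-½+½ ε) ⟩
        μ′ a + fromℚ ε                                        ∎
        where
        open ≤-Reasoning
        open ProbabilityMeasure M using (μ)
        open ProbabilityMeasure M′ using () renaming (μ to μ′)

  pushforward : ∀ M {f} → Continuous f → ProbabilityMeasure
  pushforward M c = record
    { μ          = λ a → μ (preimage-Borel c a)
    ; μ-cong     = λ a b (A⊆B , B⊆A) → μ-cong _ _ (A⊆B , B⊆A)
    ; nonneg     = λ a → nonneg _
    ; total      = ≃-trans (μ-cong _ _ ((λ _ → _) , (λ _ → _))) total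
    ; σ-additive = λ as disj → σ-additive _ (λ m≢n → disj m≢n)
    }
    where open ProbabilityMeasure M

  preserves-clopen⇒preserves : ∀ M {f} (c : Continuous f) → let open ProbabilityMeasure M in
    (∀ A → μ (preimage-Borel c (cloᵇ A)) ≃ μ (cloᵇ A)) →
    ∀ {A} (a : Borel A) → μ (preimage-Borel c a) ≃ μ a
  preserves-clopen⇒preserves M c h = Uniqueness.agree-borel (pushforward M c) M h

-- Refinements of families of clopen sets

module Sums {c ℓ} (Mon : CommutativeMonoid c ℓ) where
  open CommutativeMonoid Mon renaming (Carrier to C; refl to ≈-refl; sym to ≈-sym; trans to ≈-trans)

  sumOf : ∀ {a} {A : Set a} → (A → C) → List A → C
  sumOf F = foldr (λ x s → F x ∙ s) ε

  sumOf-++ : ∀ {a} {A : Set a} (F : A → C) xs ys → sumOf F (xs ++ ys) ≈ sumOf F xs ∙ sumOf F ys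
  sumOf-++ F []       ys = ≈-sym (identityˡ _)
  sumOf-++ F (x ∷ xs) ys = ≈-trans (∙-cong ≈-refl (sumOf-++ F xs ys)) (≈-sym (assoc _ _ _))

  sumOf-cong : ∀ {a} {A : Set a} {F G : A → C} xs → All (λ x → F x ≈ G x) xs → sumOf F xs ≈ sumOf G xs
  sumOf-cong []       []       = ≈-refl
  sumOf-cong (x ∷ xs) (e ∷ es) = ∙-cong e (sumOf-cong xs es)

  sumOf-∙ : ∀ {a} {A : Set a} (F G : A → C) xs → sumOf (λ x → F x ∙ G x) xs ≈ sumOf F xs ∙ sumOf G xs
  sumOf-∙ F G []       = ≈-sym (identityˡ _)
  sumOf-∙ F G (x ∷ xs) = ≈-trans (∙-cong ≈-refl (sumOf-∙ F G xs)) (interchange _ _ _ _)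
    where open import Algebra.Properties.CommutativeSemigroup commutativeSemigroup using (interchange)

  sumOf-map : ∀ {a b} {A : Set a} {B : Set b} (F : B → C) (f : A → B) xs → sumOf F (List.map f xs) ≈ sumOf (F ∘ f) xs
  sumOf-map F f []       = ≈-refl
  sumOf-map F f (x ∷ xs) = ∙-cong ≈-refl (sumOf-map F f xs)

module Refinement {A : Set} (Split : A → A → A → Set) where

  -- The history of a repeated splitting, with its final pieces as index. Keeping the history and
  -- not only the pieces allows additive quantities to be summed over it, hereditary properties to
  -- be passed down, and the same splitting to be replayed on another object of equal size.
  data Tree : A → List A → Set where
    leaf : ∀ {x} → Tree x (x ∷ [])
    node : ∀ {x y z ys zs} → Split x y z → Tree y ys → Tree z zs → Tree x (ys ++ zs)

  data Ref : List A → List A → Set where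
    []  : Ref [] []
    _∷_ : ∀ {x ys xs zs} → Tree x ys → Ref xs zs → Ref (x ∷ xs) (ys ++ zs)

  ref-cut : ∀ {x y z xs ys} → Split x y z → Ref (z ∷ xs) ys → Ref (x ∷ xs) (y ∷ ys)
  ref-cut s (t ∷ r) = node s leaf t ∷ r

  module _ {c ℓ} (Mon : CommutativeMonoid c ℓ) where
    open CommutativeMonoid Mon using (_∙_; _≈_; ∙-cong; identityʳ)
      renaming (Carrier to C; sym to ≈-sym; trans to ≈-trans)
    open Sums Mon

    tree-sum : (F : A → C) → (∀ {x y z} → Split x y z → F x ≈ F y ∙ F z) →
               ∀ {x ys} → Tree x ys → F x ≈ sumOf F ys
    tree-sum F add leaf         = ≈-sym (identityʳ _)
    tree-sum F add (node {ys = ys} {zs} s t u) = ≈-trans (add s)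
      (≈-trans (∙-cong (tree-sum F add t) (tree-sum F add u)) (≈-sym (sumOf-++ F ys zs)))

    ref-sum : (F : A → C) → (∀ {x y z} → Split x y z → F x ≈ F y ∙ F z) →
              ∀ {xs ys} → Ref xs ys → sumOf F xs ≈ sumOf F ys
    ref-sum F add []      = CommutativeMonoid.refl Mon
    ref-sum F add (_∷_ {ys = ys} {zs = zs} t r) = ≈-trans (∙-cong (tree-sum F add t) (ref-sum F add r)) (≈-sym (sumOf-++ F ys zs))

  tree-all : ∀ {p} {P : A → Set p} → (∀ {x y z} → Split x y z → P x → P y × P z) → ∀ {x ys} → Tree x ys → P x → All P ys
  tree-all h leaf         p = p ∷ []
  tree-all h (node s t u) p = All.++⁺ (tree-all h t (proj₁ (h s p))) (tree-all h u (proj₂ (h s p)))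

  ref-all : ∀ {p} {P : A → Set p} → (∀ {x y z} → Split x y z → P x → P y × P z) → ∀ {xs ys} → Ref xs ys → All P xs → All P ys
  ref-all h []      []       = []
  ref-all h (t ∷ r) (p ∷ ps) = All.++⁺ (tree-all h t p) (ref-all h r ps)

  graft : ∀ {p q} {P : A → Set p} {Q : A → Set q} →
          (∀ y → P y → ∃[ zs ] (Tree y zs × All Q zs)) →
          ∀ {x ys} → Tree x ys → All P ys → ∃[ zs ] (Tree x zs × All Q zs)
  graft h leaf (p ∷ []) = h _ p
  graft h (node {ys = ys} s t u) ps =
    let (_ , t′ , q) = graft h t (All.++⁻ˡ ys ps)
        (_ , u′ , r) = graft h u (All.++⁻ʳ ys ps)
    in _ , node s t′ u′ , All.++⁺ q r

  refine-each : ∀ {q} {Q : A → Set q} → (∀ y → ∃[ zs ] (Tree y zs × All Q zs)) → ∀ xs → ∃[ zs ] (Ref xs zs × All Q zs)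
  refine-each h []       = [] , [] , []
  refine-each h (x ∷ xs) =
    let (_ , t , q) = h x
        (_ , r , s) = refine-each h xs
    in _ , t ∷ r , All.++⁺ q s

ind : Clo → Cantor → ℕ
ind A x = if χ A x then 1 else 0

-- One equation between indicator functions says that `S` and `R` are disjoint and have union `E`.
-- In this form it adds up over levels and over lists, so that partitions are handled by counting.
Cut : Clo → Clo → Clo → Set
Cut E S R = ∀ x → ind E x ≡ ind S x ℕ.+ ind R x

ind-∈ : ∀ A {x} → x ∈ᶜ A → ind A x ≡ 1
ind-∈ A h rewrite h = refl

cut-by : ∀ E Z → Cut E (E ∩ᶜ Z) (E ∖ Z)
cut-by E Z x with χ E x | χ Z x
... | true  | true  = refl
... | true  | false = refl
... | false | _     = refl

cut-⊑ˡ : ∀ E S R → Cut E S R → S ⊑ E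
cut-⊑ˡ E S R c x h with χ E x | χ S x | χ R x | c x
... | true  | _    | _ | _ = refl
cut-⊑ˡ E S R c x () | false | false | _ | _

cut-⊑ʳ : ∀ E S R → Cut E S R → R ⊑ E
cut-⊑ʳ E S R c x h with χ E x | χ S x | χ R x | c x
... | true  | _     | _    | _ = refl
cut-⊑ʳ E S R c x () | false | false | false | _
cut-⊑ʳ E S R c x _  | false | true  | true  | ()

cut-disjoint : ∀ {E S R} → Cut E S R → ∀ {x} → x ∈ᶜ S → ¬ x ∈ᶜ R
cut-disjoint {E} {S} {R} c {x} p q with χ E x | χ S x | χ R x | c x
cut-disjoint c refl refl | true  | true | true | ()
cut-disjoint c refl refl | false | true | true | ()

cut-cover : ∀ {E S R} → Cut E S R → ∀ {x} → x ∈ᶜ E → x ∈ᶜ S ⊎ x ∈ᶜ R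
cut-cover {E} {S} {R} c {x} p with χ E x | χ S x | χ R x | c x
... | _ | true  | _    | _ = inj₁ refl
... | _ | false | true | _ = inj₂ refl
cut-cover c refl | true | false | false | ()

count : ∀ {n} → Cantor → Vec Clo n → ℕ
count x []       = 0
count x (E ∷ Es) = ind E x ℕ.+ count x Es

count-++ : ∀ {m n} x (Es : Vec Clo m) (Fs : Vec Clo n) → count x (Es Vec.++ Fs) ≡ count x Es ℕ.+ count x Fs
count-++ x []       Fs = refl
count-++ x (E ∷ Es) Fs = trans (cong (ind E x ℕ.+_) (count-++ x Es Fs)) (sym (ℕ.+-assoc (ind E x) _ _))

+-interchange : ∀ a b c d → (a ℕ.+ b) ℕ.+ (c ℕ.+ d) ≡ (a ℕ.+ c) ℕ.+ (b ℕ.+ d)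
+-interchange = interchange
  where
  open import Algebra.Properties.CommutativeSemigroup ℕ.+-commutativeSemigroup using (interchange)

count-cut : ∀ {n} {Es Ss Rs : Vec Clo n} → (∀ t → Cut (lookup Es t) (lookup Ss t) (lookup Rs t)) →
            ∀ x → count x Es ≡ count x Ss ℕ.+ count x Rs
count-cut {Es = []}    {[]}    {[]}    c x = refl
count-cut {Es = _ ∷ Es} {S ∷ Ss} {R ∷ Rs} c x =
  trans (cong₂ ℕ._+_ (c zero x) (count-cut {Es = Es} {Ss} {Rs} (c ∘ suc) x)) (+-interchange (ind S x) _ _ _)

-- `E` lies inside `Z` or misses it. Applied to the sets `bit n`, this is how levels are made small.
Decided : Clo → Clo → Set
Decided Z E = ∀ x y → x ∈ᶜ E → y ∈ᶜ E → χ Z x ≡ χ Z y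

-- Cutting off clopen sets of prescribed measure

module Cutting (em : ∀ {P : Set} → Dec P) (M : ProbabilityMeasure) (G : IsGood M) where
  open RealOrder em
  open Compactness em
  open MeasureTheory em
  open ProbabilityMeasure M
  open IsGood G renaming (full to μ-full)
  open Measure M

  abstract
    m : Clo → ℝ
    m A = μ (cloᵇ A)

    m-μ : ∀ A → m A ≃ μ (cloᵇ A)
    m-μ A = ≃-refl

  via : ∀ {A B} → μ (cloᵇ A) ≃ μ (cloᵇ B) → m A ≃ m B
  via {A} {B} e = ≃-trans (m-μ A) (≃-trans e (≃-sym (m-μ B)))

  <-resp : ∀ {x y u v} → x ≃ u → y ≃ v → x < y → u < v
  <-resp e f h = ≤-<-trans (≃⇒≤ (≃-sym e)) (<-≤-trans h (≃⇒≤ f))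

  m-cong : ∀ {A B} → A ⊑ B → B ⊑ A → m A ≃ m B
  m-cong {A} {B} p q = via (μ-cong _ _ ((λ {x} → p x) , (λ {x} → q x)))

  m-cut : ∀ {E S R} → Cut E S R → m E ≃ m S ⊕ m R
  m-cut {E} {S} {R} c = ≃-trans (m-μ E) (≃-trans (μ-additive (cloᵇ S) (cloᵇ R) (cloᵇ E) (λ {x} → cut-disjoint {E} {S} {R} c {x})
    ( (λ {x} → cut-cover {E} {S} {R} c {x})
    , λ { {x} (inj₁ p) → cut-⊑ˡ E S R c x p ; {x} (inj₂ p) → cut-⊑ʳ E S R c x p }))
    (≃-trans (≃-sym (⊕-≃ _ _)) (⊕-cong (≃-sym (m-μ S)) (≃-sym (m-μ R)))))

  m-pos : ∀ A {x} → x ∈ᶜ A → 0ℝ < m A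
  m-pos A x∈A = <-resp ≃-refl (≃-sym (m-μ A)) (μ-full (proj₁ (clopen A)) (_ , x∈A))

  abstract
    m-inhabited : ∀ A → 0ℝ < m A → ∃[ x ] x ∈ᶜ A
    m-inhabited A 0<m = dne λ h → <⇒≱ 0<m (≃⇒≤ (≃-trans (m-μ A) (μ-empty (cloᵇ A) λ x∈A → h (_ , x∈A))))

  m-empty : ∀ A → (∀ {x} → ¬ x ∈ᶜ A) → m A ≃ 0ℝ
  m-empty A h = ≃-trans (m-μ A) (μ-empty (cloᵇ A) λ {x} → h {x})

  m-full : m full ≃ 1ℝ
  m-full = ≃-trans (m-μ full) (≃-trans (μ-cong _ _ ((λ _ → _) , (λ _ → refl))) total)

  ≤-⊕ˡ : ∀ {x y} → 0ℝ ≤ y → x ≤ x ⊕ y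
  ≤-⊕ˡ {x} h = ≤-trans (≃⇒≤ (≃-sym (⊕-identityʳ x))) (⊕-mono-≤ ≤-refl h)

  <-⊕ʳ : ∀ {x} y → 0ℝ < x → y < x ⊕ y
  <-⊕ʳ y h = <-resp (⊕-identityˡ y) ≃-refl (⊕-monoˡ-< y h)

  positive-difference : ∀ {a b c} → a ≃ b ⊕ c → b < a → 0ℝ < c
  positive-difference {a} {b} {c} e b<a = ≰⇒> λ c≤0 → <⇒≱ b<a
    (≤-trans (≃⇒≤ e) (≤-trans (⊕-mono-≤ ≤-refl c≤0) (≃⇒≤ (⊕-identityʳ b))))

  abstract
    -- The one place where the subset property of a good measure enters. Every later cut to a
    -- prescribed measure is obtained from this one.
    cut-off : ∀ E A → m A < m E → ∃₂ λ S R → Cut E S R × m S ≃ m A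
    cut-off E A h =
      let (_ , c , C⊆E , e) = good (clopen A) (clopen E) (<-resp (m-μ A) (m-μ E) h)
          (D , D⊆C , C⊆D) = clopen⇒Clo c
      in E ∩ᶜ D , E ∖ D , cut-by E D
       , ≃-trans (m-μ _) (≃-trans (μ-cong _ _ ( (λ {x} h → D⊆C (∩-⊑ʳ E D x h))
                             , (λ {x} h → ∈-∩ E D {x} (C⊆E h) (C⊆D h)))) (≃-trans e (≃-sym (m-μ A))))

  -- What the matching of two families by size requires of their members. It is used for columns and
  -- for paths in a graph, whose splittings carry different extra structure.
  record Cuttable (A : Set) : Set₁ where
    field
      size       : A → Clo
      pos        : ∀ a → 0ℝ < m (size a)
      Split      : A → A → A → Set
      split-size : ∀ {a b c} → Split a b c → m (size a) ≃ m (size b) ⊕ m (size c)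
      split      : ∀ a C → 0ℝ < m C → m C < m (size a) → ∃₂ λ b c → Split a b c × m (size b) ≃ m C
    open Refinement Split public
    open Sums ℝ-⊕ using (sumOf)
    total-size : List A → ℝ
    total-size = sumOf (m ∘ size)

  module Coupling {A B : Set} (CA : Cuttable A) (CB : Cuttable B) where
    private
      module A = Cuttable CA
      module B = Cuttable CB

    SameSize : A → B → Set
    SameSize a b = m (A.size a) ≃ m (B.size b)

    Coupled : List A → List B → Set
    Coupled as bs = Σ[ ps ∈ List (A × B) ]
      A.Ref as (List.map proj₁ ps) × B.Ref bs (List.map proj₂ ps) ×
      All (λ (a , b) → SameSize a b) ps

    positive-total : ∀ {x s} → 0ℝ < x → 0ℝ ≤ s → ¬ x ⊕ s ≃ 0ℝ
    positive-total {x} {s} 0<x 0≤s e = <⇒≱ 0<x (≤-trans (≤-⊕ˡ 0≤s) (≃⇒≤ e))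

    nonneg-total : ∀ {C} (D : Cuttable C) xs → 0ℝ ≤ Cuttable.total-size D xs
    nonneg-total D []       = ≤-refl
    nonneg-total D (x ∷ xs) = ≤-trans (<⇒≤ (Cuttable.pos D x)) (≤-⊕ˡ (nonneg-total D xs))

    cancel-common : ∀ {a b s t r} → b ≃ a ⊕ r → a ⊕ s ≃ b ⊕ t → s ≃ r ⊕ t
    cancel-common {a} {b} {s} {t} {r} e f = ⊕-cancelʳ a (≃-trans (⊕-comm s a) (≃-trans f
      (≃-trans (⊕-cong e ≃-refl) (≃-trans (⊕-assoc a r t) (⊕-comm a (r ⊕ t))))))

    -- Imagine both families laid out side by side along one interval and cut wherever either has an
    -- endpoint. Comparing the two heads and cutting the larger one does this. Each comparison uses
    -- up at least one head, so the total length decreases and `n` can bound the recursion.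
    couple′ : ∀ n as bs → length as ℕ.+ length bs ℕ.≤ n →
              A.total-size as ≃ B.total-size bs → Coupled as bs
    couple′ n []       []       _ _ = [] , A.[] , B.[] , []
    couple′ n []       (b ∷ bs) _ e = contradiction (≃-sym e) (positive-total (B.pos b) (nonneg-total CB bs))
    couple′ n (a ∷ as) []       _ e = contradiction e (positive-total (A.pos a) (nonneg-total CA as))
    couple′ (suc n) (a ∷ as) (b ∷ bs) (ℕ.s≤s l) e with compare (m (A.size a)) (m (B.size b))
    ... | eq f =
      let (ps , r , r′ , q) = couple′ n as bs (ℕ.≤-trans (ℕ.+-monoʳ-≤ (length as) (ℕ.n≤1+n _)) l)
                                (≃-trans (cancel-common (≃-trans (≃-sym f) (≃-sym (⊕-identityʳ _))) e) (⊕-identityˡ _))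
      in (a , b) ∷ ps , A.leaf A.∷ r , B.leaf B.∷ r′ , f ∷ q
    ... | lt a<b =
      let (b′ , b″ , s , f) = B.split b (A.size a) (A.pos a) a<b
          (ps , r , r′ , q) = couple′ n as (b″ ∷ bs) l
            (cancel-common (≃-trans (B.split-size s) (⊕-cong f ≃-refl)) e)
      in (a , b′) ∷ ps , A.leaf A.∷ r , B.ref-cut s r′ , ≃-sym f ∷ q
    ... | gt b<a =
      let (a′ , a″ , s , f) = A.split a (B.size b) (B.pos b) b<a
          (ps , r , r′ , q) = couple′ n (a″ ∷ as) bs (subst (ℕ._≤ n) (ℕ.+-suc (length as) (length bs)) l)
            (≃-sym (cancel-common (≃-trans (A.split-size s) (⊕-cong f ≃-refl)) (≃-sym e)))
      in (a′ , b) ∷ ps , A.ref-cut s r , B.leaf B.∷ r′ , f ∷ q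

    abstract
      couple : ∀ as bs → A.total-size as ≃ B.total-size bs → Coupled as bs
      couple as bs = couple′ _ as bs ℕ.≤-refl

    -- The splittings of `a` are replayed on `b`: a piece of the right size is split off, and the
    -- remainders have equal size by cancellation.
    transfer-tree : ∀ {a b as} → SameSize a b → A.Tree a as → ∃[ bs ] (B.Tree b bs × Pointwise SameSize as bs)
    transfer-tree e A.leaf = _ , B.leaf , e ∷ []
    transfer-tree {a} {b} e (A.node {y = a′} {z = a″} s t u) =
      let (b′ , b″ , s′ , f) = B.split b (A.size a′) (A.pos a′)
            (<-resp ≃-refl (≃-trans (⊕-comm _ _) (≃-trans (≃-sym (A.split-size s)) e)) (<-⊕ʳ _ (A.pos a″)))
          e″ = ⊕-cancelʳ (m (A.size a′)) (≃-trans (⊕-comm _ _) (≃-trans (≃-sym (A.split-size s))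
                 (≃-trans e (≃-trans (B.split-size s′) (≃-trans (⊕-comm _ _) (⊕-cong ≃-refl f))))))
          (_ , t′ , p) = transfer-tree (≃-sym f) t
          (_ , u′ , q) = transfer-tree e″ u
      in _ , B.node s′ t′ u′ , Pointwise.++⁺ p q

    abstract
      transfer : ∀ {as bs as′} → Pointwise SameSize as bs → A.Ref as as′ → ∃[ bs′ ] (B.Ref bs bs′ × Pointwise SameSize as′ bs′)
      transfer []       A.[]      = [] , B.[] , []
      transfer (e ∷ es) (t A.∷ r) =
        let (_ , t′ , p) = transfer-tree e t
            (_ , r′ , q) = transfer es r
        in _ , t′ B.∷ r′ , Pointwise.++⁺ p q

-- Cyclic sequences

module _ {a} {A : Set a} where

  headOr : ∀ {n} → A → Vec A n → A
  headOr f []      = f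
  headOr f (a ∷ _) = a

  path : ∀ {n} → Vec A n → A → List (A × A)
  path []       f = []
  path (a ∷ as) f = (a , headOr f as) ∷ path as f

  cyc : ∀ {n} → Vec A n → List (A × A)
  cyc []       = []
  cyc (a ∷ as) = path (a ∷ as) a

  headOr-++ : ∀ {m n} (as : Vec A m) (bs : Vec A n) f → headOr f (as Vec.++ bs) ≡ headOr (headOr f bs) as
  headOr-++ []      bs f = refl
  headOr-++ (_ ∷ _) bs f = refl

  path-++ : ∀ {m n} (as : Vec A m) (bs : Vec A n) f → path (as Vec.++ bs) f ≡ path as (headOr f bs) ++ path bs f
  path-++ []       bs f = refl
  path-++ (a ∷ as) bs f = cong₂ _∷_ (cong (a ,_) (headOr-++ as bs f)) (path-++ as bs f)

module _ {a b} {A : Set a} {B : Set b} (f : A → B) where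

  path-map : ∀ {n} (as : Vec A n) e → path (Vec.map f as) (f e) ≡ List.map (λ (x , y) → f x , f y) (path as e)
  path-map []            e = refl
  path-map (a ∷ [])      e = refl
  path-map (a ∷ a′ ∷ as) e = cong ((f a , f a′) ∷_) (path-map (a′ ∷ as) e)

  cyc-map : ∀ {n} (as : Vec A n) → cyc (Vec.map f as) ≡ List.map (λ (x , y) → f x , f y) (cyc as)
  cyc-map []       = refl
  cyc-map (a ∷ as) = path-map (a ∷ as) a

cyc-lookup : ∀ {a} {A : Set a} {n} (as : Vec A n) →
             cyc as ≡ List.map (λ (t , t′) → lookup as t , lookup as t′) (cyc (Vec.allFin n))
cyc-lookup as = trans (cong cyc (sym (Vec.map-lookup-allFin as))) (cyc-map (lookup as) (Vec.allFin _))

infix 4 _≼_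

_≼_ : ∀ {n} → Vec Clo n → Vec Clo n → Set
Fs ≼ Es = ∀ t → lookup Fs t ⊑ lookup Es t

PairIn : List (Clo × Clo) → Clo × Clo → Set
PairIn L (a , b) = Any (λ (a′ , b′) → a ⊑ a′ × b ⊑ b′) L

path-≼ : ∀ {n} {Fs Es : Vec Clo n} {f e} → Fs ≼ Es → f ⊑ e → All (PairIn (path Es e)) (path Fs f)
path-≼ {Fs = []}          {[]}          _ _ = []
path-≼ {Fs = F ∷ []}      {E ∷ []}      h k = here (h zero , k) ∷ []
path-≼ {Fs = F ∷ F′ ∷ Fs} {E ∷ E′ ∷ Es} {f} {e} h k =
  here (h zero , h (suc zero)) ∷
  All.map there (path-≼ {Fs = F′ ∷ Fs} {E′ ∷ Es} {f} {e} (h ∘ suc) k)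

path-blocks : ∀ {k n} (Es : Vec Clo (suc n)) (Bs : Vec (Vec Clo (suc n)) k) {f} →
              AllV (_≼ Es) Bs → f ⊑ lookup Es zero → All (PairIn (cyc Es)) (path (Vec.concat Bs) f)
path-blocks Es              []       []       _ = []
path-blocks Es@(E ∷ _) (B ∷ Bs) {f} (h ∷ hs) k =
  subst (All (PairIn (cyc Es))) (sym (path-++ B (Vec.concat Bs) f))
    (All.++⁺ (path-≼ {Fs = B} {Es} h (first Bs hs)) (path-blocks Es Bs hs k))
  where
  first : ∀ {k} (Bs : Vec (Vec Clo _) k) → AllV (_≼ Es) Bs → headOr f (Vec.concat Bs) ⊑ E
  first []             []      = k
  first ((_ ∷ _) ∷ _) (h ∷ _) = h zero

-- Justifies stacking. A transition inside a block lies under a transition of `Es`, and one from the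
-- top of a block to the bottom of the next lies under the closing transition of `Es`. The same
-- holds for the return from the last block to the first.
cyc-blocks : ∀ {k n} (Es : Vec Clo n) (Bs : Vec (Vec Clo n) k) → AllV (_≼ Es) Bs →
             All (PairIn (cyc Es)) (cyc (Vec.concat Bs))
cyc-blocks         []      Bs             _          = subst (All _) (sym (lem Bs)) []
  where
  lem : ∀ {k} (Bs : Vec (Vec Clo 0) k) → cyc (Vec.concat Bs) ≡ []
  lem []        = refl
  lem ([] ∷ Bs) = lem Bs
cyc-blocks         (E ∷ Es) []             _          = []
cyc-blocks         (E ∷ Es) ((B ∷ Bs) ∷ Cs) (h ∷ hs) =
  path-blocks (E ∷ Es) ((B ∷ Bs) ∷ Cs) (h ∷ hs) (h zero)

open Sums ℕ.+-0-commutativeMonoid public using () renaming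
  (sumOf to sumℕ; sumOf-++ to sumℕ-++; sumOf-cong to sumℕ-cong; sumOf-∙ to sumℕ-+; sumOf-map to sumℕ-map)

count₁ count₂ : Cantor → List (Clo × Clo) → ℕ
count₁ x = sumℕ (λ (a , _) → ind a x)
count₂ x = sumℕ (λ (_ , b) → ind b x)

path-count₁ : ∀ {n} x (as : Vec Clo n) f → count₁ x (path as f) ≡ count x as
path-count₁ x []       f = refl
path-count₁ x (a ∷ as) f = cong (ind a x ℕ.+_) (path-count₁ x as f)

path-count₂ : ∀ {n} x a (as : Vec Clo n) f → count₂ x (path (a ∷ as) f) ≡ ind f x ℕ.+ count x as
path-count₂ x a []        f = refl
path-count₂ x a (a′ ∷ as) f = trans (cong (ind a′ x ℕ.+_) (path-count₂ x a′ as f)) (exchange (ind a′ x) (ind f x) (count x as))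
  where
  exchange : ∀ a b c → a ℕ.+ (b ℕ.+ c) ≡ b ℕ.+ (a ℕ.+ c)
  exchange a b c = trans (sym (ℕ.+-assoc a b c)) (trans (cong (ℕ._+ c) (ℕ.+-comm a b)) (ℕ.+-assoc b a c))

cyc-count₁ : ∀ {n} x (as : Vec Clo n) → count₁ x (cyc as) ≡ count x as
cyc-count₁ x []       = refl
cyc-count₁ x (a ∷ as) = path-count₁ x (a ∷ as) a

cyc-count₂ : ∀ {n} x (as : Vec Clo n) → count₂ x (cyc as) ≡ count x as
cyc-count₂ x []       = refl
cyc-count₂ x (a ∷ as) = path-count₂ x a as a

path-all : ∀ {n p} {P : Clo → Set p} (as : Vec Clo n) {f} → AllV P as → P f → All (λ (a , b) → P a × P b) (path as f)
path-all []            []             _  = []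
path-all (_ ∷ [])      (p ∷ [])       pf = (p , pf) ∷ []
path-all (_ ∷ a′ ∷ as) (p ∷ p′ ∷ ps) pf = (p , p′) ∷ path-all (a′ ∷ as) (p′ ∷ ps) pf

cyc-all : ∀ {n p} {P : Clo → Set p} (as : Vec Clo n) → AllV P as → All (λ (a , b) → P a × P b) (cyc as)
cyc-all []       _          = []
cyc-all (a ∷ as) (p ∷ ps) = path-all (a ∷ as) (p ∷ ps) p

-- Columns: tuples of clopen sets of equal measure

module Columns (em : ∀ {P : Set} → Dec P) (M : ProbabilityMeasure) (G : IsGood M) where
  open RealOrder em
  open Compactness em
  open Cutting em M G

  -- size only represents the common measure of the levels, also when there are none.
  record Column (n : ℕ) : Set where
    field
      levels : Vec Clo n
      size   : Clo
      even   : AllV (λ E → m E ≃ m size) levels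
      pos    : 0ℝ < m size

    level : Fin n → Clo
    level = lookup levels

    level-size : ∀ t → m (level t) ≃ m size
    level-size = AllV.lookup⁺ even

  open Column public using (levels; level; level-size) renaming (size to sizeᶜ; pos to posᶜ)

  record ColumnSplit {n} (p q r : Column n) : Set where
    field
      cuts  : ∀ t → Cut (level p t) (level q t) (level r t)
      sizes : m (sizeᶜ p) ≃ m (sizeᶜ q) ⊕ m (sizeᶜ r)

    splitˡ : levels q ≼ levels p
    splitˡ t = cut-⊑ˡ (level p t) (level q t) (level r t) (cuts t)

    splitʳ : levels r ≼ levels p
    splitʳ t = cut-⊑ʳ (level p t) (level q t) (level r t) (cuts t)

  module _ {n} (p : Column n) (S R : Clo) (c : Cut (sizeᶜ p) S R) (0<S : 0ℝ < m S) (0<R : 0ℝ < m R)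
           (Ss Rs : Fin n → Clo) (cs : ∀ t → Cut (level p t) (Ss t) (Rs t)) (es : ∀ t → m (Ss t) ≃ m S) where

    lower-part upper-part : Column n
    lower-part = record
      { levels = tabulate Ss ; size = S ; pos = 0<S ; even = AllV.tabulate⁺ es }
    upper-part = record
      { levels = tabulate Rs ; size = R ; pos = 0<R
      ; even = AllV.tabulate⁺ λ t → ⊕-cancelʳ (m S) (≃-trans (⊕-cong ≃-refl (≃-sym (es t)))
          (≃-trans (⊕-comm _ _) (≃-trans (≃-sym (m-cut (cs t)))
            (≃-trans (level-size p t) (≃-trans (m-cut c) (⊕-comm _ _)))))) }

    parts-split : ColumnSplit p lower-part upper-part
    parts-split = record
      { cuts  = λ t → subst (λ S → Cut (level p t) S (lookup (tabulate Rs) t)) (sym (Vec.lookup∘tabulate Ss t))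
                  (subst (Cut (level p t) (Ss t)) (sym (Vec.lookup∘tabulate Rs t)) (cs t))
      ; sizes = m-cut c }

  abstract
    -- The levels, and the set that represents their size, are cut independently of each other. As
    -- no map between the levels has been fixed, their parts only have to agree in measure.
    column-split : ∀ {n} (p : Column n) C → 0ℝ < m C → m C < m (sizeᶜ p) →
                   ∃₂ λ q r → ColumnSplit p q r × m (sizeᶜ q) ≃ m C
    column-split p C 0<C C<p =
      let (S , R , c , e) = cut-off (sizeᶜ p) C C<p
          ps = λ t → cut-off (level p t) S (<-resp (≃-sym e) (≃-sym (level-size p t)) C<p)
      in _ , _ , parts-split p S R c (<-resp ≃-refl (≃-sym e) 0<C)
                   (positive-difference (m-cut c) (<-resp (≃-sym e) ≃-refl C<p))
                   (λ t → proj₁ (ps t)) (λ t → proj₁ (proj₂ (ps t)))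
                   (λ t → proj₁ (proj₂ (proj₂ (ps t)))) (λ t → proj₂ (proj₂ (proj₂ (ps t)))) , e

  columns : ∀ n → Cuttable (Column n)
  columns n = record
    { size = sizeᶜ ; pos = posᶜ ; Split = ColumnSplit ; split-size = ColumnSplit.sizes ; split = column-split }

  module _ {n : ℕ} where
    open Cuttable (columns n) public using (Tree; leaf; node; Ref; []; _∷_)
    open Refinement (ColumnSplit {n}) public using (graft; refine-each; tree-all; ref-all; tree-sum; ref-sum)

  ref-count : ∀ {n} {ps qs : List (Column n)} → Ref ps qs → ∀ x →
              sumℕ (λ p → count x (levels p)) ps ≡ sumℕ (λ q → count x (levels q)) qs
  ref-count r x = ref-sum ℕ.+-0-commutativeMonoid (λ p → count x (levels p))
    (λ {p} {q} {s} c → count-cut {Es = levels p} {levels q} {levels s} (ColumnSplit.cuts c) x) r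

  ⊑-decided : ∀ {Z E F} → F ⊑ E → Decided Z E → Decided Z F
  ⊑-decided F⊑E d x y p q = d x y (F⊑E x p) (F⊑E y q)

  module _ {n} (p : Column n) (t : Fin n) (Z : Clo) where
    private
      E C : Clo
      E = level p t
      C = E ∩ᶜ Z

    -- Only level `t` has to be cut exactly along `Z`. Any other level may be cut anywhere, provided
    -- that its part has the measure of `S`.
    record Piece (S : Clo) (u : Fin n) : Set where
      field
        part remainder : Clo
        cut     : Cut (level p u) part remainder
        part-≃  : m part ≃ m S
        decided : u ≡ t → Decided Z part × Decided Z remainder

    open Piece

    inside-decided : Decided Z C
    inside-decided x y p q = trans (∩-⊑ʳ E Z x p) (sym (∩-⊑ʳ E Z y q))

    outside-decided : Decided Z (E ∖ Z)
    outside-decided x y p q = trans (out x p) (sym (out y q))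
      where
      out : ∀ x → x ∈ᶜ E ∖ Z → χ Z x ≡ false
      out x h = Bool.¬-not (proj₂ (∈-∖⁻ E Z {x} h))

    piece : ∀ S → m S ≃ m C → m C < m (sizeᶜ p) → ∀ u → Dec (u ≡ t) → Piece S u
    piece S e C<p u (yes refl) = record
      { part = C ; remainder = E ∖ Z ; cut = cut-by E Z ; part-≃ = ≃-sym e
      ; decided = λ _ → inside-decided , outside-decided }
    piece S e C<p u (no u≢t) =
      let (S′ , R′ , c , f) = cut-off (level p u) S (<-resp (≃-sym e) (≃-sym (level-size p u)) C<p)
      in record { part = S′ ; remainder = R′ ; cut = c ; part-≃ = f ; decided = λ u≡t → contradiction u≡t u≢t }

    split-at : ∀ {x y} → x ∈ᶜ C → y ∈ᶜ E ∖ Z →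
               ∃₂ λ q r → ColumnSplit p q r × Decided Z (level q t) × Decided Z (level r t)
    split-at {x} {y} x∈ y∈ =
      let (S , R , c , e) = cut-off (sizeᶜ p) C C<p
          ps = λ u → piece S e C<p u (u Fin.≟ t)
          (d , d′) = decided (ps t) refl
      in _ , _ , parts-split p S R c (<-resp ≃-refl (≃-sym e) (m-pos C {x} x∈))
                   (positive-difference (m-cut c) (<-resp (≃-sym e) ≃-refl C<p))
                   (λ u → part (ps u)) (λ u → remainder (ps u)) (λ u → cut (ps u)) (λ u → part-≃ (ps u))
       , subst (Decided Z) (sym (Vec.lookup∘tabulate (λ u → part (ps u)) t)) d
       , subst (Decided Z) (sym (Vec.lookup∘tabulate (λ u → remainder (ps u)) t)) d′
      where
      C<p : m C < m (sizeᶜ p)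
      C<p = <-resp ≃-refl (level-size p t) (<-resp ≃-refl (≃-trans (⊕-comm _ _) (≃-sym (m-cut (cut-by E Z))))
              (<-⊕ʳ (m C) (m-pos (E ∖ Z) {y} y∈)))

    abstract
      -- If level `t` meets both `Z` and its complement, fullness makes both parts positive, and the
      -- whole column is split in the ratio of these parts. Otherwise the column is already decided
      -- and stays whole.
      decide : ∃[ qs ] (Tree p qs × All (λ q → Decided Z (level q t) × levels q ≼ levels p) qs)
      decide with em {∃[ x ] x ∈ᶜ C} | em {∃[ x ] x ∈ᶜ E ∖ Z}
      ... | yes (x , x∈) | yes (y , y∈) =
        let (q , r , s , d , d′) = split-at {x} {y} x∈ y∈
        in _ , node s leaf leaf , (d , ColumnSplit.splitˡ s) ∷ (d′ , ColumnSplit.splitʳ s) ∷ []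
      ... | no ¬C | _ = _ , leaf , ((λ x y p∈ q∈ → trans (out x p∈) (sym (out y q∈))) , (λ _ _ h → h)) ∷ []
        where
        out : ∀ x → x ∈ᶜ E → χ Z x ≡ false
        out x x∈ = Bool.¬-not λ x∈Z → ¬C (x , ∈-∩ E Z {x} x∈ x∈Z)
      ... | yes _ | no ¬R = _ , leaf , ((λ x y p∈ q∈ → trans (inn x p∈) (sym (inn y q∈))) , (λ _ _ h → h)) ∷ []
        where
        inn : ∀ x → x ∈ᶜ E → χ Z x ≡ true
        inn x x∈ = dne λ x∉Z → ¬R (x , ∈-∖⁺ E Z {x} x∈ x∉Z)

  DecidedBy : ∀ {n} → List (Fin n × Clo) → Column n → Set
  DecidedBy ts q = All (λ (t , Z) → Decided Z (level q t)) ts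

  abstract
    decide-all : ∀ {n} (ts : List (Fin n × Clo)) (p : Column n) → ∃[ qs ] (Tree p qs × All (DecidedBy ts) qs)
    decide-all []             p = _ , leaf , [] ∷ []
    decide-all ((t , Z) ∷ ts) p =
      let (qs , tr , ds) = decide-all ts p in
      graft (λ q d → let (rs , tr′ , es) = decide q t Z in
        rs , tr′ , All.map (λ {r} (e , s) → e ∷
          All.map (λ {(t , Z)} f → ⊑-decided {Z} {level q t} {level r t} (s t) f) d) es) tr ds

  module _ {n} (p : Column n) (C : Clo) (0<C : 0ℝ < m C) where

    divide : ∀ k (q : Column n) → levels q ≼ levels p → suc k ⋆ m C ≃ m (sizeᶜ q) →
             Σ[ qs ∈ Vec (Column n) (suc k) ]
               AllV (λ r → m (sizeᶜ r) ≃ m C × levels r ≼ levels p) qs ×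
               (∀ x → count x (Vec.concat (Vec.map levels qs)) ≡ count x (levels q))
    divide zero    q q≼p e = q ∷ [] , (≃-trans (≃-sym e) (⊕-identityʳ _) , q≼p) ∷ [] , λ x →
      trans (count-++ x (levels q) []) (ℕ.+-identityʳ _)
    divide (suc k) q q≼p e =
      let (r , r′ , s , f) = column-split q C 0<C (<-resp ≃-refl (≃-trans (⊕-comm _ _) e)
                               (<-⊕ʳ (m C) (<-≤-trans 0<C (≤-⊕ˡ (⋆-nonneg k)))))
          open ColumnSplit s
          e′ = ⊕-cancelʳ (m C) (≃-trans (⊕-comm _ _) (≃-trans e (≃-trans sizes (≃-trans (⊕-comm _ _) (⊕-cong ≃-refl f)))))
          (qs , h , c) = divide k r′ (λ t x y → q≼p t x (splitʳ t x y)) e′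
      in r ∷ qs , (f , (λ t x y → q≼p t x (splitˡ t x y))) ∷ h
       , λ x → trans (count-++ x (levels r) _) (trans (cong (count x (levels r) ℕ.+_) (c x)) (sym (count-cut {Es = levels q} {levels r} {levels r′} cuts x)))
      where
      ⋆-nonneg : ∀ k → 0ℝ ≤ k ⋆ m C
      ⋆-nonneg k = ≤-trans (≃⇒≤ (≃-sym (⋆-zero k))) (⋆-mono-≤ k (<⇒≤ 0<C))

    record Raised (k : ℕ) : Set where
      field
        column : Column (suc k ℕ.* n)
        blocks : Vec (Vec Clo n) (suc k)
        levels-concat : levels column ≡ Vec.concat blocks
        blocks-≼ : AllV (_≼ levels p) blocks
        count-raised : ∀ x → count x (levels column) ≡ count x (levels p)
        size-raised : sizeᶜ column ≡ C

    abstract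
      -- Cutting and stacking: the column is divided into `suc k` columns with levels of measure
      -- `m C`, which are placed on top of one another. The points covered stay the same.
      raise : ∀ k → suc k ⋆ m C ≃ m (sizeᶜ p) → Raised k
      raise k e =
        let (qs , h , c) = divide k p (λ _ _ y → y) e in record
        { column = record
          { levels = Vec.concat (Vec.map levels qs) ; size = C ; pos = 0<C
          ; even = AllV.concat⁺ (AllV.map⁺ (AllV.map (λ {r} (f , _) → AllV.map (λ g → ≃-trans g f) (Column.even r)) h)) }
        ; blocks = Vec.map levels qs
        ; levels-concat = refl
        ; blocks-≼ = AllV.map⁺ (AllV.map proj₂ h)
        ; count-raised = c
        ; size-raised = refl }

  -- The form of being ℚ-like in which both implications work: it lets towers be raised to a
  -- multiple of their height, and it is what the Rokhlin property is shown to yield.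
  Divisible : Set
  Divisible = ∀ A j → ∃[ C ] suc j ⋆ m C ≃ m A

  abstract
    divisor : Divisible → ∀ (A : Clo) j → 0ℝ < m A → ∃[ C ] (0ℝ < m C × suc j ⋆ m C ≃ m A)
    divisor divisible A j 0<A =
      let (C , e) = divisible A j
      in C , ≰⇒> (λ C≤0 → <⇒≱ 0<A (≤-trans (≃⇒≤ (≃-sym e)) (≤-trans (⋆-mono-≤ (suc j) C≤0) (≃⇒≤ (⋆-zero (suc j)))))) , e

  everything : Column 1
  everything = record { levels = full ∷ [] ; size = full ; even = ≃-refl ∷ [] ; pos = m-pos full {origin} refl }

  total-measure : ∀ (L : List Clo) Z → (∀ x → sumℕ (λ E → ind E x) L ≡ ind Z x) → Sums.sumOf ℝ-⊕ m L ≃ m Z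
  total-measure []      Z h = ≃-sym (m-empty Z λ {x} x∈Z → case (trans (h x) (ind-∈ Z {x} x∈Z)))
    where
    case : 0 ≡ 1 → ⊥
    case ()
  total-measure (E ∷ L) Z h = ≃-trans (⊕-cong ≃-refl (total-measure L (Z ∖ E) rest)) (≃-sym (m-cut {Z} {E} {Z ∖ E} c))
    where
    c : Cut Z E (Z ∖ E)
    c x with χ Z x | χ E x | h x
    ... | true  | true  | _ = refl
    ... | true  | false | _ = refl
    ... | false | false | _ = refl
    c x | false | true | ()
    rest : ∀ x → sumℕ (λ E → ind E x) L ≡ ind (Z ∖ E) x
    rest x = ℕ.+-cancelˡ-≡ (ind E x) _ _ (trans (h x) (c x))

-- Homeomorphisms by back and forth

module _ {A : Set} (f : A → Clo) (x : Cantor) where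

  count-witness : ∀ L → sumℕ (λ p → ind (f p) x) L ≡ 1 → ∃[ p ] (p ∈ L × x ∈ᶜ f p)
  count-witness (p ∷ L) e with χ (f p) x in eq
  ... | true  = p , here refl , eq
  ... | false = let (q , q∈ , h) = count-witness L e in q , there q∈ , h

  count-none : ∀ {L} → sumℕ (λ p → ind (f p) x) L ≡ 0 → ∀ {p} → p ∈ L → ¬ x ∈ᶜ f p
  count-none {p ∷ L} e (here refl) h with χ (f p) x
  count-none {p ∷ L} () (here refl) refl | true
  count-none {p ∷ L} e (there p∈)  h = count-none {L} (ℕ.m+n≡0⇒n≡0 (ind (f p) x) e) p∈ h

  count-unique : ∀ {L} → sumℕ (λ p → ind (f p) x) L ≡ 1 → ∀ {p q} → p ∈ L → q ∈ L →
                 x ∈ᶜ f p → x ∈ᶜ f q → p ≡ q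
  count-unique {r ∷ L} e (here refl) (here refl) h k = refl
  count-unique {r ∷ L} e (here refl) (there q∈)  h k =
    contradiction k (count-none {L} (ℕ.suc-injective (trans (cong (ℕ._+ _) (sym (ind-∈ (f r) {x} h))) e)) q∈)
  count-unique {r ∷ L} e (there p∈)  (here refl) h k =
    contradiction h (count-none {L} (ℕ.suc-injective (trans (cong (ℕ._+ _) (sym (ind-∈ (f r) {x} k))) e)) p∈)
  count-unique {r ∷ L} e (there p∈)  (there q∈)  h k with χ (f r) x
  ... | true  = contradiction h (count-none {L} (ℕ.suc-injective e) p∈)
  ... | false = count-unique {L} e p∈ q∈ h k

  count-∩ : ∀ Z L → sumℕ (λ p → ind (f p) x) L ≡ 1 → sumℕ (λ p → ind (f p ∩ᶜ Z) x) L ≡ ind Z x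
  count-∩ Z L e = trans (go L) (lem (χ Z x) e)
    where
    lem : ∀ b {n} → n ≡ 1 → (if b then n else 0) ≡ (if b then 1 else 0)
    lem true  e = e
    lem false e = refl
    go : ∀ L → sumℕ (λ p → ind (f p ∩ᶜ Z) x) L ≡ (if χ Z x then sumℕ (λ p → ind (f p) x) L else 0)
    go [] with χ Z x
    ... | true  = refl
    ... | false = refl
    go (p ∷ L) with go L
    ... | ih with χ Z x | χ (f p) x
    ... | true  | true  = cong suc ih
    ... | true  | false = ih
    ... | false | true  = ih
    ... | false | false = ih

module BackAndForth (em : ∀ {P : Set} → Dec P) (M : ProbabilityMeasure) (G : IsGood M) where
  open RealOrder em
  open Compactness em
  open MeasureTheory em
  open Cutting em M G
  open Columns em M G

  -- At each stage the first components, and the second ones, partition the Cantor space: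
  -- every point is counted once.
  record Approximation : Set where
    field
      stage   : ℕ → List (Clo × Clo)
      once₁   : ∀ n x → count₁ x (stage n) ≡ 1
      once₂   : ∀ n x → count₂ x (stage n) ≡ 1
      sizes   : ∀ n → All (λ (a , b) → m a ≃ m b × 0ℝ < m a) (stage n)
      parents : ∀ n → All (PairIn (stage n)) (stage (suc n))
      small   : ∀ n → All (λ (a , b) → Decided (bit n) a × Decided (bit n) b) (stage (suc n))

  flip : Approximation → Approximation
  flip A = record
    { stage   = λ n → List.map swap (stage n)
    ; once₁   = λ n x → trans (sumℕ-map _ swap (stage n)) (once₂ n x)
    ; once₂   = λ n x → trans (sumℕ-map _ swap (stage n)) (once₁ n x)
    ; sizes   = λ n → All.map⁺ (All.map (λ (e , 0<a) → ≃-sym e , <-resp ≃-refl e 0<a) (sizes n))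
    ; parents = λ n → All.map⁺ (All.map (λ h → Any.map⁺ (Any.map swap h)) (parents n))
    ; small   = λ n → All.map⁺ (All.map swap (small n))
    }
    where
    open Approximation A

  module Limit (A : Approximation) where
    open Approximation A

    -- The graph of the limit map. It is symmetric under `flip`, so functionality in both directions
    -- already makes the two limit maps inverse to each other.
    Related : Cantor → Cantor → Set
    Related x y = ∀ n → ∃[ p ] (p ∈ stage n × x ∈ᶜ proj₁ p × y ∈ᶜ proj₂ p)

    small₂ : ∀ n → All (λ (_ , b) → ∀ z z′ → z ∈ᶜ b → z′ ∈ᶜ b → Agree n z z′) (stage n)
    small₂ zero    = All.tabulate λ _ _ _ _ _ _ ()
    small₂ (suc n) = All.tabulate λ {p} p∈ z z′ z∈ z′∈ i i<sn → lem p p∈ z z′ z∈ z′∈ (ℕ.m<1+n⇒m<n∨m≡n i<sn)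
      where
      lem : ∀ p → p ∈ stage (suc n) → ∀ z z′ → z ∈ᶜ proj₂ p → z′ ∈ᶜ proj₂ p → ∀ {i} → i ℕ.< n ⊎ i ≡ n → z i ≡ z′ i
      lem p p∈ z z′ z∈ z′∈ (inj₁ i<n) =
        let (q , q∈ , _ , b⊑) = find (All.lookup (parents n) p∈)
        in All.lookup (small₂ n) q∈ z z′ (b⊑ z z∈) (b⊑ z′ z′∈) _ i<n
      lem p p∈ z z′ z∈ z′∈ (inj₂ refl) = proj₂ (All.lookup (small n) p∈) z z′ z∈ z′∈

    related-functional : ∀ {x x′ y y′} → x ≗ x′ → Related x y → Related x′ y′ → y ≗ y′
    related-functional {x} x≗x′ r r′ n =
      let (p , p∈ , x∈ , y∈)   = r (suc n)
          (q , q∈ , x∈′ , y′∈) = r′ (suc n)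
          e = count-unique proj₁ x (once₁ (suc n) x) q∈ p∈ (trans (χ-≗ (proj₁ q) x≗x′) x∈′) x∈
      in proj₂ (All.lookup (small n) p∈) _ _ y∈ (subst (λ p → _ ∈ᶜ proj₂ p) e y′∈)

    module _ (x : Cantor) where
      pair-at : ∀ n → ∃[ p ] (p ∈ stage n × x ∈ᶜ proj₁ p)
      pair-at n = count-witness proj₁ x (stage n) (once₁ n x)

      target : ℕ → Clo
      target n = proj₂ (proj₁ (pair-at n))

      target-⊑ : ∀ n → target (suc n) ⊑ target n
      target-⊑ n =
        let (p , p∈ , x∈)      = pair-at (suc n)
            (p′ , p′∈ , x∈′)   = pair-at n
            (q , q∈ , a⊑ , b⊑) = find (All.lookup (parents n) p∈)
        in λ z z∈ → subst (λ p → z ∈ᶜ proj₂ p)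
             (count-unique proj₁ x (once₁ n x) q∈ p′∈ (a⊑ x x∈) x∈′) (b⊑ z z∈)

      target-mono : ∀ {k n} → k ℕ.≤′ n → target n ⊑ target k
      target-mono ℕ.≤′-refl          z z∈ = z∈
      target-mono (ℕ.≤′-step k≤n) z z∈ = target-mono k≤n z (target-⊑ _ z z∈)

      point : ∀ n → ∃[ z ] z ∈ᶜ target n
      point n = let (p , p∈ , _) = pair-at n
                    (e , 0<a) = All.lookup (sizes n) p∈
                in m-inhabited (target n) (<-resp ≃-refl e 0<a)

      -- All points of the target at stage `suc n` share their first `suc n` bits, so bit `n` can be
      -- read off any point of it. Positive measure guarantees that there is one.
      image : Cantor
      image n = proj₁ (point (suc n)) n

      image-near : ∀ {z} n → z ∈ᶜ target n → Agree n z image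
      image-near {z} n z∈ i i<n = All.lookup (small₂ (suc i)) (proj₁ (proj₂ (pair-at (suc i)))) _ _
        (target-mono (ℕ.≤⇒≤′ i<n) z z∈) (proj₂ (point (suc i))) i ℕ.≤-refl

      -- A point of a sufficiently late target lies in this target, as targets are nested, and
      -- agrees with `image` on all coordinates on which membership depends.
      image-∈ : ∀ n → image ∈ᶜ target n
      image-∈ n =
        let N = n ⊔ depth (target n)
            (z , z∈) = point N
        in ∈ᶜ-agree (target n) (agree-≤ (ℕ.m≤n⊔m n _) (image-near N z∈))
             (target-mono (ℕ.≤⇒≤′ (ℕ.m≤m⊔n n _)) z z∈)

      image-related : Related x image
      image-related n = let (p , p∈ , x∈) = pair-at n in p , p∈ , x∈ , image-∈ n

    maps : ∀ n {p} → p ∈ stage n → ∀ x → x ∈ᶜ proj₁ p → image x ∈ᶜ proj₂ p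
    maps n {p} p∈ x x∈ =
      let (q , q∈ , x∈′ , y∈) = image-related x n
      in subst (λ p → image x ∈ᶜ proj₂ p) (count-unique proj₁ x (once₁ n x) q∈ p∈ x∈′ x∈) y∈

    image-continuous : Continuous image
    image-continuous {O} o = local⇒open λ {x} Oy →
      let (n , h) = open⇒local o Oy
          (p , p∈ , x∈) = pair-at x n
      in depth (proj₁ p) , λ {x′} a → h (All.lookup (small₂ n) p∈ _ _ (image-∈ x n)
           (maps n p∈ x′ (∈ᶜ-agree (proj₁ p) a x∈)))

  related-flip : ∀ A {x y} → Limit.Related (flip A) y x → Limit.Related A x y
  related-flip A {x} {y} r n with r n
  ... | p , p∈ , y∈ , x∈ with ∈-map⁻ swap p∈
  ... | q , q∈ , refl = q , q∈ , x∈ , y∈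

  module Homeomorphism (A : Approximation) where
    open Approximation A
    module To   = Limit A
    module From = Limit (flip A)

    to-from : ∀ y → To.image (From.image y) ≗ y
    to-from y = To.related-functional (λ _ → refl) (To.image-related (From.image y))
      (related-flip A (From.image-related y))

    from-to : ∀ x → From.image (To.image x) ≗ x
    from-to x = From.related-functional (λ _ → refl) (From.image-related (To.image x))
      λ n → let (p , p∈ , x∈ , y∈) = To.image-related x n in swap p , ∈-map⁺ swap p∈ , y∈ , x∈

    to-cong : ∀ {x x′} → x ≗ x′ → To.image x ≗ To.image x′
    to-cong e = To.related-functional e (To.image-related _) (To.image-related _)

    from-cong : ∀ {x x′} → x ≗ x′ → From.image x ≗ From.image x′
    from-cong e = From.related-functional e (From.image-related _) (From.image-related _)

    open ProbabilityMeasure M using (μ; μ-cong)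

    -- At stage `depth Z` every second component lies inside `Z` or misses it. Hence `Z` and its
    -- preimage are unions of the second and of the first components of the same pairs, whose
    -- measures agree.
    preserves-clo : ∀ Z → μ (preimage-Borel To.image-continuous (cloᵇ Z)) ≃ μ (cloᵇ Z)
    preserves-clo Z = ≃-trans (μ-cong _ (cloᵇ Y) (∈-preimage⁺ To.image-continuous Z , ∈-preimage⁻ To.image-continuous Z))
      (≃-trans (≃-sym (m-μ Y)) (≃-trans (≃-sym (decompose proj₁ once₁ Y))
        (≃-trans (Sums.sumOf-cong ℝ-⊕ (stage (depth Z)) (All.tabulate λ {p} p∈ → term p p∈ em))
          (≃-trans (decompose proj₂ once₂ Z) (m-μ Z)))))
      where
      Y : Clo
      Y = preimageᶜ To.image-continuous Z
      decompose : (f : Clo × Clo → Clo) → (∀ n x → sumℕ (λ p → ind (f p) x) (stage n) ≡ 1) → ∀ Y →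
                  Sums.sumOf ℝ-⊕ (λ p → m (f p ∩ᶜ Y)) (stage (depth Z)) ≃ m Y
      decompose f once Y = ≃-trans (≃-sym (Sums.sumOf-map ℝ-⊕ m (λ p → f p ∩ᶜ Y) (stage (depth Z))))
        (total-measure (List.map (λ p → f p ∩ᶜ Y) (stage (depth Z))) Y λ x →
          trans (sumℕ-map (λ E → ind E x) (λ p → f p ∩ᶜ Y) (stage (depth Z))) (count-∩ f x Y (stage (depth Z)) (once (depth Z) x)))
      term : ∀ p → p ∈ stage (depth Z) → Dec (∃[ y ] (y ∈ᶜ proj₂ p ∩ᶜ Z)) → m (proj₁ p ∩ᶜ Y) ≃ m (proj₂ p ∩ᶜ Z)
      term p@(a , b) p∈ (yes (y , y∈)) = ≃-trans
        (m-cong {a ∩ᶜ Y} {a} (∩-⊑ˡ a Y) (λ x x∈ → ∈-∩ a Y {x} x∈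
          (∈-preimage⁺ To.image-continuous Z (inside (To.image x) (To.maps (depth Z) p∈ x x∈)))))
        (≃-trans (proj₁ (All.lookup (sizes (depth Z)) p∈))
          (m-cong {b} {b ∩ᶜ Z} (λ z z∈ → ∈-∩ b Z {z} z∈ (inside z z∈)) (∩-⊑ˡ b Z)))
        where
        inside : ∀ z → z ∈ᶜ b → z ∈ᶜ Z
        inside z z∈ = ∈ᶜ-agree Z (All.lookup (To.small₂ (depth Z)) p∈ y z (∩-⊑ˡ b Z y y∈) z∈) (∩-⊑ʳ b Z y y∈)
      term p@(a , b) p∈ (no ¬y) = ≃-trans
        (m-empty (a ∩ᶜ Y) λ {x} x∈ → ¬y (To.image x , ∈-∩ b Z {To.image x}
          (To.maps (depth Z) p∈ x (∩-⊑ˡ a Y x x∈)) (∈-preimage⁻ To.image-continuous Z (∩-⊑ʳ a Y x x∈))))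
        (≃-sym (m-empty (b ∩ᶜ Z) λ {y} y∈ → ¬y (y , y∈)))

    homeo : Homeo M
    homeo = record
      { bijection = record
        { to = To.image ; from = From.image ; to-cong = to-cong ; from-cong = from-cong
        ; inverse = (λ {x} {y} e i → trans (to-cong e i) (to-from x i))
                  , (λ {x} {y} e i → trans (from-cong e i) (from-to x i)) }
      ; to-continuous = To.image-continuous
      ; from-continuous = From.image-continuous
      ; preserves = preserves-clopen⇒preserves M To.image-continuous preserves-clo
      }

    to-maps : ∀ n {a b} → (a , b) ∈ stage n → ∀ x → x ∈ᶜ a → Homeo.to homeo x ∈ᶜ b
    to-maps n p∈ = To.maps n p∈

    from-maps : ∀ n {a b} → (a , b) ∈ stage n → ∀ y → y ∈ᶜ b → Homeo.from homeo y ∈ᶜ a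
    from-maps n p∈ = From.maps n (∈-map⁺ swap p∈)

  tree-parents : ∀ {n} {p : Column n} {qs} → Tree p qs → All (λ q → levels q ≼ levels p) qs
  tree-parents {p = p} t = tree-all
    (λ s h → (λ t x x∈ → h t x (ColumnSplit.splitˡ s t x x∈)) , (λ t x x∈ → h t x (ColumnSplit.splitʳ s t x x∈))) t (λ _ _ h → h)

  ref-parents : ∀ {n} {ps qs : List (Column n)} → Ref ps qs → All (λ q → Any (λ p → levels q ≼ levels p) ps) qs
  ref-parents []      = []
  ref-parents (t ∷ r) = All.++⁺ (All.map here (tree-parents t)) (All.map there (ref-parents r))

  ends : Column 2 → Clo × Clo
  ends p = level p zero , level p (suc zero)

  module _ (L : List (Clo × Clo)) (once₁ : ∀ x → count₁ x L ≡ 1) (once₂ : ∀ x → count₂ x L ≡ 1)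
           (sizes : All (λ (a , b) → m a ≃ m b × 0ℝ < m a) L) where

    private
      column : ∀ {p} → (m (proj₁ p) ≃ m (proj₂ p) × 0ℝ < m (proj₁ p)) → Column 2
      column {a , b} (e , 0<a) = record { levels = a ∷ b ∷ [] ; size = a ; even = ≃-refl ∷ ≃-sym e ∷ [] ; pos = 0<a }

      ends-column : ∀ {L} (sz : All (λ (a , b) → m a ≃ m b × 0ℝ < m a) L) → List.map ends (All.reduce column sz) ≡ L
      ends-column []       = refl
      ends-column (_ ∷ sz) = cong (_ ∷_) (ends-column sz)

      bits : ℕ → List (Fin 2 × Clo)
      bits n = (zero , bit n) ∷ (suc zero , bit n) ∷ []

      step : ∀ n ps → ∃[ qs ] (Ref ps qs × All (DecidedBy (bits n)) qs)
      step n = refine-each (decide-all (bits n))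

      cols : ℕ → List (Column 2)
      cols zero    = All.reduce column sizes
      cols (suc n) = proj₁ (step n (cols n))

      count-step : ∀ t n x → sumℕ (λ p → ind (level p t) x) (cols n) ≡ sumℕ (λ p → ind (level p t) x) (cols 0)
      count-step t zero    x = refl
      count-step t (suc n) x = trans (sym (ref-sum ℕ.+-0-commutativeMonoid (λ p → ind (level p t) x)
        (λ s → ColumnSplit.cuts s t x) (proj₁ (proj₂ (step n (cols n)))))) (count-step t n x)

    -- Each pair of `L` is regarded as a column with two levels. Deciding a coordinate on both
    -- levels, with cuts of equal measure on the opposite one, performs the forth and the back step
    -- together. Stage 0 is `L` itself, so the limit respects the given matching.
    extension : Approximation
    extension = record
      { stage = λ n → List.map ends (cols n)
      ; once₁ = λ n x → trans (sumℕ-map _ ends (cols n)) (trans (count-step zero n x)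
                  (trans (sym (sumℕ-map _ ends (cols 0))) (trans (cong (count₁ x) (ends-column sizes)) (once₁ x))))
      ; once₂ = λ n x → trans (sumℕ-map _ ends (cols n)) (trans (count-step (suc zero) n x)
                  (trans (sym (sumℕ-map _ ends (cols 0))) (trans (cong (count₂ x) (ends-column sizes)) (once₂ x))))
      ; sizes = λ n → All.map⁺ (All.tabulate λ {p} _ →
                  ≃-trans (level-size p zero) (≃-sym (level-size p (suc zero))) ,
                  <-resp ≃-refl (≃-sym (level-size p zero)) (posᶜ p))
      ; parents = λ n → All.map⁺ (All.map (λ h → Any.map⁺ (Any.map (λ s → s zero , s (suc zero)) h))
                    (ref-parents (proj₁ (proj₂ (step n (cols n))))))
      ; small = λ n → All.map⁺ (All.map (λ { (d ∷ d′ ∷ []) → d , d′ }) (proj₂ (proj₂ (step n (cols n)))))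
      }

    extension-homeo : Homeo M
    extension-homeo = Homeomorphism.homeo extension

    extension-to : ∀ {a b} → (a , b) ∈ L → ∀ x → x ∈ᶜ a → Homeo.to extension-homeo x ∈ᶜ b
    extension-to p∈ = Homeomorphism.to-maps extension 0 (subst (_ ∈_) (sym (ends-column sizes)) p∈)

    extension-from : ∀ {a b} → (a , b) ∈ L → ∀ y → y ∈ᶜ b → Homeo.from extension-homeo y ∈ᶜ a
    extension-from p∈ = Homeomorphism.from-maps extension 0 (subst (_ ∈_) (sym (ends-column sizes)) p∈)

-- Closing up paths

module _ {c ℓ} (Mon : CommutativeMonoid c ℓ) where
  open CommutativeMonoid Mon using (_∙_; ∙-cong; assoc; comm; _≈_) renaming (Carrier to C; refl to ≈-refl; sym to ≈-sym; trans to ≈-trans)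
  open Sums Mon

  sumOf-↭ : ∀ {A : Set} (F : A → C) {xs ys} → xs ↭ ys → sumOf F xs ≈ sumOf F ys
  sumOf-↭ F ↭-refl          = ≈-refl
  sumOf-↭ F (↭-prep x r)    = ∙-cong ≈-refl (sumOf-↭ F r)
  sumOf-↭ F (↭-swap x y r)  = ≈-trans (≈-sym (assoc _ _ _))
    (≈-trans (∙-cong (comm _ _) (sumOf-↭ F r)) (assoc _ _ _))
  sumOf-↭ F (↭-trans′ r r′) = ≈-trans (sumOf-↭ F r) (sumOf-↭ F r′)

  sumOf-reduce : ∀ {A B : Set} {P : A → Set} (g : ∀ {x} → P x → B) (F : B → C) (H : A → C) →
                 (∀ {x} (p : P x) → F (g p) ≈ H x) → ∀ {xs} (ps : All P xs) →
                 sumOf F (All.reduce g ps) ≈ sumOf H xs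
  sumOf-reduce g F H h []       = ≈-refl
  sumOf-reduce g F H h (p ∷ ps) = ∙-cong (h p) (sumOf-reduce g F H h ps)

cut-∩ : ∀ E S R Z → Cut E S R → Cut (E ∩ᶜ Z) (S ∩ᶜ Z) (R ∩ᶜ Z)
cut-∩ E S R Z c x with χ E x | χ S x | χ R x | χ Z x | c x
... | true  | true  | false | true  | _ = refl
... | true  | true  | false | false | _ = refl
... | true  | false | true  | true  | _ = refl
... | true  | false | true  | false | _ = refl
... | false | false | false | _     | _ = refl
cut-∩ E S R Z c x | true  | true  | true  | _ | ()
cut-∩ E S R Z c x | true  | false | false | _ | ()
cut-∩ E S R Z c x | false | true  | _     | _ | ()
cut-∩ E S R Z c x | false | false | true  | _ | ()

module Walks (α β : Cantor → ℕ) where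

  -- A point x is an edge from α x to β x.
  data Walk (c : ℕ) : ℕ → ∀ {n} → Vec Clo n → Set where
    []  : Walk c c []
    _∷_ : ∀ {a b n E} {Es : Vec Clo n} → (∀ x → x ∈ᶜ E → α x ≡ a × β x ≡ b) → Walk c b Es → Walk c a (E ∷ Es)

  Walkable : Clo × Clo → Set
  Walkable (E , F) = ∀ x y → x ∈ᶜ E → y ∈ᶜ F → β x ≡ α y

  walk-≼ : ∀ {a c n} {Es Fs : Vec Clo n} → Fs ≼ Es → Walk c a Es → Walk c a Fs
  walk-≼ {Fs = []}     s []      = []
  walk-≼ {Fs = _ ∷ Fs} s (e ∷ w) = (λ x x∈ → e x (s zero x x∈)) ∷ walk-≼ {Fs = Fs} (s ∘ suc) w

  walk-single : ∀ {a b} (Es : Vec Clo 1) → (∀ x → x ∈ᶜ lookup Es zero → α x ≡ a × β x ≡ b) → Walk b a Es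
  walk-single (E ∷ []) h = h ∷ []

  walk-++ : ∀ {a b c k n} {Es : Vec Clo k} {Fs : Vec Clo n} → Walk b a Es → Walk c b Fs → Walk c a (Es Vec.++ Fs)
  walk-++ []      w′ = w′
  walk-++ (e ∷ w) w′ = e ∷ walk-++ w w′

  walk-concat : ∀ {a n k} {Bs : Vec (Vec Clo n) k} → AllV (Walk a a) Bs → Walk a a (Vec.concat Bs)
  walk-concat []       = []
  walk-concat (w ∷ ws) = walk-++ w (walk-concat ws)

  walkable-path : ∀ {a c n} {Es : Vec Clo n} {f} → Walk c a Es → (∀ y → y ∈ᶜ f → α y ≡ c) → All Walkable (path Es f)
  walkable-path []            h = []
  walkable-path (e ∷ [])      h = (λ x y x∈ y∈ → trans (proj₂ (e x x∈)) (sym (h y y∈))) ∷ []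
  walkable-path (e ∷ e′ ∷ w) h =
    (λ x y x∈ y∈ → trans (proj₂ (e x x∈)) (sym (proj₁ (e′ y y∈)))) ∷ walkable-path (e′ ∷ w) h

  walkable-cyc : ∀ {a n} {Es : Vec Clo n} → Walk a a Es → All Walkable (cyc Es)
  walkable-cyc []      = []
  walkable-cyc (e ∷ w) = walkable-path (e ∷ w) (λ y y∈ → proj₁ (e y y∈))

module Elimination (em : ∀ {P : Set} → Dec P) (M : ProbabilityMeasure) (G : IsGood M) (α β : Cantor → ℕ) where
  open RealOrder em
  open Cutting em M G
  open Columns em M G
  open Walks α β

  record Path : Set where
    constructor mkPath
    field
      src tgt : ℕ
      {len}   : ℕ
      column  : Column (suc len)
      walk    : Walk tgt src (levels column)

  open Path public

  data PathSplit : Path → Path → Path → Set where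
    path-split : ∀ {s t n} {p q r : Column (suc n)} {w w′ w″} → ColumnSplit p q r →
                 PathSplit (mkPath s t p w) (mkPath s t q w′) (mkPath s t r w″)

  paths : Cuttable Path
  paths = record
    { size       = sizeᶜ ∘ column
    ; pos        = posᶜ ∘ column
    ; Split      = PathSplit
    ; split-size = λ { (path-split s) → ColumnSplit.sizes s }
    ; split      = λ p C 0<C C<p →
        let (q , r , s , e) = column-split (column p) C 0<C C<p
        in mkPath (src p) (tgt p) q (walk-≼ (ColumnSplit.splitˡ s) (walk p))
         , mkPath (src p) (tgt p) r (walk-≼ (ColumnSplit.splitʳ s) (walk p))
         , path-split s , e
    }

  open Cuttable paths using (size; total-size) renaming (ref-all to path-ref-all; ref-sum to path-ref-sum)
  open Coupling paths paths using (SameSize; couple)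
  open Sums ℝ-⊕

  at : ℕ → ℕ → ℝ → ℝ
  at v k r with k ℕ.≟ v
  ... | yes _ = r
  ... | no  _ = 0ℝ

  at-≡ : ∀ {v k} r → k ≡ v → at v k r ≃ r
  at-≡ {v} {k} r e with k ℕ.≟ v
  ... | yes _ = ≃-refl
  ... | no ¬e = contradiction e ¬e

  at-≢ : ∀ {v k} r → k ≢ v → at v k r ≃ 0ℝ
  at-≢ {v} {k} r ¬e with k ℕ.≟ v
  ... | yes e = contradiction e ¬e
  ... | no _  = ≃-refl

  at-cong : ∀ v k {r s} → r ≃ s → at v k r ≃ at v k s
  at-cong v k e with k ℕ.≟ v
  ... | yes _ = e
  ... | no _  = ≃-refl

  at-⊕ : ∀ v k r s → at v k (r ⊕ s) ≃ at v k r ⊕ at v k s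
  at-⊕ v k r s with k ℕ.≟ v
  ... | yes _ = ≃-refl
  ... | no _  = ≃-sym (⊕-identityˡ 0ℝ)

  outflow inflow : ℕ → Path → ℝ
  outflow v p = at v (src p) (m (size p))
  inflow  v p = at v (tgt p) (m (size p))

  outflow-split : ∀ v {p q r} → PathSplit p q r → outflow v p ≃ outflow v q ⊕ outflow v r
  outflow-split v (path-split {s = s} c) = ≃-trans (at-cong v s (ColumnSplit.sizes c)) (at-⊕ v s _ _)

  inflow-split : ∀ v {p q r} → PathSplit p q r → inflow v p ≃ inflow v q ⊕ inflow v r
  inflow-split v (path-split {t = t} c) = ≃-trans (at-cong v t (ColumnSplit.sizes c)) (at-⊕ v t _ _)

  visits : Cantor → Path → ℕ
  visits x p = count x (levels (column p))

  visits-split : ∀ x {p q r} → PathSplit p q r → visits x p ≡ visits x q ℕ.+ visits x r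
  visits-split x (path-split {p = p} {q} {r} c) = count-cut {Es = levels p} {levels q} {levels r} (ColumnSplit.cuts c) x

  Closed : Path → Set
  Closed p = src p ≡ tgt p

  Below : ℕ → Path → Set
  Below k p = src p ℕ.< k × tgt p ℕ.< k

  Into OutOf : ℕ → Path → Set
  Into  b p = src p ℕ.< b × tgt p ≡ b
  OutOf b p = src p ≡ b × tgt p ℕ.< b

  Balanced : ℕ → List Path → Set
  Balanced v L = sumOf (outflow v) L ≃ sumOf (inflow v) L

  module _ (b : ℕ) where

    record Sorted (L : List Path) : Set where
      field
        rest ins outs : List Path
        permuted : L ↭ rest ++ ins ++ outs
        rest-ok  : All (λ p → Closed p ⊎ Below b p) rest
        ins-ok   : All (Into b) ins
        outs-ok  : All (OutOf b) outs

    sort : ∀ {L} → All (λ p → Closed p ⊎ Below (suc b) p) L → Sorted L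
    sort [] = record { rest = [] ; ins = [] ; outs = [] ; permuted = ↭-refl ; rest-ok = [] ; ins-ok = [] ; outs-ok = [] }
    sort {p ∷ L} (h ∷ hs) = insert h
      where
      open Sorted (sort hs)
      insert-rest : Closed p ⊎ Below b p → Sorted (p ∷ L)
      insert-rest h = record { rest = p ∷ rest ; ins = ins ; outs = outs ; permuted = ↭-prep p permuted
                             ; rest-ok = h ∷ rest-ok ; ins-ok = ins-ok ; outs-ok = outs-ok }
      insert : Closed p ⊎ Below (suc b) p → Sorted (p ∷ L)
      insert (inj₁ c) = insert-rest (inj₁ c)
      insert (inj₂ (s< , t<)) with ℕ.m<1+n⇒m<n∨m≡n s< | ℕ.m<1+n⇒m<n∨m≡n t<
      ... | inj₁ s<b | inj₁ t<b = insert-rest (inj₂ (s<b , t<b))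
      ... | inj₂ s≡b | inj₂ t≡b = insert-rest (inj₁ (trans s≡b (sym t≡b)))
      ... | inj₁ s<b | inj₂ t≡b = record
        { rest = rest ; ins = p ∷ ins ; outs = outs
        ; permuted = ↭-trans (↭-prep p permuted) (↭-sym (↭.shift p rest (ins ++ outs)))
        ; rest-ok = rest-ok ; ins-ok = (s<b , t≡b) ∷ ins-ok ; outs-ok = outs-ok }
      ... | inj₂ s≡b | inj₁ t<b = record
        { rest = rest ; ins = ins ; outs = p ∷ outs
        ; permuted = ↭-trans (↭-prep p permuted) (↭-trans (↭-sym (↭.shift p rest (ins ++ outs)))
                       (↭.++⁺ˡ rest (↭-sym (↭.shift p ins outs))))
        ; rest-ok = rest-ok ; ins-ok = ins-ok ; outs-ok = (s≡b , t<b) ∷ outs-ok }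

    Joinable : Path × Path → Set
    Joinable (p , q) = SameSize p q × Into b p × OutOf b q

    join : ∀ {pq} → Joinable pq → Path
    join {p , q} (e , (_ , t≡b) , (s≡b , _)) = record
      { src = src p ; tgt = tgt q
      ; column = record
        { levels = levels (column p) Vec.++ levels (column q) ; size = size p ; pos = posᶜ (column p)
        ; even = AllV.++⁺ (Column.even (column p)) (AllV.map (λ f → ≃-trans f (≃-sym e)) (Column.even (column q))) }
      ; walk = walk-++ (subst (λ v → Walk v (src p) _) (trans t≡b (sym s≡b)) (walk p)) (walk q)
      }

    module Step {L} (S : Sorted L) (balanced : ∀ v → v ℕ.< suc b → Balanced v L) where
      open Sorted S

      sum-sorted : ∀ {c ℓ} (Mon : CommutativeMonoid c ℓ) (F : Path → CommutativeMonoid.Carrier Mon) →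
                   let open CommutativeMonoid Mon
                       open Sums Mon renaming (sumOf to sum)
                   in sum F L ≈ sum F rest ∙ (sum F ins ∙ sum F outs)
      sum-sorted Mon F = ≈-trans (sumOf-↭ Mon F permuted)
        (≈-trans (Sums.sumOf-++ Mon F rest (ins ++ outs)) (∙-cong ≈-refl (Sums.sumOf-++ Mon F ins outs)))
        where open CommutativeMonoid Mon using (∙-cong) renaming (refl to ≈-refl; trans to ≈-trans)

      zero-sum : ∀ {F : Path → ℝ} {L} → All (λ p → F p ≃ 0ℝ) L → sumOf F L ≃ 0ℝ
      zero-sum []       = ≃-refl
      zero-sum (e ∷ es) = ≃-trans (⊕-cong e (zero-sum es)) (⊕-identityˡ 0ℝ)

      -- At vertex `b` a closed path contributes equally to both flows and a path below `b` to
      -- neither. Cancelling these from the balance at `b` leaves the paths that enter and those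
      -- that leave.
      equal-totals : total-size ins ≃ total-size outs
      equal-totals = ≃-sym (⊕-cancelʳ r (≃-trans (⊕-comm _ _) (≃-trans (≃-sym out) (≃-trans (balanced b ℕ.≤-refl) (≃-trans inn (⊕-comm _ _))))))
        where
        r = sumOf (inflow b) rest
        out : sumOf (outflow b) L ≃ r ⊕ total-size outs
        out = ≃-trans (sum-sorted ℝ-⊕ (outflow b)) (⊕-cong
          (sumOf-cong rest (All.map (λ {p} → same {p}) rest-ok))
          (≃-trans (⊕-cong (zero-sum (All.map (λ {p} (s<b , _) → at-≢ (m (size p)) (ℕ.<⇒≢ s<b)) ins-ok))
                      (sumOf-cong outs (All.map (λ {p} (s≡b , _) → at-≡ (m (size p)) s≡b) outs-ok)))
            (⊕-identityˡ _)))
          where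
          same : ∀ {p} → Closed p ⊎ Below b p → outflow b p ≃ inflow b p
          same {p} (inj₁ c) = subst (λ k → outflow b p ≃ at b k (m (size p))) c ≃-refl
          same {p} (inj₂ (s<b , t<b)) = ≃-trans (at-≢ (m (size p)) (ℕ.<⇒≢ s<b)) (≃-sym (at-≢ (m (size p)) (ℕ.<⇒≢ t<b)))
        inn : sumOf (inflow b) L ≃ r ⊕ total-size ins
        inn = ≃-trans (sum-sorted ℝ-⊕ (inflow b)) (⊕-cong ≃-refl
          (≃-trans (⊕-cong (sumOf-cong ins (All.map (λ {p} (_ , t≡b) → at-≡ (m (size p)) t≡b) ins-ok))
                      (zero-sum (All.map (λ {p} (_ , t<b) → at-≢ (m (size p)) (ℕ.<⇒≢ t<b)) outs-ok)))
            (⊕-identityʳ _)))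

      coupled = couple ins outs equal-totals
      ps = proj₁ coupled
      ref₁ = proj₁ (proj₂ coupled)
      ref₂ = proj₁ (proj₂ (proj₂ coupled))

      joinable : All Joinable ps
      joinable = All.zip (proj₂ (proj₂ (proj₂ coupled)) , All.zip
        ( All.map⁻ (path-ref-all (λ { (path-split _) h → h , h }) ref₁ ins-ok)
        , All.map⁻ (path-ref-all (λ { (path-split _) h → h , h }) ref₂ outs-ok) ))

      joined : List Path
      joined = All.reduce (λ {pq} → join {pq}) joinable

      next : List Path
      next = rest ++ joined

      next-ok : All (λ p → Closed p ⊎ Below b p) next
      next-ok = All.++⁺ rest-ok (ok joinable)
        where
        ok : ∀ {ps} (js : All Joinable ps) → All (λ p → Closed p ⊎ Below b p) (All.reduce (λ {pq} → join {pq}) js)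
        ok []                                 = []
        ok ((_ , (s< , _) , (_ , t<)) ∷ js) = inj₂ (s< , t<) ∷ ok js

      outflow-joined : ∀ v → sumOf (outflow v) joined ≃ sumOf (outflow v) ins
      outflow-joined v = ≃-trans (sumOf-reduce ℝ-⊕ (λ {pq} → join {pq}) (outflow v) (outflow v ∘ proj₁) (λ {(p , q)} _ → ≃-refl {outflow v p}) joinable)
        (≃-trans (≃-sym (sumOf-map (outflow v) proj₁ ps)) (≃-sym (path-ref-sum ℝ-⊕ (outflow v) (outflow-split v) ref₁)))

      inflow-joined : ∀ v → sumOf (inflow v) joined ≃ sumOf (inflow v) outs
      inflow-joined v = ≃-trans (sumOf-reduce ℝ-⊕ (λ {pq} → join {pq}) (inflow v) (inflow v ∘ proj₂)
          (λ {(p , q)} (e , _) → at-cong v (tgt q) e) joinable)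
        (≃-trans (≃-sym (sumOf-map (inflow v) proj₂ ps)) (≃-sym (path-ref-sum ℝ-⊕ (inflow v) (inflow-split v) ref₂)))

      -- Joining keeps the sources of the incoming paths and the targets of the outgoing ones. What
      -- disappears are sources and targets at `b`, which do not count at a vertex below `b`.
      next-balanced : ∀ v → v ℕ.< b → Balanced v next
      next-balanced v v<b = ≃-trans out (≃-trans (balanced v (ℕ.m<n⇒m<1+n v<b)) (≃-sym inn))
        where
        b≢v : b ≢ v
        b≢v b≡v = ℕ.<⇒≢ v<b (sym b≡v)
        out : sumOf (outflow v) next ≃ sumOf (outflow v) L
        out = ≃-trans (sumOf-++ (outflow v) rest joined) (≃-trans
          (⊕-cong ≃-refl (≃-trans (outflow-joined v) (≃-trans (≃-sym (⊕-identityʳ _)) (⊕-cong ≃-refl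
            (≃-sym (zero-sum (All.map (λ {p} (s≡b , _) → at-≢ (m (size p)) (λ e → b≢v (trans (sym s≡b) e))) outs-ok)))))))
          (≃-sym (sum-sorted ℝ-⊕ (outflow v))))
        inn : sumOf (inflow v) next ≃ sumOf (inflow v) L
        inn = ≃-trans (sumOf-++ (inflow v) rest joined) (≃-trans
          (⊕-cong ≃-refl (≃-trans (inflow-joined v) (≃-trans (≃-sym (⊕-identityˡ _)) (⊕-cong
            (≃-sym (zero-sum (All.map (λ {p} (_ , t≡b) → at-≢ (m (size p)) (λ e → b≢v (trans (sym t≡b) e))) ins-ok))) ≃-refl))))
          (≃-sym (sum-sorted ℝ-⊕ (inflow v))))

      next-visits : ∀ x → sumℕ (visits x) next ≡ sumℕ (visits x) L
      next-visits x = trans (sumℕ-++ (visits x) rest joined) (trans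
        (cong (sumℕ (visits x) rest ℕ.+_) (trans
          (sumOf-reduce ℕ.+-0-commutativeMonoid (λ {pq} → join {pq}) (visits x) (λ (p , q) → visits x p ℕ.+ visits x q)
            (λ {(p , q)} _ → count-++ x (levels (column p)) (levels (column q))) joinable)
          (trans (sumℕ-+ (visits x ∘ proj₁) (visits x ∘ proj₂) ps) (cong₂ ℕ._+_
            (trans (sym (sumℕ-map (visits x) proj₁ ps)) (sym (path-ref-sum ℕ.+-0-commutativeMonoid (visits x) (visits-split x) ref₁)))
            (trans (sym (sumℕ-map (visits x) proj₂ ps)) (sym (path-ref-sum ℕ.+-0-commutativeMonoid (visits x) (visits-split x) ref₂)))))))
        (sym (sum-sorted ℕ.+-0-commutativeMonoid (visits x))))

  -- A balanced family of paths on finitely many vertices is rearranged into closed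
  -- ones by joining, at one vertex after another, the paths that enter to those that leave.
  abstract
    close-up : ∀ k L → All (λ p → Closed p ⊎ Below k p) L → (∀ v → v ℕ.< k → Balanced v L) →
               Σ[ L′ ∈ List Path ] All Closed L′ × (∀ x → sumℕ (visits x) L′ ≡ sumℕ (visits x) L)
    close-up zero    L h bal = L , All.map (λ { (inj₁ c) → c }) h , λ _ → refl
    close-up (suc b) L h bal =
      let open Step b (sort b h) bal
          (L′ , c , v) = close-up b next next-ok next-balanced
      in L′ , c , λ x → trans (v x) (next-visits x)

-- Periodic approximation

fromBool : Bool → Fin 2
fromBool true  = suc zero
fromBool false = zero

fromBool-injective : ∀ {b c} → fromBool b ≡ fromBool c → b ≡ c
fromBool-injective {true}  {true}  _ = refl
fromBool-injective {false} {false} _ = refl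

-- Names the atom of `x` in the algebra generated by the list, through the string of its membership
-- bits. The atoms serve as vertices of the graph, so they are numbered below a known bound.
code : ∀ {k} → Vec Clo k → Cantor → Fin (2 ℕ.^ k)
code []       x = zero
code (C ∷ Cs) x = Fin.combine (fromBool (χ C x)) (code Cs x)

code-injective : ∀ {k} (Cs Ds : Vec Clo k) {x y} → code Cs x ≡ code Ds y → ∀ t → χ (lookup Cs t) x ≡ χ (lookup Ds t) y
code-injective (C ∷ Cs) (D ∷ Ds) {x} {y} e zero    =
  fromBool-injective (Fin.combine-injectiveˡ (fromBool (χ C x)) (code Cs x) (fromBool (χ D y)) (code Ds y) e)
code-injective (C ∷ Cs) (D ∷ Ds) {x} {y} e (suc t) =
  code-injective Cs Ds (Fin.combine-injectiveʳ (fromBool (χ C x)) (code Cs x) (fromBool (χ D y)) (code Ds y) e) t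

code-cong : ∀ {k} (Cs Ds : Vec Clo k) {x y} → (∀ t → χ (lookup Cs t) x ≡ χ (lookup Ds t) y) → code Cs x ≡ code Ds y
code-cong []       []       h = refl
code-cong (C ∷ Cs) (D ∷ Ds) h = cong₂ (λ b c → Fin.combine (fromBool b) c) (h zero) (code-cong Cs Ds (h ∘ suc))

depths : ∀ {k} → Vec Clo k → ℕ
depths []       = 0
depths (C ∷ Cs) = depth C ⊔ depths Cs

depth-≤ : ∀ {k} (Cs : Vec Clo k) t → depth (lookup Cs t) ℕ.≤ depths Cs
depth-≤ (C ∷ Cs) zero    = ℕ.m≤m⊔n _ _
depth-≤ (C ∷ Cs) (suc t) = ℕ.≤-trans (depth-≤ Cs t) (ℕ.m≤n⊔m (depth C) _)

module Periodic (em : ∀ {P : Set} → Dec P) (M : ProbabilityMeasure) (G : IsGood M)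
                (h : Homeo M) {k} (Cs : Vec Clo k) where
  open RealOrder em
  open Compactness em
  open MeasureTheory em
  open Cutting em M G
  open Columns em M G
  open Homeo h using (to; from; to-continuous; from-continuous; preserves; strictlyInverseʳ)
  open ProbabilityMeasure M using (μ; μ-cong)

  Ds : Vec Clo k
  Ds = Vec.map (preimageᶜ from-continuous) Cs

  χ-Ds : ∀ t y → χ (lookup Ds t) y ≡ χ (lookup Cs t) (from y)
  χ-Ds t y = trans (cong (λ D → χ D y) (Vec.lookup-map t (preimageᶜ from-continuous) Cs)) (χ-preimageᶜ from-continuous (lookup Cs t) y)

  -- β x ≡ α (h x), so a map that sends every x to some y with α y ≡ β x agrees with h up to Cs.
  α β : Cantor → ℕ
  α x = Fin.toℕ (code Ds x)
  β x = Fin.toℕ (code Cs x)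

  α-to : ∀ x → α (to x) ≡ β x
  α-to x = cong Fin.toℕ (code-cong Ds Cs λ t →
    trans (χ-Ds t (to x)) (χ-≗ (lookup Cs t) (strictlyInverseʳ x)))

  β≡α⇒ : ∀ {x y} → β x ≡ α y → ∀ t → x ∈ᶜ lookup Cs t → from y ∈ᶜ lookup Cs t
  β≡α⇒ {x} {y} e t x∈ = trans (sym (χ-Ds t y)) (trans (sym (code-injective Cs Ds (Fin.toℕ-injective e) t)) x∈)

  open Walks α β public
  open Elimination em M G α β public

  code-local : ∀ {k} (Es : Vec Clo k) {x y} → Agree (depths Es) x y → code Es x ≡ code Es y
  code-local Es a = code-cong Es Es λ t → local (lookup Es t) (agree-≤ (depth-≤ Es t) a)

  abstract
    fibre : ∀ {k} → Vec Clo k → ℕ → Clo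
    fibre Es v = fromPred (λ x → Fin.toℕ (code Es x) ≡ v) (depths Es) (λ a e → trans (cong Fin.toℕ (sym (code-local Es a))) e)

    fibre⁻ : ∀ {k} (Es : Vec Clo k) {v x} → x ∈ᶜ fibre Es v → Fin.toℕ (code Es x) ≡ v
    fibre⁻ Es = fromPred⁻ {h = λ a e → trans (cong Fin.toℕ (sym (code-local Es a))) e}

    fibre⁺ : ∀ {k} (Es : Vec Clo k) {v x} → Fin.toℕ (code Es x) ≡ v → x ∈ᶜ fibre Es v
    fibre⁺ Es = fromPred⁺ {h = λ a e → trans (cong Fin.toℕ (sym (code-local Es a))) e}

  -- Since `α (to x) ≡ β x`, the preimage under `h` of the points with source `v` consists of the
  -- points with target `v`, and `h` preserves the measure.
  fibres-balanced : ∀ v → m (fibre Ds v) ≃ m (fibre Cs v)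
  fibres-balanced v = ≃-trans (m-μ (fibre Ds v)) (≃-trans (≃-sym (preserves (cloᵇ (fibre Ds v))))
    (≃-trans (μ-cong _ (cloᵇ (fibre Cs v))
      ( (λ {x} e → fibre⁺ Cs (trans (sym (α-to x)) (fibre⁻ Ds e)))
      , (λ {x} e → fibre⁺ Ds (trans (α-to x) (fibre⁻ Cs e)))))
      (≃-sym (m-μ (fibre Cs v)))))

  tasks : List (Fin 1 × Clo)
  tasks = List.map (zero ,_) (Vec.toList Cs) ++ List.map (zero ,_) (Vec.toList Ds)

  decided-lookup : ∀ {k} (Es : Vec Clo k) {q : Column 1} → DecidedBy (List.map (zero ,_) (Vec.toList Es)) q →
                   ∀ t → Decided (lookup Es t) (level q zero)
  decided-lookup (E ∷ Es) (d ∷ ds) zero        = d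
  decided-lookup (E ∷ Es) {q} (d ∷ ds) (suc t) = decided-lookup Es {q} ds t

  module _ {q : Column 1} (ds : DecidedBy tasks q) where
    private
      inhabited = m-inhabited (level q zero) (<-resp ≃-refl (≃-sym (level-size q zero)) (posᶜ q))
      z = proj₁ inhabited
      z∈ = proj₂ inhabited
      d₁ = All.++⁻ˡ (List.map (zero ,_) (Vec.toList Cs)) ds
      d₂ = All.++⁻ʳ (List.map (zero ,_) (Vec.toList Cs)) ds

    α-constant : ∀ x → x ∈ᶜ level q zero → α x ≡ α z
    α-constant x x∈ = cong Fin.toℕ (code-cong Ds Ds λ t → decided-lookup Ds {q} d₂ t x z x∈ z∈)

    β-constant : ∀ x → x ∈ᶜ level q zero → β x ≡ β z
    β-constant x x∈ = cong Fin.toℕ (code-cong Cs Cs λ t → decided-lookup Cs {q} d₁ t x z x∈ z∈)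

    edge : Path
    edge = record { src = α z ; tgt = β z ; column = q
                  ; walk = walk-single (levels q) (λ x x∈ → α-constant x x∈ , β-constant x x∈) }

    -- The level lies entirely in one fibre. Writing its weight at `v` as the measure of an
    -- intersection makes the flow of all edges through `v` sum to the measure of the fibre.
    at-fibre : ∀ {k} (Es : Vec Clo k) v → (∀ x → x ∈ᶜ level q zero → Fin.toℕ (code Es x) ≡ Fin.toℕ (code Es z)) →
               at v (Fin.toℕ (code Es z)) (m (sizeᶜ q)) ≃ m (level q zero ∩ᶜ fibre Es v)
    at-fibre Es v const = go (Fin.toℕ (code Es z) ℕ.≟ v)
      where
      go : Dec (Fin.toℕ (code Es z) ≡ v) → at v (Fin.toℕ (code Es z)) (m (sizeᶜ q)) ≃ m (level q zero ∩ᶜ fibre Es v)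
      go (yes e) = ≃-trans (at-≡ _ e) (≃-trans (≃-sym (level-size q zero)) (m-cong
        (λ x x∈ → ∈-∩ (level q zero) (fibre Es v) {x} x∈ (fibre⁺ Es (trans (const x x∈) e)))
        (∩-⊑ˡ (level q zero) (fibre Es v))))
      go (no ¬e) = ≃-trans (at-≢ _ ¬e) (≃-sym (m-empty (level q zero ∩ᶜ fibre Es v) λ {x} x∈ →
        ¬e (trans (sym (const x (∩-⊑ˡ (level q zero) (fibre Es v) x x∈))) (fibre⁻ Es (∩-⊑ʳ (level q zero) (fibre Es v) x x∈)))))

  abstract
    initial : ∃[ qs ] (Tree everything qs × All (DecidedBy tasks) qs)
    initial = decide-all tasks everything

  edges : List Path
  edges = All.reduce (λ {q} → edge {q}) (proj₂ (proj₂ initial))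

  edges-below : ∀ {qs} (ds : All (DecidedBy tasks) qs) →
                All (λ p → Closed p ⊎ Below (2 ℕ.^ k) p) (All.reduce (λ {q} → edge {q}) ds)
  edges-below []       = []
  edges-below (d ∷ ds) = inj₂ (Fin.toℕ<n _ , Fin.toℕ<n _) ∷ edges-below ds

  fibre-sum : ∀ Z → Sums.sumOf ℝ-⊕ (λ q → m (level q zero ∩ᶜ Z)) (proj₁ initial) ≃ m Z
  fibre-sum Z = ≃-trans (≃-sym (tree-sum ℝ-⊕ (λ q → m (level q zero ∩ᶜ Z))
    (λ {p} {q} {r} s → m-cut (cut-∩ (level p zero) (level q zero) (level r zero) Z (ColumnSplit.cuts s zero))) (proj₁ (proj₂ initial))))
    (m-cong (λ _ h → h) (λ _ h → h))

  edges-balanced : ∀ v → Balanced v edges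
  edges-balanced v = ≃-trans
    (sumOf-reduce ℝ-⊕ (λ {q} → edge {q}) (outflow v) (λ q → m (level q zero ∩ᶜ fibre Ds v))
      (λ {q} d → at-fibre {q} d Ds v (α-constant {q} d)) (proj₂ (proj₂ initial)))
    (≃-trans (fibre-sum (fibre Ds v)) (≃-trans (fibres-balanced v) (≃-sym (≃-trans
      (sumOf-reduce ℝ-⊕ (λ {q} → edge {q}) (inflow v) (λ q → m (level q zero ∩ᶜ fibre Cs v))
        (λ {q} d → at-fibre {q} d Cs v (β-constant {q} d)) (proj₂ (proj₂ initial)))
      (fibre-sum (fibre Cs v))))))

  edges-visits : ∀ x → sumℕ (visits x) edges ≡ 1
  edges-visits x = trans
    (sumOf-reduce ℕ.+-0-commutativeMonoid (λ {q} → edge {q}) (visits x) (λ q → count x (levels q)) (λ _ → refl) (proj₂ (proj₂ initial)))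
    (sym (tree-sum ℕ.+-0-commutativeMonoid (λ q → count x (levels q))
      (λ {p} {q} {r} s → count-cut {Es = levels p} {levels q} {levels r} (ColumnSplit.cuts s) x) (proj₁ (proj₂ initial))))

  abstract
    closed-paths : Σ[ L ∈ List Path ] All Closed L × (∀ x → sumℕ (visits x) L ≡ 1)
    closed-paths =
      let (L , c , v) = close-up (2 ℕ.^ k) edges (edges-below (proj₂ (proj₂ initial))) (λ v _ → edges-balanced v)
      in L , c , λ x → trans (v x) (edges-visits x)

  record Cycle (n : ℕ) : Set where
    constructor mkCycle
    field
      {vertex} : ℕ
      tower    : Column n
      closed   : Walk vertex vertex (levels tower)

  open Cycle public

  module Raising (divisible : Divisible) where

    abstract
      raise-cycle : ∀ {n H} j → suc j ℕ.* n ≡ H → (c : Cycle n) →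
                    Σ[ d ∈ Cycle H ] suc j ⋆ m (sizeᶜ (tower d)) ≃ m (sizeᶜ (tower c)) ×
                      (∀ x → count x (levels (tower d)) ≡ count x (levels (tower c)))
      raise-cycle j refl (mkCycle {v} p w) =
        let (C , 0<C , e) = divisor divisible (sizeᶜ p) j (posᶜ p)
            open Raised (raise p C 0<C j e) renaming (column to raised)
        in mkCycle raised (subst (Walk v v) (sym levels-concat) (walk-concat (AllV.map (λ s → walk-≼ s w) blocks-≼)))
         , ≃-trans (⋆-congʳ (suc j) (subst (λ D → m D ≃ m C) (sym size-raised) ≃-refl)) e
         , count-raised

    abstract
      common-height : (L : List Path) → ∃[ h ] All (λ p → ∃[ j ] suc j ℕ.* suc (len p) ≡ suc h) L
      common-height []      = 0 , []
      common-height (p ∷ L) =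
        let (h , hs) = common-height L
        -- The product of all lengths serves as common multiple. Lengths and factors are stored as
        -- predecessors, and this value is one less than `suc (len p) * suc h`.
        in h ℕ.+ len p ℕ.* suc h , (h , ℕ.*-comm (suc h) (suc (len p))) ∷
           All.map (λ { {q} (j , e) → j ℕ.+ len p ℕ.* suc j ,
             trans (ℕ.*-assoc (suc (len p)) (suc j) (suc (len q))) (cong (suc (len p) ℕ.*_) e) }) hs

    closed-cycle : ∀ {p} → Closed p → Cycle (suc (len p))
    closed-cycle {p} c = mkCycle (column p) (subst (λ v → Walk v (src p) (levels (column p))) (sym c) (walk p))

    abstract
      cycles : ∃[ h ] Σ[ cs ∈ List (Cycle (suc h)) ] (∀ x → sumℕ (λ c → count x (levels (tower c))) cs ≡ 1)
      cycles =
        let (L , c , v) = closed-paths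
            (h , js) = common-height L
            evidence = All.zip (c , js)
            lift : ∀ {p} → Closed p × (∃[ j ] suc j ℕ.* suc (len p) ≡ suc h) → Cycle (suc h)
            lift = λ {p} (c , j , e) → proj₁ (raise-cycle j e (closed-cycle {p} c))
        in h , All.reduce (λ {p} → lift {p}) evidence , λ x → trans
             (sumOf-reduce ℕ.+-0-commutativeMonoid (λ {p} → lift {p}) (λ c → count x (levels (tower c))) (visits x)
               (λ {p} (c , j , e) → proj₂ (proj₂ (raise-cycle j e (closed-cycle {p} c))) x) evidence)
             (v x)

-- The universal homeomorphism

increment : List ℕ → List ℕ
increment []       = []
increment (k ∷ ks) = suc k ∷ ks

-- Reads a binary numeral as a list of numbers in unary, each terminated by an even digit.
decodeᵇ : ℕᵇ → List ℕ
decodeᵇ ℕᵇ.zero  = []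
decodeᵇ 2[1+ b ] = 0 ∷ decodeᵇ b
decodeᵇ 1+[2 b ] = increment (decodeᵇ b)

encodeᵇ : List ℕ → ℕᵇ
encodeᵇ []       = ℕᵇ.zero
encodeᵇ (k ∷ ks) = prepend k (encodeᵇ ks)
  where
  prepend : ℕ → ℕᵇ → ℕᵇ
  prepend zero    b = 2[1+ b ]
  prepend (suc k) b = 1+[2 prepend k b ]

decode-encodeᵇ : ∀ ks → decodeᵇ (encodeᵇ ks) ≡ ks
decode-encodeᵇ []           = refl
decode-encodeᵇ (zero ∷ ks)  = cong (0 ∷_) (decode-encodeᵇ ks)
decode-encodeᵇ (suc k ∷ ks) = cong increment (decode-encodeᵇ (k ∷ ks))

decode : ℕ → List ℕ
decode n = decodeᵇ (ℕᵇ.fromℕ n)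

decode-onto : ∀ ks → ∃[ n ] decode n ≡ ks
decode-onto ks = ℕᵇ.toℕ (encodeᵇ ks) , trans (cong decodeᵇ (ℕᵇ.fromℕ-toℕ (encodeᵇ ks))) (decode-encodeᵇ ks)

PairIn-trans : ∀ {K L p} → All (PairIn L) K → PairIn K p → PairIn L p
PairIn-trans {K} {L} h p∈ =
  let (_ , q∈ , a , b) = find p∈
  in Any.map (λ (c , d) → (λ x y → c x (a x y)) , (λ x y → d x (b x y))) (All.lookup h q∈)

pairs-trans : ∀ {J K L} → All (PairIn L) K → All (PairIn K) J → All (PairIn L) J
pairs-trans h = All.map (λ {p} → PairIn-trans {p = p} h)

cyc-≼ : ∀ {n} (Fs Es : Vec Clo n) → Fs ≼ Es → All (PairIn (cyc Es)) (cyc Fs)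
cyc-≼ []       []       s = []
cyc-≼ (F ∷ Fs) (E ∷ Es) s = path-≼ {Fs = F ∷ Fs} {E ∷ Es} s (s zero)

pairs-of : ∀ {n} → List (Vec Clo n) → List (Clo × Clo)
pairs-of = List.concatMap cyc

All-concatMap⁺ : ∀ {A B : Set} {p} {P : B → Set p} (f : A → List B) {xs} → All (λ x → All P (f x)) xs → All P (List.concatMap f xs)
All-concatMap⁺ f []       = []
All-concatMap⁺ f (p ∷ ps) = All.++⁺ p (All-concatMap⁺ f ps)

module _ {c ℓ} (Mon : CommutativeMonoid c ℓ) where
  open CommutativeMonoid Mon using (_∙_; ∙-cong; _≈_) renaming (Carrier to C; refl to ≈-refl; sym to ≈-sym; trans to ≈-trans)
  open Sums Mon

  sumOf-concatMap : ∀ {A B : Set} (F : B → C) (f : A → List B) xs →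
                    sumOf F (List.concatMap f xs) ≈ sumOf (λ x → sumOf F (f x)) xs
  sumOf-concatMap F f []       = ≈-refl
  sumOf-concatMap F f (x ∷ xs) = ≈-trans (sumOf-++ F (f x) _) (∙-cong ≈-refl (sumOf-concatMap F f xs))

module Universal (em : ∀ {P : Set} → Dec P) (M : ProbabilityMeasure) (G : IsGood M) where
  open RealOrder em
  open Cutting em M G
  open Columns em M G
  open BackAndForth em M G

  module _ {n : ℕ} (cols : List (Column n)) (once : ∀ x → sumℕ (λ p → count x (levels p)) cols ≡ 1) where
    private
      flat : ∀ {k} → Vec Clo k → List Clo
      flat = Vec.toList

      flat-count : ∀ {k} x (Es : Vec Clo k) → sumℕ (λ E → ind E x) (flat Es) ≡ count x Es
      flat-count x []       = refl
      flat-count x (E ∷ Es) = cong (ind E x ℕ.+_) (flat-count x Es)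

      flat-size : ∀ {k r} (Es : Vec Clo k) → AllV (λ E → m E ≃ r) Es → Sums.sumOf ℝ-⊕ m (flat Es) ≃ k ⋆ r
      flat-size []       []       = ≃-refl
      flat-size (E ∷ Es) (e ∷ es) = ⊕-cong e (flat-size Es es)

      sum-⋆ : ∀ (F : Column n → ℝ) cs → Sums.sumOf ℝ-⊕ (λ p → n ⋆ F p) cs ≃ n ⋆ Sums.sumOf ℝ-⊕ F cs
      sum-⋆ F []       = ≃-sym (⋆-zero n)
      sum-⋆ F (c ∷ cs) = ≃-trans (⊕-cong ≃-refl (sum-⋆ F cs)) (≃-sym (⋆-distrib-+ (F c) (Sums.sumOf ℝ-⊕ F cs) n))

    abstract
      columns-total : n ⋆ Cuttable.total-size (columns n) cols ≃ 1ℝ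
      columns-total = ≃-trans (≃-sym (sum-⋆ (m ∘ sizeᶜ) cols)) (≃-trans
        (≃-sym (≃-trans (sumOf-concatMap ℝ-⊕ m (flat ∘ levels) cols)
          (Sums.sumOf-cong ℝ-⊕ cols (All.tabulate λ {p} _ → flat-size (levels p) (Column.even p)))))
        (≃-trans (total-measure (List.concatMap (flat ∘ levels) cols) full
            (λ x → trans (sumOf-concatMap ℕ.+-0-commutativeMonoid (λ E → ind E x) (flat ∘ levels) cols)
              (trans (sumℕ-cong cols (All.tabulate λ {p} _ → flat-count x (levels p))) (once x))))
          m-full))

  -- Cyclic towers of height suc period whose level sizes are those of parts.
  record Requirement : Set where
    field
      period : ℕ
      parts  : List Clo
      pos    : All (λ D → 0ℝ < m D) parts
      total  : suc period ⋆ Sums.sumOf ℝ-⊕ m parts ≃ 1ℝ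

  open Requirement

  module Construction (divisible : Divisible)
                      (sample : ℕ → Clo) (sample-onto : ∀ A → ∃[ n ] m (sample n) ≃ m A) where

    Valid : ℕ → List Clo → Set
    Valid h Ds = All (λ D → 0ℝ < m D) Ds × suc h ⋆ Sums.sumOf ℝ-⊕ m Ds ≃ 1ℝ

    -- The default for numbers that do not code an admissible list of level measures: a single tower
    -- of one level, the whole space.
    trivial : Requirement
    trivial = record
      { period = 0 ; parts = full ∷ [] ; pos = m-pos full {λ _ → false} refl ∷ []
      ; total = ≃-trans (⊕-identityʳ _) (≃-trans (⊕-identityʳ _) m-full) }

    fromValid : ∀ h Ds → Dec (Valid h Ds) → Requirement
    fromValid h Ds (yes (p , t)) = record { period = h ; parts = Ds ; pos = p ; total = t }
    fromValid h Ds (no _)        = trivial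

    fromList : List ℕ → Requirement
    fromList []       = trivial
    fromList (h ∷ ks) = fromValid h (List.map sample ks) em

    requirement : ℕ → Requirement
    requirement n = fromList (decode n)

    Realises : Requirement → ℕ → List Clo → Set
    Realises r h Ds = period r ≡ h × Pointwise (λ D E → m D ≃ m E) (parts r) Ds

    abstract
      requirement-onto : ∀ h Ds → Valid h Ds → ∃[ n ] Realises (requirement n) h Ds
      requirement-onto h Ds (p , t) =
        let (ks , es) = samples Ds
            (n , e) = decode-onto (h ∷ ks)
        in n , subst (λ l → Realises (fromList l) h Ds) (sym e) (go ks es em)
        where
        samples : ∀ Ds → ∃[ ks ] Pointwise (λ D E → m D ≃ m E) (List.map sample ks) Ds
        samples []       = [] , []
        samples (D ∷ Ds) = let (k , e) = sample-onto D
                               (ks , es) = samples Ds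
                           in k ∷ ks , e ∷ es
        pos-≃ : ∀ {Cs Ds} → Pointwise (λ D E → m D ≃ m E) Cs Ds → All (λ D → 0ℝ < m D) Ds → All (λ D → 0ℝ < m D) Cs
        pos-≃ []       []       = []
        pos-≃ (e ∷ es) (p ∷ ps) = <-resp ≃-refl (≃-sym e) p ∷ pos-≃ es ps
        total-≃ : ∀ {Cs Ds} → Pointwise (λ D E → m D ≃ m E) Cs Ds → Sums.sumOf ℝ-⊕ m Cs ≃ Sums.sumOf ℝ-⊕ m Ds
        total-≃ []       = ≃-refl
        total-≃ (e ∷ es) = ⊕-cong e (total-≃ es)
        go : ∀ ks → Pointwise (λ D E → m D ≃ m E) (List.map sample ks) Ds → (d : Dec (Valid h (List.map sample ks))) →
             Realises (fromValid h (List.map sample ks) d) h Ds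
        go ks es (yes _) = refl , es
        go ks es (no ¬v) = contradiction (pos-≃ es p , ≃-trans (⋆-congʳ (suc h) (total-≃ es)) t) ¬v

    record Stage : Set where
      field
        height : ℕ
        cols   : List (Column (suc height))
        once   : ∀ x → sumℕ (λ p → count x (levels p)) cols ≡ 1

      pairs : List (Clo × Clo)
      pairs = pairs-of (List.map levels cols)

    open Stage

    initial-stage : Stage
    initial-stage = record
      { height = 0
      ; cols = record { levels = full ∷ [] ; size = full ; even = ≃-refl ∷ [] ; pos = m-pos full {λ _ → false} refl } ∷ []
      ; once = λ _ → refl }

    module Step (S : Stage) (b : Clo) (r : Requirement) where
      N = height S
      h = period r

      -- The two conditions that yield `parents` and `small` of the approximation: transitions
      -- refine those of the previous stage, and each level is decided by `b`. Both survive
      -- splitting and stacking.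
      Fits : ∀ {n} → Vec Clo n → Set
      Fits Es = All (PairIn (pairs S)) (cyc Es) × AllV (Decided b) Es

      FitsC : ∀ {n} → Column n → Set
      FitsC p = Fits (levels p)

      fits-≼ : ∀ {n} (Fs Es : Vec Clo n) → Fs ≼ Es → Fits Es → Fits Fs
      fits-≼ Fs Es s (o , d) = pairs-trans o (cyc-≼ Fs Es s)
        , AllV.lookup⁻ (λ t → ⊑-decided {b} {lookup Es t} {lookup Fs t} (s t) (AllV.lookup⁺ d t))

      fits-split : ∀ {n} {p q s : Column n} → ColumnSplit p q s → Fits (levels p) → Fits (levels q) × Fits (levels s)
      fits-split {p = p} {q} {s} c f = fits-≼ (levels q) (levels p) (ColumnSplit.splitˡ c) f
                                     , fits-≼ (levels s) (levels p) (ColumnSplit.splitʳ c) f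

      fits-concat : ∀ {n k} (Es : Vec Clo n) (Bs : Vec (Vec Clo n) k) → AllV (_≼ Es) Bs → Fits Es → Fits (Vec.concat Bs)
      fits-concat Es Bs s (o , d) = pairs-trans o (cyc-blocks Es Bs s)
        , AllV.concat⁺ (AllV.map (λ {B} s′ → AllV.lookup⁻ (λ t → ⊑-decided {b} {lookup Es t} {lookup B t} (s′ t) (AllV.lookup⁺ d t))) s)

      tasks : List (Fin (suc N) × Clo)
      tasks = List.map (_, b) (List.allFin (suc N))

      Above : Column (suc N) → Set
      Above p = All (PairIn (pairs S)) (cyc (levels p))

      above-split : ∀ {p q s : Column (suc N)} → ColumnSplit p q s → Above p → Above q × Above s
      above-split {p} {q} {s} c o = pairs-trans o (cyc-≼ (levels q) (levels p) (ColumnSplit.splitˡ c))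
                                  , pairs-trans o (cyc-≼ (levels s) (levels p) (ColumnSplit.splitʳ c))

      cols-above : ∀ (cs : List (Column (suc N))) → All (λ p → All (PairIn (pairs-of (List.map levels cs))) (cyc (levels p))) cs
      cols-above []       = []
      cols-above (c ∷ cs) =
        All.tabulate (λ {p} p∈ → Any.++⁺ˡ (lose p∈ ((λ _ h → h) , (λ _ h → h)))) ∷
        All.map (All.map (Any.++⁺ʳ (cyc (levels c)))) (cols-above cs)

      tasks-decided : ∀ {p} → DecidedBy tasks p → AllV (Decided b) (levels p)
      tasks-decided ds = AllV.lookup⁻ λ t → All.lookup (All.map⁻ ds) (∈-allFin t)

      abstract
        refined : ∃[ qs ] (Ref (cols S) qs × All FitsC qs)
        refined =
          let (qs , r , d) = refine-each (decide-all tasks) (cols S)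
          in qs , r , All.map (λ { {p} (o , d) → o , tasks-decided {p} d })
                        (All.zip (ref-all (λ {p} {q} {s} → above-split {p} {q} {s}) r (cols-above (cols S)) , d))

        raise-one : ∀ (p : Column (suc N)) → Fits (levels p) →
          Σ[ q ∈ Column (suc h ℕ.* suc N) ] Fits (levels q) × (∀ x → count x (levels q) ≡ count x (levels p))
        raise-one p f =
          let (C , 0<C , e) = divisor divisible (sizeᶜ p) h (posᶜ p)
              open Raised (raise p C 0<C h e) renaming (column to raised)
          in raised , subst Fits (sym levels-concat) (fits-concat (levels p) blocks blocks-≼ f) , count-raised

        raise-all : ∀ ps → All (FitsC {suc N}) ps → Σ[ qs ∈ List (Column (suc h ℕ.* suc N)) ] All (FitsC {suc h ℕ.* suc N}) qs ×
                    (∀ x → sumℕ (λ q → count x (levels q)) qs ≡ sumℕ (λ p → count x (levels p)) ps)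
        raise-all []       []       = [] , [] , λ _ → refl
        raise-all (p ∷ ps) (f ∷ fs) =
          let (q , g , c) = raise-one p f
              (qs , gs , cs) = raise-all ps fs
          in q ∷ qs , g ∷ gs , λ x → cong₂ ℕ._+_ (c x) (cs x)

      thin : List (Column (suc N))
      thin = proj₁ refined

      thin-ref : Ref (cols S) thin
      thin-ref = proj₁ (proj₂ refined)

      thin-fits : All FitsC thin
      thin-fits = proj₂ (proj₂ refined)

      tall : List (Column (suc h ℕ.* suc N))
      tall = proj₁ (raise-all thin thin-fits)

      tall-fits : All FitsC tall
      tall-fits = proj₁ (proj₂ (raise-all thin thin-fits))

      tall-once : ∀ x → sumℕ (λ q → count x (levels q)) tall ≡ 1
      tall-once x = trans (proj₂ (proj₂ (raise-all thin thin-fits)) x) (trans (sym (ref-count thin-ref x)) (once S x))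

      -- Required towers of height `suc h` must be raised by the factor `suc N` to become as high as
      -- `tall`, which divides their level measures by `suc N`. A column without levels stands for
      -- such a bare size.
      Fraction : Column 0 → Clo → Set
      Fraction c D = suc N ⋆ m (sizeᶜ c) ≃ m D

      abstract
        fractions : ∀ {Ds} → All (λ D → 0ℝ < m D) Ds → Σ[ cs ∈ List (Column 0) ] Pointwise Fraction cs Ds
        fractions []             = [] , []
        fractions (_∷_ {D} p ps) =
          let (C , 0<C , e) = divisor divisible D N p
              (cs , es) = fractions ps
          in record { levels = [] ; size = C ; even = [] ; pos = 0<C } ∷ cs , e ∷ es

      fracs : List (Column 0)
      fracs = proj₁ (fractions (pos r))

      fractions-total : ∀ {cs Ds} → Pointwise Fraction cs Ds → suc N ⋆ Cuttable.total-size (columns 0) cs ≃ Sums.sumOf ℝ-⊕ m Ds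
      fractions-total []       = ⋆-zero (suc N)
      fractions-total (_∷_ {c} {D} {cs} e es) = ≃-trans (⋆-distrib-+ (m (sizeᶜ c)) (Cuttable.total-size (columns 0) cs) (suc N)) (⊕-cong e (fractions-total es))

      open Coupling (columns (suc h ℕ.* suc N)) (columns 0) using (couple; SameSize)

      abstract
        -- Both totals are the reciprocal of the common height `suc h * suc N`: for `tall` because
        -- its levels partition the space, for `fracs` by the total in the requirement.
        equal-totals : Cuttable.total-size (columns (suc h ℕ.* suc N)) tall ≃ Cuttable.total-size (columns 0) fracs
        equal-totals = ⋆-cancel h (⋆-cancel N (commute (≃-trans
          (columns-total tall tall-once) (≃-sym (≃-trans
            (≃-sym (⋆-assocˡ (Cuttable.total-size (columns 0) fracs) (suc h) (suc N)))
            (≃-trans (⋆-congʳ (suc h) (fractions-total (proj₂ (fractions (pos r))))) (total r)))))))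
          where
          commute : ∀ {x y} → (suc h ℕ.* suc N) ⋆ x ≃ (suc h ℕ.* suc N) ⋆ y → suc N ⋆ (suc h ⋆ x) ≃ suc N ⋆ (suc h ⋆ y)
          commute {x} {y} e = ≃-trans (flipped x) (≃-trans e (≃-sym (flipped y)))
            where
            flipped : ∀ x → suc N ⋆ (suc h ⋆ x) ≃ (suc h ℕ.* suc N) ⋆ x
            flipped x = ≃-trans (⋆-assocˡ x (suc N) (suc h)) (subst (λ k → k ⋆ x ≃ (suc h ℕ.* suc N) ⋆ x) (ℕ.*-comm (suc h) (suc N)) ≃-refl)

      coupled = couple tall fracs equal-totals
      matched = proj₁ coupled

      next : Stage
      next = record
        -- Its successor is definitionally `suc h * suc N`, the height of the columns in `tall`.
        { height = N ℕ.+ h ℕ.* suc N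
        ; cols = List.map proj₁ matched
        ; once = λ x → trans (sym (ref-count (proj₁ (proj₂ coupled)) x)) (tall-once x) }

      next-fits : All FitsC (cols next)
      next-fits = ref-all (λ {p} {q} {s} → fits-split {p = p} {q} {s}) (proj₁ (proj₂ coupled)) tall-fits

      next-realises : Ref fracs (List.map proj₂ matched) × All (λ (p , q) → SameSize p q) matched
      next-realises = proj₂ (proj₂ coupled)

    stages : ℕ → Stage
    stages zero    = initial-stage
    stages (suc n) = Step.next (stages n) (bit n) (requirement n)

    approximation : Approximation
    approximation = record
      { stage = λ n → pairs (stages n)
      ; once₁ = λ n x → trans (flatten (λ (a , _) → ind a x) (cols (stages n)))
                  (trans (sumℕ-cong (cols (stages n)) (All.tabulate λ {p} _ → cyc-count₁ x (levels p))) (once (stages n) x))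
      ; once₂ = λ n x → trans (flatten (λ (_ , b) → ind b x) (cols (stages n)))
                  (trans (sumℕ-cong (cols (stages n)) (All.tabulate λ {p} _ → cyc-count₂ x (levels p))) (once (stages n) x))
      ; sizes = λ n → All-concatMap⁺ cyc {List.map levels (cols (stages n))} (All.map⁺ (All.tabulate λ {p} _ →
                  All.map (λ (e , f) → ≃-trans e (≃-sym f) , <-resp ≃-refl (≃-sym e) (posᶜ p)) (cyc-all (levels p) (Column.even p))))
      ; parents = λ n → All-concatMap⁺ cyc {List.map levels (cols (stages (suc n)))} (All.map⁺ (All.map proj₁ (Step.next-fits (stages n) (bit n) (requirement n))))
      ; small = λ n → All-concatMap⁺ cyc {List.map levels (cols (stages (suc n)))} (All.map⁺ (All.map (λ {p} (_ , d) → cyc-all (levels p) d)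
                  (Step.next-fits (stages n) (bit n) (requirement n))))
      }
      where
      flatten : ∀ {n} (F : Clo × Clo → ℕ) (cs : List (Column n)) → sumℕ F (pairs-of (List.map levels cs)) ≡ sumℕ (λ p → sumℕ F (cyc (levels p))) cs
      flatten F cs = trans (sumOf-concatMap ℕ.+-0-commutativeMonoid F cyc (List.map levels cs)) (sumℕ-map (λ Es → sumℕ F (cyc Es)) levels cs)

    universal : Homeo M
    universal = Homeomorphism.homeo approximation

    universal-shifts : ∀ n {p} → p ∈ cols (stages n) → ∀ {a b} → (a , b) ∈ cyc (levels p) →
                       ∀ x → x ∈ᶜ a → Homeo.to universal x ∈ᶜ b
    universal-shifts n p∈ ab∈ = Homeomorphism.to-maps approximation n
      (∈-concatMap⁺ cyc {xs = List.map levels (cols (stages n))} (lose (∈-map⁺ levels p∈) ab∈))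

-- Density of its conjugacy class

module Conjugation (em : ∀ {P : Set} → Dec P) (M : ProbabilityMeasure) (G : IsGood M) where
  open RealOrder em
  open Cutting em M G
  open Columns em M G
  open BackAndForth em M G

  module _ {n : ℕ} (pqs : List (Column n × Column n))
           (once₁ : ∀ x → sumℕ (λ (p , _) → count x (levels p)) pqs ≡ 1)
           (once₂ : ∀ x → sumℕ (λ (_ , q) → count x (levels q)) pqs ≡ 1)
           (same : All (λ (p , q) → m (sizeᶜ p) ≃ m (sizeᶜ q)) pqs) where

    Edge : Set
    Edge = (Column n × Column n) × (Fin n × Fin n)

    turns : List (Fin n × Fin n)
    turns = cyc (Vec.allFin n)

    edges : List Edge
    edges = List.concatMap (λ pq → List.map (pq ,_) turns) pqs

    level-pair : Edge → Clo × Clo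
    level-pair ((p , q) , (t , _)) = level p t , level q t

    turn-count : ∀ x (p : Column n) → sumℕ (λ (t , _) → ind (level p t) x) turns ≡ count x (levels p)
    turn-count x p = trans (sym (sumℕ-map (λ (a , _) → ind a x) (λ (t , t′) → level p t , level p t′) turns))
      (trans (cong (count₁ x) (sym (cyc-lookup (levels p)))) (cyc-count₁ x (levels p)))

    edge-count : ∀ x (pick : Column n × Column n → Column n) →
                 sumℕ (λ (pq , (t , _)) → ind (level (pick pq) t) x) edges ≡ sumℕ (λ pq → count x (levels (pick pq))) pqs
    edge-count x pick = trans
      (sumOf-concatMap ℕ.+-0-commutativeMonoid (λ (pq , (t , _)) → ind (level (pick pq) t) x) (λ pq → List.map (pq ,_) turns) pqs)
      (sumℕ-cong pqs (All.tabulate λ {pq} _ →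
        trans (sumℕ-map (λ (pq , (t , _)) → ind (level (pick pq) t) x) (pq ,_) turns) (turn-count x (pick pq))))

    pieces : List (Clo × Clo)
    pieces = List.map level-pair edges

    pieces-sizes : All (λ (a , b) → m a ≃ m b × 0ℝ < m a) pieces
    pieces-sizes = All.map⁺ (All-concatMap⁺ (λ pq → List.map (pq ,_) turns) (All.map (λ { {(p , q)} e →
      All.map⁺ (All.tabulate λ {(t , _)} _ →
        ≃-trans (level-size p t) (≃-trans e (≃-sym (level-size q t))) ,
        <-resp ≃-refl (≃-sym (level-size p t)) (posᶜ p)) }) same))

    pieces-once₁ : ∀ x → count₁ x pieces ≡ 1
    pieces-once₁ x = trans (sumℕ-map (λ (a , _) → ind a x) level-pair edges) (trans (edge-count x proj₁) (once₁ x))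

    pieces-once₂ : ∀ x → count₂ x pieces ≡ 1
    pieces-once₂ x = trans (sumℕ-map (λ (_ , b) → ind b x) level-pair edges) (trans (edge-count x proj₂) (once₂ x))

    conjugator : Homeo M
    conjugator = extension-homeo pieces pieces-once₁ pieces-once₂ pieces-sizes

    -- The conjugator matches level t of `p` with level t of `q`. Going back from `q` to `p`, moving
    -- up one level by `g` and returning therefore moves a point up one level of `q`.
    conjugate-moves : (g : Homeo M) →
      (∀ {p} → p ∈ List.map proj₁ pqs → ∀ {a b} → (a , b) ∈ cyc (levels p) → ∀ x → x ∈ᶜ a → Homeo.to g x ∈ᶜ b) →
      ∀ x → ∃[ q ] (q ∈ List.map proj₂ pqs × Σ[ (a , b) ∈ Clo × Clo ] ((a , b) ∈ cyc (levels q) ×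
        x ∈ᶜ a × Homeo.to conjugator (Homeo.to g (Homeo.from conjugator x)) ∈ᶜ b))
    conjugate-moves g moves x =
      let (((p , q) , (t , t′)) , e∈ , x∈) = count-witness (λ (pq , (t , _)) → level (proj₂ pq) t) x edges (trans (edge-count x proj₂) (once₂ x))
          (pq∈ , tt′∈) = edge-inv e∈
          y∈ = extension-from pieces pieces-once₁ pieces-once₂ pieces-sizes (∈-map⁺ level-pair e∈) x x∈
          z∈ = moves (∈-map⁺ proj₁ pq∈) (turn-∈ p tt′∈) _ y∈
          -- Each matched pair of levels is listed under the first index of a turn. To carry the
          -- image back from level `t′`, a turn that starts at `t′` is needed.
          (u , e′∈) = next tt′∈
      in q , ∈-map⁺ proj₂ pq∈ , (level q t , level q t′) , turn-∈ q tt′∈ , x∈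
       , extension-to pieces pieces-once₁ pieces-once₂ pieces-sizes (∈-map⁺ level-pair (edge-mk pq∈ e′∈)) _ z∈
      where
      turn-∈ : ∀ (p : Column n) {t t′} → (t , t′) ∈ turns → (level p t , level p t′) ∈ cyc (levels p)
      turn-∈ p {t} {t′} h = subst ((level p t , level p t′) ∈_) (sym (cyc-lookup (levels p))) (∈-map⁺ (λ (t , t′) → level p t , level p t′) h)
      edge-inv : ∀ {pq tt} → (pq , tt) ∈ edges → pq ∈ pqs × tt ∈ turns
      edge-inv {pq} {tt} h with find (∈-concatMap⁻ (λ pq → List.map (pq ,_) turns) {xs = pqs} h)
      ... | pq′ , pq∈ , h′ with ∈-map⁻ (pq′ ,_) h′
      ... | _ , tt∈ , refl = pq∈ , tt∈
      edge-mk : ∀ {pq tt} → pq ∈ pqs → tt ∈ turns → (pq , tt) ∈ edges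
      edge-mk {pq} pq∈ tt∈ = ∈-concatMap⁺ (λ pq → List.map (pq ,_) turns) {xs = pqs} (lose pq∈ (∈-map⁺ (pq ,_) tt∈))
      next : ∀ {t t′} → (t , t′) ∈ turns → ∃[ u ] (t′ , u) ∈ turns
      next {t′ = t′} _ = starts (Vec.allFin n) (∈-allFin⁺ t′)
        where
        open import Data.Vec.Membership.Propositional renaming (_∈_ to _∈ᵛ_)
        open import Data.Vec.Membership.Propositional.Properties using () renaming (∈-allFin⁺ to ∈-allFin⁺)
        import Data.Vec.Relation.Unary.Any as AnyV
        path-starts : ∀ {A : Set} {n} (as : Vec A n) f {a} → a ∈ᵛ as → ∃[ b ] (a , b) ∈ path as f
        path-starts (a ∷ as) f (AnyV.here refl) = _ , here refl
        path-starts (a ∷ as) f (AnyV.there h)   = let (b , k) = path-starts as f h in b , there k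
        starts : ∀ {A : Set} {n} (as : Vec A n) {a} → a ∈ᵛ as → ∃[ b ] (a , b) ∈ cyc as
        starts (a ∷ as) h = path-starts (a ∷ as) a h

module Density (em : ∀ {P : Set} → Dec P) (M : ProbabilityMeasure) (G : IsGood M)
  (divisible : Columns.Divisible em M G)
  (sample : ℕ → Clo) (sample-onto : ∀ A → ∃[ n ] Cutting.m em M G (sample n) ≃ Cutting.m em M G A) where
  open RealOrder em
  open Compactness em
  open Cutting em M G
  open Columns em M G
  open Conjugation em M G
  open Universal em M G
  open Construction divisible sample sample-onto

  module Approximate (h : Homeo M) {k} (Cs : Vec Clo k) where
    open Periodic em M G h Cs hiding (module Step)
    open Raising divisible

    matching : ∀ {n} (ms : List (Column n × Column 0)) qs → All (λ (p , c) → m (sizeᶜ p) ≃ m (sizeᶜ c)) ms →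
               Pointwise (λ c q → m (sizeᶜ c) ≃ m (sizeᶜ q)) (List.map proj₂ ms) qs →
               Σ[ pqs ∈ List (Column n × Column n) ] List.map proj₁ pqs ≡ List.map proj₁ ms ×
                 List.map proj₂ pqs ≡ qs × All (λ (p , q) → m (sizeᶜ p) ≃ m (sizeᶜ q)) pqs
    matching []             []       []       []       = [] , refl , refl , []
    matching ((p , c) ∷ ms) (q ∷ qs) (e ∷ es) (f ∷ fs) =
      let (pqs , l , r , s) = matching ms qs es fs
      in (p , q) ∷ pqs , cong (p ∷_) l , cong (q ∷_) r , ≃-trans e f ∷ s

    raise-cycles : ∀ {n H} j → suc j ℕ.* n ≡ H → (cs : List (Cycle n)) → ∀ {frs Ds} →
                   Pointwise (λ c D → suc j ⋆ m (sizeᶜ {0} c) ≃ m D) frs Ds →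
                   Pointwise (λ D E → m D ≃ m E) Ds (List.map (sizeᶜ ∘ tower) cs) →
                   Σ[ ds ∈ List (Cycle H) ] Pointwise (λ c d → m (sizeᶜ c) ≃ m (sizeᶜ d)) frs (List.map tower ds) ×
                     (∀ x → sumℕ (λ d → count x (levels (tower d))) ds ≡ sumℕ (λ c → count x (levels (tower c))) cs)
    raise-cycles j hH []       []       []       = [] , [] , λ _ → refl
    raise-cycles j hH (c ∷ cs) (e ∷ es) (f ∷ fs) =
      let (d , g , v)    = raise-cycle j hH c
          (ds , gs , vs) = raise-cycles j hH cs es fs
      in d ∷ ds , ⋆-cancel j (≃-trans e (≃-trans f (≃-sym g))) ∷ gs , λ x → cong₂ ℕ._+_ (v x) (vs x)

    Rotates : ∀ {n} → Column n → Set
    Rotates q = ∃[ v ] Walk v v (levels q)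

    rotates-split : ∀ {n} {p q r : Column n} → ColumnSplit p q r → Rotates p → Rotates q × Rotates r
    rotates-split s (v , w) = (v , walk-≼ (ColumnSplit.splitˡ s) w) , (v , walk-≼ (ColumnSplit.splitʳ s) w)

    towers-rotate : ∀ {n} (cs : List (Cycle n)) → All Rotates (List.map tower cs)
    towers-rotate []       = []
    towers-rotate (c ∷ cs) = (_ , closed c) ∷ towers-rotate cs

    module Realise {hh} (cs : List (Cycle (suc hh))) (once : ∀ x → sumℕ (λ c → count x (levels (tower c))) cs ≡ 1)
                   (S : Stage) (b : Clo) (r : Requirement) (same-period : Requirement.period r ≡ hh)
                   (parts≃ : Pointwise (λ D E → m D ≃ m E) (Requirement.parts r) (List.map (sizeᶜ ∘ tower) cs)) where
      open Step S b r using (N; matched; fracs; fractions; next; next-realises)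

      H : ℕ
      H = suc (Requirement.period r) ℕ.* suc N

      heights : suc N ℕ.* suc hh ≡ H
      heights = trans (cong (λ k → suc N ℕ.* suc k) (sym same-period)) (ℕ.*-comm (suc N) (suc (Requirement.period r)))

      raised : Σ[ ds ∈ List (Cycle H) ] Pointwise (λ c d → m (sizeᶜ c) ≃ m (sizeᶜ d)) fracs (List.map tower ds) ×
                 (∀ x → sumℕ (λ d → count x (levels (tower d))) ds ≡ sumℕ (λ c → count x (levels (tower c))) cs)
      raised = raise-cycles N heights cs (proj₂ (fractions (Requirement.pos r))) parts≃

      ds : List (Cycle H)
      ds = proj₁ raised

      -- When `g` was built, its towers were matched with pieces of the bare sizes in `fracs`. The
      -- same cuts are now made in the towers of the approximation, so that their pieces match the
      -- towers of `g` one by one.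
      transferred : Σ[ qs ∈ List (Column H) ] Ref (List.map tower ds) qs ×
                      Pointwise (λ c q → m (sizeᶜ c) ≃ m (sizeᶜ q)) (List.map proj₂ matched) qs
      transferred = Coupling.transfer (columns 0) (columns H) (proj₁ (proj₂ raised)) (proj₁ next-realises)

      qs : List (Column H)
      qs = proj₁ transferred

      qs-rotate : All Rotates qs
      qs-rotate = ref-all (λ {p} {q} {s} → rotates-split {p = p} {q} {s}) (proj₁ (proj₂ transferred)) (towers-rotate ds)

      paired : Σ[ pqs ∈ List (Column H × Column H) ] List.map proj₁ pqs ≡ List.map proj₁ matched ×
                 List.map proj₂ pqs ≡ qs × All (λ (p , q) → m (sizeᶜ p) ≃ m (sizeᶜ q)) pqs
      paired = matching matched qs (proj₂ next-realises) (proj₂ (proj₂ transferred))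

      pqs : List (Column H × Column H)
      pqs = proj₁ paired

      pqs₁ : List.map proj₁ pqs ≡ List.map proj₁ matched
      pqs₁ = proj₁ (proj₂ paired)

      pqs₂ : List.map proj₂ pqs ≡ qs
      pqs₂ = proj₁ (proj₂ (proj₂ paired))

      same : All (λ (p , q) → m (sizeᶜ p) ≃ m (sizeᶜ q)) pqs
      same = proj₂ (proj₂ (proj₂ paired))

      once₁ : ∀ x → sumℕ (λ (p , _) → count x (levels p)) pqs ≡ 1
      once₁ x = trans (sym (sumℕ-map (λ p → count x (levels p)) proj₁ pqs))
        (trans (cong (sumℕ (λ p → count x (levels p))) pqs₁) (Stage.once next x))

      once₂ : ∀ x → sumℕ (λ (_ , q) → count x (levels q)) pqs ≡ 1
      once₂ x = trans (sym (sumℕ-map (λ q → count x (levels q)) proj₂ pqs))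
        (trans (cong (sumℕ (λ q → count x (levels q))) pqs₂)
          (trans (sym (ref-count (proj₁ (proj₂ transferred)) x))
            (trans (sumℕ-map (λ q → count x (levels q)) tower ds) (trans (proj₂ (proj₂ raised) x) (once x)))))

      realise : (g : Homeo M) →
        (∀ {p} → p ∈ Stage.cols next → ∀ {a b} → (a , b) ∈ cyc (levels p) → ∀ x → x ∈ᶜ a → Homeo.to g x ∈ᶜ b) →
        Σ[ k ∈ Homeo M ] (∀ x → β x ≡ α (Homeo.to k (Homeo.to g (Homeo.from k x))))
      realise g moves = conjugator pqs once₁ once₂ same , λ x →
        let (q , q∈ , (a , b) , ab∈ , x∈ , y∈) = conjugate-moves pqs once₁ once₂ same g
              (λ {p} p∈ → moves (subst (p ∈_) pqs₁ p∈)) x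
            (v , w) = All.lookup qs-rotate (subst (q ∈_) pqs₂ q∈)
        in All.lookup (walkable-cyc w) ab∈ x _ x∈ y∈

    abstract
      approximate : Σ[ k ∈ Homeo M ] (∀ x → β x ≡ α (Homeo.to k (Homeo.to universal (Homeo.from k x))))
      approximate =
        let (hh , cs , once) = cycles
            total = columns-total (List.map tower cs) (λ x → trans (sumℕ-map (λ p → count x (levels p)) tower cs) (once x))
            (n , realises) = requirement-onto hh (List.map (sizeᶜ ∘ tower) cs)
              ( All.map⁺ (All.tabulate λ {c} _ → posᶜ (tower c))
              , ≃-trans (⋆-congʳ (suc hh) (≃-trans (Sums.sumOf-map ℝ-⊕ m (sizeᶜ ∘ tower) cs)
                  (≃-sym (Sums.sumOf-map ℝ-⊕ (m ∘ sizeᶜ) tower cs)))) total)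
        -- Requirement `n` is imposed in passing from stage `n` to the next, so the matching towers
        -- are those of stage `suc n`.
        in Realise.realise cs once (stages n) (bit n) (requirement n) (proj₁ realises) (proj₂ realises)
             universal (universal-shifts (suc n))

  private
    Subbasic : Set₁
    Subbasic = ∃ Compact × ∃ Open

    Within : Homeo M → Subbasic → Set
    Within f ((K , _) , (W , _)) = ∀ {x} → K x → W (Homeo.to f x)

  -- For each condition take a clopen `C` between the compact set and the preimage of the open set
  -- under `h`. If `f` followed by the inverse of `h` maps `C` into itself, then applying `h` again
  -- shows that `f` maps the compact set into the open one.
  clopen-data : ∀ h (is : List Subbasic) → All (Within h) is →
                ∃[ k ] Σ[ Cs ∈ Vec Clo k ] (∀ f →
                  (∀ t x → x ∈ᶜ lookup Cs t → Homeo.from h (Homeo.to f x) ∈ᶜ lookup Cs t) → All (Within f) is)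
  clopen-data h []                              []       = 0 , [] , λ _ _ → []
  clopen-data h (((K , cK) , (W , oW)) ∷ is) (s ∷ ss) =
    let (C , K⊆ , C⊆) = clopen-between cK (Homeo.to-continuous h oW) (λ {x} → s {x})
        (k , Cs , f⊆) = clopen-data h is ss
    in suc k , C ∷ Cs , λ f hyp →
      (λ {x} Kx → open-resp-≗ oW (Homeo.strictlyInverseˡ h (Homeo.to f x)) (C⊆ (hyp zero x (K⊆ Kx)))) ∷ f⊆ f (hyp ∘ suc)

  rokhlin : HomeoHasRokhlin M
  rokhlin = universal , λ {O} O-open (h , Oh) →
    let (is , on , sub) = O-open Oh
        (k , Cs , f⊆) = clopen-data h is on
        (c , moves) = Approximate.approximate h Cs
        f = Group._∙_ (HomeoGroup M) (Group._∙_ (HomeoGroup M) c universal) (Group._⁻¹ (HomeoGroup M) c)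
    in f , sub (f⊆ f (λ t x x∈ → Periodic.β≡α⇒ em M G h Cs (moves x) t x∈)) , c , λ _ _ → refl

-- The converse and the theorem

module Converse (em : ∀ {P : Set} → Dec P) (M : ProbabilityMeasure) (G : IsGood M) where
  open RealOrder em
  open Compactness em
  open MeasureTheory em
  open Cutting em M G
  open Columns em M G
  open BackAndForth em M G
  open ProbabilityMeasure M using (μ; μ-cong)
  open Homeo

  m-mono : ∀ {A B} → A ⊑ B → m A ≤ m B
  m-mono {A} {B} A⊑B = ≤-trans (≃⇒≤ (m-μ A)) (≤-trans
    (Measure.μ-mono M (cloᵇ A) (cloᵇ B) (λ {x} → A⊑B x)) (≃⇒≤ (≃-sym (m-μ B))))

  pullback : Homeo M → Clo → Clo
  pullback k = preimageᶜ (to-continuous k)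

  m-pullback : ∀ k A → m (pullback k A) ≃ m A
  m-pullback k A = ≃-trans (m-μ (pullback k A)) (≃-trans
    (μ-cong (cloᵇ (pullback k A)) (preimage-Borel (to-continuous k) (cloᵇ A))
      (∈-preimage⁻ (to-continuous k) A , ∈-preimage⁺ (to-continuous k) A))
    (≃-trans (preserves k (cloᵇ A)) (≃-sym (m-μ A))))

  Maps : List (Clo × Clo) → Pred (Homeo M) 0ℓ
  Maps L f = All (λ (a , b) → ∀ x → x ∈ᶜ a → to f x ∈ᶜ b) L

  maps-open : ∀ L → CompactOpen M (Maps L)
  maps-open L h = List.map subbasic L , All.map⁺ (All.map (λ k {x} → k x) h) , λ h′ → All.map (λ k x → k {x}) (All.map⁻ h′)
    where
    subbasic : Clo × Clo → ∃ Compact × ∃ Open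
    subbasic (a , b) = (⟦ a ⟧ , Clo-compact a) , (⟦ b ⟧ , proj₁ (clopen b))

  module _ {g f k : Homeo M} (conj : ∀ x → to f x ≗ to k (to g (from k x))) where

    conjugated : ∀ {a b} → (∀ x → x ∈ᶜ a → to f x ∈ᶜ b) → ∀ y → y ∈ᶜ pullback k a → to g y ∈ᶜ pullback k b
    conjugated {a} {b} h y y∈ = ∈-preimage⁺ (to-continuous k) b (trans
      (χ-≗ b λ i → sym (trans (conj (to k y) i) (to-cong k (to-cong g (strictlyInverseʳ k y)) i)))
      (h (to k y) (∈-preimage⁻ (to-continuous k) a y∈)))

  module Chain (w : Clo → ℝ) where

    path-upper : ∀ {n} (as : Vec Clo n) {f} → All (λ (a , b) → w a ≤ w b) (path as f) → AllV (λ a → w a ≤ w f) as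
    path-upper []            []       = []
    path-upper (a ∷ [])      (h ∷ []) = h ∷ []
    path-upper (a ∷ a′ ∷ as) (h ∷ hs) with path-upper (a′ ∷ as) hs
    ... | k ∷ ks = ≤-trans h k ∷ k ∷ ks

    path-lower : ∀ {n c} (as : Vec Clo n) {f} → All (λ (a , b) → w a ≤ w b) (path as f) → c ≤ w (headOr f as) → AllV (λ a → c ≤ w a) as
    path-lower []       []       _ = []
    path-lower (a ∷ as) (h ∷ hs) k = k ∷ path-lower as hs (≤-trans k h)

    -- Followed forwards from `a`, the inequalities bound every weight from below by that of `a`;
    -- followed on to the return to `a`, they bound it from above.
    cyc-constant : ∀ {n} (a : Clo) (as : Vec Clo n) → All (λ (a , b) → w a ≤ w b) (cyc (a ∷ as)) → AllV (λ b → w b ≃ w a) (a ∷ as)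
    cyc-constant a as h = AllV.map (λ (p , q) → ≤-antisym p q) (AllV.zip (path-upper (a ∷ as) h , path-lower (a ∷ as) h ≤-refl))

  -- g cyclically permutes clopen sets B₀, …, Bₙ partitioning the space and fixes
  -- a clopen set Y with m Y ≃ m Z; hence m Y ≃ (n + 1) m (B₀ ∩ Y).
  division : HomeoHasRokhlin M → ∀ {n} (P : Column (suc n)) → (∀ x → count x (levels P) ≡ 1) →
             ∀ Z → 0ℝ < m Z → ∃[ C ] suc n ⋆ m C ≃ m Z
  division (g , dense) {n} P once Z 0<Z =
    let h₁ = extension-homeo L (λ x → trans (cyc-count₁ x (levels P)) (once x)) (λ x → trans (cyc-count₂ x (levels P)) (once x)) sizes
        (f₁ , F₁ , k₁ , c₁) = dense (λ {f} → maps-open L {f}) (h₁ , All.tabulate λ p∈ →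
          extension-to L (λ x → trans (cyc-count₁ x (levels P)) (once x)) (λ x → trans (cyc-count₂ x (levels P)) (once x)) sizes p∈)
        (f₂ , F₂ , k₂ , c₂) = dense (λ {f} → maps-open ((Z , Z) ∷ []) {f}) (Group.ε (HomeoGroup M) , (λ _ h → h) ∷ [])
    in pieces-equal (levels P) once {f₁} {f₂} {k₁} {k₂} F₁ F₂ c₁ c₂
    where
    L : List (Clo × Clo)
    L = cyc (levels P)
    sizes : All (λ (a , b) → m a ≃ m b × 0ℝ < m a) L
    sizes = All.map (λ (e , f) → ≃-trans e (≃-sym f) , <-resp ≃-refl (≃-sym e) (posᶜ P)) (cyc-all (levels P) (Column.even P))
    pieces-equal : ∀ {n} (Es : Vec Clo (suc n)) → (∀ x → count x Es ≡ 1) → ∀ {f₁ f₂ k₁ k₂} → Maps (cyc Es) f₁ → Maps ((Z , Z) ∷ []) f₂ →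
                   (∀ x → to f₁ x ≗ to k₁ (to g (from k₁ x))) → (∀ x → to f₂ x ≗ to k₂ (to g (from k₂ x))) →
                   ∃[ C ] suc n ⋆ m C ≃ m Z
    pieces-equal Es@(E₀ ∷ Es′) once {f₁} {f₂} {k₁} {k₂} F₁ (F₂ ∷ []) c₁ c₂ =
      part E₀ , ≃-trans (≃-sym (vec-sum Es (Chain.cyc-constant (m ∘ part) E₀ Es′ increasing)))
        (≃-trans (≃-sym (Sums.sumOf-map ℝ-⊕ m part (Vec.toList Es)))
          (≃-trans (total-measure (List.map part (Vec.toList Es)) Y covered) (m-pullback k₂ Z)))
      where
      Y : Clo
      Y = pullback k₂ Z
      B : Clo → Clo
      B = pullback k₁
      part : Clo → Clo
      part E = B E ∩ᶜ Y
      -- `g` is only known to map `part a` into `part b`; invariance of the measure turns this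
      -- inclusion into an inequality.
      increasing : All (λ (a , b) → m (part a) ≤ m (part b)) (cyc Es)
      increasing = All.map (λ { {(a , b)} h → ≤-trans
        (m-mono {part a} {pullback g (part b)} λ y y∈ → ∈-preimage⁺ (to-continuous g) (part b) (∈-∩ (B b) Y {to g y}
          (conjugated {g} {f₁} {k₁} c₁ {a} {b} h y (∩-⊑ˡ (B a) Y y y∈))
          (conjugated {g} {f₂} {k₂} c₂ {Z} {Z} F₂ y (∩-⊑ʳ (B a) Y y y∈))))
        (≃⇒≤ (m-pullback g (part b))) }) F₁
      vec-sum : ∀ {n r} (as : Vec Clo n) → AllV (λ a → m (part a) ≃ r) as → Sums.sumOf ℝ-⊕ (m ∘ part) (Vec.toList as) ≃ n ⋆ r
      vec-sum []       []       = ≃-refl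
      vec-sum (a ∷ as) (e ∷ es) = ⊕-cong e (vec-sum as es)
      vec-count : ∀ {n} y (as : Vec Clo n) → sumℕ (λ E → ind (B E) y) (Vec.toList as) ≡ count (to k₁ y) as
      vec-count y []       = refl
      vec-count y (a ∷ as) = cong₂ ℕ._+_ (cong (λ b → if b then 1 else 0) (χ-preimageᶜ (to-continuous k₁) a y)) (vec-count y as)
      covered : ∀ y → sumℕ (λ E → ind E y) (List.map part (Vec.toList Es)) ≡ ind Y y
      covered y = trans (sumℕ-map (λ E → ind E y) part (Vec.toList Es))
        (count-∩ B y Y (Vec.toList Es) (trans (vec-count y Es) (once (to k₁ y))))

  -- Stacking pieces of the one-level column on the whole space. The shape `suc (j * 1)` of the
  -- height is the one that `raise` produces.
  unit-tower : ∀ D j → suc j ⋆ m D ≃ 1ℝ → Σ[ P ∈ Column (suc (j ℕ.* 1)) ] (∀ x → count x (levels P) ≡ 1)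
  unit-tower D j e = column , count-raised
    where
    0<D : 0ℝ < m D
    0<D = ≰⇒> λ D≤0 → <⇒≱ (m-pos full {origin} refl) (≤-trans (≃⇒≤ m-full) (≤-trans (≃⇒≤ (≃-sym e))
            (≤-trans (⋆-mono-≤ (suc j) D≤0) (≃⇒≤ (⋆-zero (suc j))))))
    open Raised (raise everything D 0<D j (≃-trans e (≃-sym m-full)))

  rokhlin⇒divisible : HomeoHasRokhlin M → (∀ j → ∃[ D ] suc j ⋆ m D ≃ 1ℝ) → Divisible
  rokhlin⇒divisible R units Z j with em {0ℝ < m Z}
  ... | yes 0<Z =
    let (D , e) = units j
        (P , once) = unit-tower D j e
        (C , f) = division R P once Z 0<Z
    in C , subst (λ k → suc k ⋆ m C ≃ m Z) (ℕ.*-identityʳ j) f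
  ... | no ¬0<Z = Z , ≃-trans (⋆-congʳ (suc j) Z≃0) (≃-trans (⋆-zero (suc j)) (≃-sym Z≃0))
    where
    Z≃0 : m Z ≃ 0ℝ
    Z≃0 = ≤-antisym (dne λ h → ¬0<Z (≰⇒> h))
            (≤-trans (ProbabilityMeasure.nonneg M (cloᵇ Z)) (≃⇒≤ (≃-sym (m-μ Z))))

-- Passing between clopen measures and the set `V`

module Main (em : ∀ {P : Set} → Dec P) (V : Pred ℝ 0ℓ) (groupLike : IsGroupLike V)
            (M : ProbabilityMeasure) (goodFor : IsGoodMeasureFor V M) where
  open IsGroupLike groupLike renaming (resp to V-resp)
  open IsGoodMeasureFor goodFor
  open RealOrder em
  open Compactness em
  open Cutting em M isGood
  open Columns em M isGood using (Divisible)
  open ProbabilityMeasure M using (μ-cong)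

  measure∈V : ∀ A → V (m A)
  measure∈V A = Equivalence.from (clopenValues (m A)) (⟦ A ⟧ , clopen A , m-μ A)

  V-measure : ∀ {r} → V r → ∃[ A ] m A ≃ r
  V-measure {r} Vr =
    let (_ , a , e) = Equivalence.to (clopenValues r) Vr
        (A , ⊆A , A⊆) = clopen⇒Clo a
    in A , ≃-trans (m-μ A) (≃-trans (μ-cong _ _ (⊆A , A⊆)) (≃-sym e))

  V⊆V+ℤ : ∀ {v} → V v → (V +ℤ) v
  V⊆V+ℤ {v} Vv = v , Vv , ℤ.+ 0 , ≃-sym (+-identityʳ v)

  sample : ℕ → Clo
  sample n = proj₁ (V-measure (proj₂ (Bijection.to countablyInfinite n)))

  sample-onto : ∀ A → ∃[ n ] m (sample n) ≃ m A
  sample-onto A =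
    let (n , e) = Bijection.surjective countablyInfinite (m A , measure∈V A)
    in n , ≃-trans (proj₂ (V-measure (proj₂ (Bijection.to countablyInfinite n)))) (e refl)

  0≤1/ : ∀ d → 0ℚ ℚ.≤ (ℤ.+ 1) ℚ./ suc d
  0≤1/ d = ℚ.nonNegative⁻¹ _ {{ℚ.normalize-nonNeg 1 (suc d)}}

  1/≤1 : ∀ d → (ℤ.+ 1) ℚ./ suc d ℚ.≤ 1ℚ
  1/≤1 d = ℚ.≤-trans (ℚ.≤-reflexive (sym (ℚ.*-identityʳ q)))
    (ℚ.≤-trans (ℚ.*-monoˡ-≤-nonNeg q {{ℚ.normalize-nonNeg 1 (suc d)}} (1≤suc/1 d)) (ℚ.≤-reflexive (*-denominator (ℤ.+ 1) d)))
    where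
    q : ℚ
    q = (ℤ.+ 1) ℚ./ suc d

  module _ (ℚlike : IsℚLike V) where
    open IsℚSubspace (IsℚLike.subspace ℚlike)

    rationals∈V : ∀ q → 0ℚ ℚ.≤ q → q ℚ.≤ 1ℚ → V (fromℚ q)
    rationals∈V q 0≤q q≤1 = unit-interval-part groupLike
      (+ℤ-resp {V} (pw λ _ → ℚ.*-identityʳ q) (·-closed q (V⊆V+ℤ 1∈))) (fromℚ-mono-≤ 0≤q) (fromℚ-mono-≤ q≤1)

    divisible : Divisible
    divisible A j =
      let v = m A
          x = v /ℕ suc j
          e = ⋆-/ℕ j v
          (0≤v , v≤1) = ⊆[0,1] (measure∈V A)
          Vx = unit-interval-part groupLike (·-closed ((ℤ.+ 1) ℚ./ suc j) (V⊆V+ℤ (measure∈V A)))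
                 (⋆-cancel-≤ j (≤-trans (≃⇒≤ (⋆-zero (suc j))) (≤-trans 0≤v (≃⇒≤ (≃-sym e)))))
                 (⋆-cancel-≤ j (≤-trans (≃⇒≤ e) (≤-trans v≤1 (≤-⊕ˡ
                   (≤-trans (≃⇒≤ (≃-sym (⋆-zero j))) (⋆-mono-≤ j (fromℚ-mono-≤ (ℚ.nonNegative⁻¹ 1ℚ))))))))
          (C , f) = V-measure Vx
      in C , ≃-trans (⋆-congʳ (suc j) f) e

    ℚlike⇒ : (∀ q → 0ℚ ℚ.≤ q → q ℚ.≤ 1ℚ → V (fromℚ q)) × HomeoHasRokhlin M
    ℚlike⇒ = rationals∈V , Density.rokhlin em M isGood divisible sample sample-onto

  module _ (rationals : ∀ q → 0ℚ ℚ.≤ q → q ℚ.≤ 1ℚ → V (fromℚ q)) (R : HomeoHasRokhlin M) where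

    unit-fraction : ℕ → ℝ
    unit-fraction d = fromℚ ((ℤ.+ 1) ℚ./ suc d)

    fraction∈V : ∀ d → V (unit-fraction d)
    fraction∈V d = rationals _ (0≤1/ d) (1/≤1 d)

    units : ∀ d → ∃[ D ] suc d ⋆ m D ≃ 1ℝ
    units d =
      let (D , e) = V-measure (fraction∈V d)
      in D , ≃-trans (⋆-congʳ (suc d) (≃-trans e (pw λ _ → sym (ℚ.*-identityʳ ((ℤ.+ 1) ℚ./ suc d))))) (⋆-/ℕ d 1ℝ)

    V-divisible : Divisible
    V-divisible = Converse.rokhlin⇒divisible em M isGood R units

    -- The two summands are divided separately: `v` is the measure of a clopen set, which is
    -- divisible, and the integer `k` is divided as a multiple of the unit fraction, which lies in
    -- `V`.
    quotient : ∀ d {x} → (V +ℤ) x → ∃[ w ] ((V +ℤ) w × suc d ⋆ w ≃ x)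
    quotient d {x} (v , Vv , k , e) =
      let (A , f) = V-measure Vv
          (C , g) = V-divisible A d
          u = (k ℚ./ 1) · unit-fraction d
      in m C ⊕ u
       , +ℤ-resp {V} (≃-sym (⊕-≃ (m C) u)) (+-closed (V⊆V+ℤ (measure∈V C))
           (ℤ·-closed (+ℤ-resp {V}) subgroup k (V⊆V+ℤ (fraction∈V d))))
       , ≃-trans (⋆-distrib-+ (m C) u (suc d)) (≃-trans
           (⊕-cong (≃-trans g f) (≃-trans (⋆-congʳ (suc d) {u} {fromℤ k /ℕ suc d}
             (pw λ _ → ℚ.*-comm (k ℚ./ 1) ((ℤ.+ 1) ℚ./ suc d))) (⋆-/ℕ d (fromℤ k))))
           (≃-trans (⊕-≃ v (fromℤ k)) (≃-sym e)))
      where open IsAdditiveSubgroup subgroup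

    ⇒ℚlike : IsℚLike V
    ⇒ℚlike = record
      { isGroupLike = groupLike
      ; subspace = record
        { isAdditiveSubgroup = subgroup
        ; ·-closed = λ { q@(ℚ.mkℚ i d c) x∈ →
            let (w , w∈ , e) = quotient d x∈
            in +ℤ-resp {V} (≃-sym (·-as-multiple q e)) (ℤ·-closed (+ℤ-resp {V}) subgroup i w∈) } } }

lemma5p9 : ExcludedMiddle (lsuc 0ℓ) →
    (V : Pred ℝ 0ℓ) → IsGroupLike V →
    (μV : ProbabilityMeasure) → IsGoodMeasureFor V μV →
    IsℚLike V ⇔ ((∀ q → 0ℚ ℚ.≤ q → q ℚ.≤ 1ℚ → V (fromℚ q)) × HomeoHasRokhlin μV)
lemma5p9 em₁ V groupLike μV goodFor = mk⇔ Result.ℚlike⇒ (λ (q , R) → Result.⇒ℚlike q R)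
  where
  em : ∀ {P : Set} → Dec P
  em {P} with em₁ {Lift (lsuc 0ℓ) P}
  ... | yes (lift p) = yes p
  ... | no ¬p        = no (λ p → ¬p (lift p))
  module Result = Main em V groupLike μV goodFor
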